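{- Let $(\mathcal{A},\varphi)$ be a non-commutative probability space and let $\mathcal{M}, \mathcal{N} \subseteq \mathcal{A}$ be two unital subalgebras which are freely independent with respect to $\varphi$. For every $t \in \mathbb{R}$, let $(\beta^{(t)}_n)_{n=1}^\infty$ be the $t$-Boolean cumulant functionals of $(\mathcal{A},\varphi)$. Then $$ \beta^{(t)}_n(x_1 y, \ldots, x_n y) = \sum_{\pi \in NC(n)} \beta^{(t)}_{\pi}(x_1,\ldots,x_n)\cdot \beta^{(t)}_{\mathrm{Kr}(\pi)}(y,\ldots,y), $$ holding for every $n \in \mathbb{N}$, $x_1,\ldots,x_n \in \mathcal{M}$, $y \in \mathcal{N}$ and $t \in \mathbb{R}$.
   Context: A non-commutative probability space $(\mathcal{A},\varphi)$ consists of a unital associative algebra $\mathcal{A}$ over $\mathbb{C}$ and a linear functional $\varphi:\mathcal{A}\to\mathbb{C}$ with $\varphi(1_{\mathcal{A}})=1$. Unital subalgebras $\mathcal{M},\mathcal{N}$ of $\mathcal{A}$ are freely independent if $\varphi(a_1\cdots a_k)=0$ whenever $k\ge 1$, the $a_i$ are alternately from $\mathcal{M}$ and $\mathcal{N}$ (consecutive elements from different subalgebras), and $\varphi(a_i)=0$ for all $i$. $NC(n)$ is the set of non-crossing partitions of $\{1,\ldots,n\}$, ordered by reverse refinement ($\pi\le\sigma$ iff every block of $\sigma$ is a union of blocks of $\pi$). A block $V$ of $\pi \in NC(n)$ is inner if there is a block $W$ of $\pi$ with $\min W < \min V \le \max V < \max W$; $\mathrm{inner}(\pi)$ is the number of inner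 blocks of $\pi$. Kreweras complement: for $\pi \in NC(n)$, $\mathrm{Kr}(\pi) \in NC(n)$ is the largest $\sigma \in NC(n)$ such that, placing $\pi$ on the points $1,\ldots,n$ and $\sigma$ on the points $1',\ldots,n'$, the union of $\pi$ and $\sigma$ is a non-crossing partition of the ordered set $1<1'<2<2'<\cdots<n<n'$. For a sequence $(\psi_n:\mathcal{A}^n\to\mathbb{C})_{n\ge1}$ of multilinear functionals and $\pi\in NC(n)$, $\psi_\pi(x_1,\ldots,x_n)=\prod_{V\in\pi}\psi_{|V|}((x_1,\ldots,x_n)\mid V)$, where $(x_1,\ldots,x_n)\mid V=(x_{i_1},\ldots,x_{i_k})$ for $V=\{i_1<\cdots<i_k\}$. For $t\in\mathbb{R}$, the $t$-Boolean cumulant functionals of $(\mathcal{A},\varphi)$ are the (uniquely determined) multilinear functionals $\beta^{(t)}_n:\mathcal{A}^n\to\mathbb{C}$, $n\ge1$, such that $\varphi(x_1\cdots x_n)=\sum_{\pi\in NC(n)}t^{\mathrm{inner}(\pi)}\prod_{V\in\pi}\beta^{(t)}_{|V|}((x_1,\ldots,x_n)\mid V)$ for all $n\ge1$ and $x_1,\ldots,x_n\in\mathcal{A}$ (with $0^0=1$). -}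

module Defs where

open import Algebra.Bundles using (CommutativeRing; Ring)
import Algebra.Properties.Semiring.Exp as SemiringExp
open import Algebra.Module.Bundles using (RawLeftModule)
import Algebra.Module.Construct.TensorUnit as TensorUnit
open import Algebra.Module.Morphism.Structures using (module LeftModuleMorphisms)
open import Algebra.Module.Structures using (IsLeftModule)
open import Data.Bool.Base using (Bool; true; false; if_then_else_; _xor_)
import Data.Bool.Properties as Bool
open import Data.Empty using (⊥-elim)
open import Data.List.Base as List using (List; []; _∷_; filter; mapMaybe; allFin; cartesianProductWith; length)
import Data.List.Extrema.Nat as Extrema
open import Data.List.Relation.Unary.Any using (Any; any?)
open import Data.Maybe.Base as Maybe using (Maybe)
open import Data.Nat.Base as ℕ using (ℕ; zero; suc; _⊔_)
import Data.Nat.Properties as ℕ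
open import Data.Product.Base using (∃; _×_; _,_; proj₁; proj₂)
open import Data.Sum.Base using (_⊎_; inj₁; inj₂)
open import Data.Sum.Relation.Binary.Pointwise using (inj₁; inj₂) renaming (Pointwise to SumRel)
open import Data.Vec.Base as Vec using (Vec; []; _∷_; lookup; tabulate; fromList; _[_]≔_)
open import Data.Vec.Properties using (lookup∘tabulate)
open import Data.Vec.Relation.Binary.Pointwise.Inductive using (Pointwise)
open import Function.Base using (_∘_)
open import Level using (0ℓ; Level) renaming (suc to lsuc; _⊔_ to _⊔ˡ_)
open import Relation.Binary.Bundles using (Setoid)
open import Relation.Binary.Core using (Rel)
open import Relation.Binary.Definitions using (Decidable; tri<; tri≈; tri>)
open import Relation.Binary.PropositionalEquality using (_≡_; _≢_; refl; sym; trans; cong; subst)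
open import Relation.Nullary using (Dec; yes; no; does; recompute; _×-dec_; _→-dec_)
open import Relation.Nullary.Decidable using (dec-true; dec-false; dec⇒maybe)
open import Relation.Unary using (Pred; _∈_)

-- The standard library has no real numbers: ℝ is the Cauchy completion of ℚ
-- (with equality "the difference tends to 0"), and ℂ = ℝ × ℝ.
module ComplexNumbers where

  open import Data.Rational.Base hiding (_≃_; _⊔_)
  open import Data.Rational.Properties
  open import Data.Rational.Solver using (module +-*-Solver)
  open +-*-Solver
  open ≤-Reasoning

  IsCauchy : (ℕ → ℚ) → Set
  IsCauchy s = ∀ ε → 0ℚ < ε → ∃ λ N → ∀ m n → N ℕ.≤ m → N ℕ.≤ n → ∣ s m - s n ∣ < ε

  record ℝ : Set where
    constructor mkℝ
    field
      seq    : ℕ → ℚ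
      cauchy : IsCauchy seq
  open ℝ public

  infix 4 _≃_
  record _≃_ (x y : ℝ) : Set where
    constructor mk≃
    field
      close : ∀ ε → 0ℚ < ε → ∃ λ N → ∀ n → N ℕ.≤ n → ∣ seq x n - seq y n ∣ < ε
  open _≃_ public

  private abstract

    ½+½ : ∀ ε → ½ * ε + ½ * ε ≡ ε
    ½+½ ε = trans (sym (*-distribʳ-+ ε ½ ½)) (*-identityˡ ε)

    ½-pos : ∀ {ε} → 0ℚ < ε → 0ℚ < ½ * ε
    ½-pos {ε} 0<ε = positive⁻¹ (½ * ε) {{pos*pos⇒pos ½ ε {{positive 0<ε}}}}

    quot : ∀ ε B → 0ℚ < ε → 0ℚ < B → ∃ λ δ → 0ℚ < δ × B * δ ≡ ε
    quot ε B 0<ε 0<B = (1/ B) * ε , positive⁻¹ _ {{pos*pos⇒pos (1/ B) {{1/pos⇒pos B}} ε}} , (begin-equality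
      B * ((1/ B) * ε) ≡⟨ *-assoc B (1/ B) ε ⟨
      B * (1/ B) * ε   ≡⟨ cong (_* ε) (*-inverseʳ B) ⟩
      1ℚ * ε           ≡⟨ *-identityˡ ε ⟩
      ε                ∎)
      where
      instance
        B-pos : Positive B
        B-pos = positive 0<B

        ε-pos : Positive ε
        ε-pos = positive 0<ε

        B-nonZero : NonZero B
        B-nonZero = pos⇒nonZero B

    ∣-∣-refl : ∀ p {ε} → 0ℚ < ε → ∣ p - p ∣ < ε
    ∣-∣-refl p {ε} 0<ε = subst (λ r → ∣ r ∣ < ε) (sym (+-inverseʳ p)) 0<ε

    ∣-∣-sym : ∀ p q {ε} → ∣ p - q ∣ < ε → ∣ q - p ∣ < ε
    ∣-∣-sym p q {ε} = subst (_< ε) (trans (sym (∣-p∣≡∣p∣ (p - q)))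
      (cong ∣_∣ (solve 2 (λ p q → :- (p :- q) := q :- p) refl p q)))

    split-< : ∀ a b r {ε} → a + b ≡ r → ∣ a ∣ < ½ * ε → ∣ b ∣ < ½ * ε → ∣ r ∣ < ε
    split-< a b r {ε} eq a< b< = begin-strict
      ∣ r ∣             ≡⟨ cong ∣_∣ eq ⟨
      ∣ a + b ∣         ≤⟨ ∣p+q∣≤∣p∣+∣q∣ a b ⟩
      ∣ a ∣ + ∣ b ∣     <⟨ +-mono-< a< b< ⟩
      ½ * ε + ½ * ε     ≡⟨ ½+½ ε ⟩
      ε                 ∎

    +-close : ∀ a b c d {ε} → ∣ a - b ∣ < ½ * ε → ∣ c - d ∣ < ½ * ε → ∣ (a + c) - (b + d) ∣ < ε
    +-close a b c d = split-< (a - b) (c - d) _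
      (solve 4 (λ a b c d → (a :- b) :+ (c :- d) := (a :+ c) :- (b :+ d)) refl a b c d)

    neg-close : ∀ a b {ε} → ∣ a - b ∣ < ε → ∣ - a - - b ∣ < ε
    neg-close a b {ε} = subst (_< ε) (trans (sym (∣-p∣≡∣p∣ (a - b)))
      (cong ∣_∣ (solve 2 (λ a b → :- (a :- b) := :- a :- :- b) refl a b)))

    ∣*∣-< : ∀ a u {B δ} → 0ℚ < B → ∣ a ∣ < B → ∣ u ∣ < δ → ∣ a * u ∣ < B * δ
    ∣*∣-< a u {B} {δ} 0<B a<B u<δ = begin-strict
      ∣ a * u ∣       ≡⟨ ∣p*q∣≡∣p∣*∣q∣ a u ⟩
      ∣ a ∣ * ∣ u ∣   ≤⟨ *-monoʳ-≤-nonNeg ∣ u ∣ {{∣-∣-nonNeg u}} (<⇒≤ a<B) ⟩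
      B * ∣ u ∣       <⟨ *-monoʳ-<-pos B {{positive 0<B}} u<δ ⟩
      B * δ           ∎

    *-close : ∀ a b c d {A D δ η ε} → 0ℚ < A → 0ℚ < D → A * δ ≡ ½ * ε → D * η ≡ ½ * ε →
              ∣ a ∣ < A → ∣ d ∣ < D → ∣ c - d ∣ < δ → ∣ a - b ∣ < η → ∣ a * c - b * d ∣ < ε
    *-close a b c d 0<A 0<D eq₁ eq₂ a< d< cd< ab< = split-< (a * (c - d)) (d * (a - b)) _
      (solve 4 (λ a b c d → a :* (c :- d) :+ d :* (a :- b) := a :* c :- b :* d) refl a b c d)
      (subst (_ <_) eq₁ (∣*∣-< a (c - d) 0<A a< cd<))
      (subst (_ <_) eq₂ (∣*∣-< d (a - b) 0<D d< ab<))

    bounded : ∀ x → ∃ λ B → 0ℚ < B × ∃ λ N → ∀ n → N ℕ.≤ n → ∣ seq x n ∣ < B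
    bounded x with cauchy x 1ℚ (positive⁻¹ 1ℚ)
    ... | N , h = 1ℚ + ∣ seq x N ∣
                , positive⁻¹ _ {{pos+nonNeg⇒pos 1ℚ ∣ seq x N ∣ {{∣-∣-nonNeg (seq x N)}}}}
                , N , λ n N≤n → begin-strict
      ∣ seq x n ∣                           ≡⟨ cong ∣_∣ (solve 2 (λ p q → p := (p :- q) :+ q) refl (seq x n) (seq x N)) ⟩
      ∣ (seq x n - seq x N) + seq x N ∣     ≤⟨ ∣p+q∣≤∣p∣+∣q∣ (seq x n - seq x N) (seq x N) ⟩
      ∣ seq x n - seq x N ∣ + ∣ seq x N ∣   <⟨ +-monoˡ-< ∣ seq x N ∣ (h n N N≤n ℕ.≤-refl) ⟩
      1ℚ + ∣ seq x N ∣                      ∎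

    ⊔-l : ∀ {M N n} → M ⊔ N ℕ.≤ n → M ℕ.≤ n
    ⊔-l {M} {N} = ℕ.≤-trans (ℕ.m≤m⊔n M N)

    ⊔-r : ∀ {M N n} → M ⊔ N ℕ.≤ n → N ℕ.≤ n
    ⊔-r {M} {N} = ℕ.≤-trans (ℕ.m≤n⊔m M N)

    ⊔⁴-≤ : ∀ K L M N {n} → (K ⊔ L) ⊔ (M ⊔ N) ℕ.≤ n → (K ℕ.≤ n × L ℕ.≤ n) × (M ℕ.≤ n × N ℕ.≤ n)
    ⊔⁴-≤ K L M N p = let q = ⊔-l {K ⊔ L} {M ⊔ N} p ; r = ⊔-r {K ⊔ L} {M ⊔ N} p in
      (⊔-l {K} {L} q , ⊔-r {K} {L} q) , (⊔-l {M} {N} r , ⊔-r {M} {N} r)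

    pointwise : ∀ {x y} → (∀ n → seq x n ≡ seq y n) → x ≃ y
    pointwise {x} {y} eq = mk≃ λ ε 0<ε → 0 , λ n _ →
      subst (λ q → ∣ seq x n - q ∣ < ε) (eq n) (∣-∣-refl (seq x n) 0<ε)

  fromℚ : ℚ → ℝ
  fromℚ q = mkℝ (λ _ → q) λ ε 0<ε → 0 , λ _ _ _ _ → ∣-∣-refl q 0<ε

  0ʳ 1ʳ : ℝ
  0ʳ = fromℚ 0ℚ
  1ʳ = fromℚ 1ℚ

  infixl 6 _+ʳ_
  infixl 7 _*ʳ_
  infix  8 -ʳ_

  -- Abstract so that checking an equation between real numbers never
  -- unfolds a modulus of convergence.
  abstract

    +-cauchy : ∀ x y → IsCauchy (λ n → seq x n + seq y n)
    +-cauchy x y ε 0<ε =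
      let M , hx = cauchy x (½ * ε) (½-pos 0<ε)
          N , hy = cauchy y (½ * ε) (½-pos 0<ε)
      in M ⊔ N , λ m n p q → +-close (seq x m) (seq x n) (seq y m) (seq y n)
           (hx m n (⊔-l p) (⊔-l q)) (hy m n (⊔-r p) (⊔-r q))

    neg-cauchy : ∀ x → IsCauchy (λ n → - seq x n)
    neg-cauchy x ε 0<ε =
      let N , h = cauchy x ε 0<ε in N , λ m n p q → neg-close (seq x m) (seq x n) (h m n p q)

    *-cauchy : ∀ x y → IsCauchy (λ n → seq x n * seq y n)
    *-cauchy x y ε 0<ε =
      let A , 0<A , K , ha = bounded x
          D , 0<D , L , hd = bounded y
          δ , 0<δ , eq₁ = quot (½ * ε) A (½-pos 0<ε) 0<A
          η , 0<η , eq₂ = quot (½ * ε) D (½-pos 0<ε) 0<D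
          M , hx = cauchy x η 0<η
          N , hy = cauchy y δ 0<δ
      in (K ⊔ L) ⊔ (M ⊔ N) , λ m n p q →
           let (Km , Lm) , (Mm , Nm) = ⊔⁴-≤ K L M N p
               (Kn , Ln) , (Mn , Nn) = ⊔⁴-≤ K L M N q
           in *-close (seq x m) (seq x n) (seq y m) (seq y n) 0<A 0<D eq₁ eq₂
                (ha m Km) (hd n Ln) (hy m n Nm Nn) (hx m n Mm Mn)

  _+ʳ_ _*ʳ_ : ℝ → ℝ → ℝ
  x +ʳ y = mkℝ (λ n → seq x n + seq y n) (+-cauchy x y)
  x *ʳ y = mkℝ (λ n → seq x n * seq y n) (*-cauchy x y)

  -ʳ_ : ℝ → ℝ
  -ʳ x = mkℝ (λ n → - seq x n) (neg-cauchy x)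

  private

    ≃ʳ-refl : ∀ {x} → x ≃ x
    ≃ʳ-refl = pointwise λ _ → refl

    ≃ʳ-sym : ∀ {x y} → x ≃ y → y ≃ x
    ≃ʳ-sym {x} {y} x≃y = mk≃ λ ε 0<ε → let N , h = close x≃y ε 0<ε in
      N , λ n p → ∣-∣-sym (seq x n) (seq y n) (h n p)

    ≃ʳ-trans : ∀ {x y z} → x ≃ y → y ≃ z → x ≃ z
    ≃ʳ-trans {x} {y} {z} x≃y y≃z = mk≃ λ ε 0<ε →
      let M , h = close x≃y (½ * ε) (½-pos 0<ε)
          N , k = close y≃z (½ * ε) (½-pos 0<ε)
      in M ⊔ N , λ n p → split-< (seq x n - seq y n) (seq y n - seq z n) _
           (solve 3 (λ a b c → (a :- b) :+ (b :- c) := a :- c) refl (seq x n) (seq y n) (seq z n))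
           (h n (⊔-l p)) (k n (⊔-r p))

    +ʳ-cong : ∀ {x y u v} → x ≃ y → u ≃ v → x +ʳ u ≃ y +ʳ v
    +ʳ-cong {x} {y} {u} {v} x≃y u≃v = mk≃ λ ε 0<ε →
      let M , h = close x≃y (½ * ε) (½-pos 0<ε)
          N , k = close u≃v (½ * ε) (½-pos 0<ε)
      in M ⊔ N , λ n p → +-close (seq x n) (seq y n) (seq u n) (seq v n) (h n (⊔-l p)) (k n (⊔-r p))

    -ʳ-cong : ∀ {x y} → x ≃ y → -ʳ x ≃ -ʳ y
    -ʳ-cong {x} {y} x≃y = mk≃ λ ε 0<ε → let N , h = close x≃y ε 0<ε in
      N , λ n p → neg-close (seq x n) (seq y n) (h n p)

    *ʳ-cong : ∀ {x y u v} → x ≃ y → u ≃ v → x *ʳ u ≃ y *ʳ v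
    *ʳ-cong {x} {y} {u} {v} x≃y u≃v = mk≃ λ ε 0<ε →
      let A , 0<A , K , ha = bounded x
          D , 0<D , L , hd = bounded v
          δ , 0<δ , eq₁ = quot (½ * ε) A (½-pos 0<ε) 0<A
          η , 0<η , eq₂ = quot (½ * ε) D (½-pos 0<ε) 0<D
          M , hx = close x≃y η 0<η
          N , hu = close u≃v δ 0<δ
      in (K ⊔ L) ⊔ (M ⊔ N) , λ n p →
           let (Kn , Ln) , (Mn , Nn) = ⊔⁴-≤ K L M N p
           in *-close (seq x n) (seq y n) (seq u n) (seq v n) 0<A 0<D eq₁ eq₂
                (ha n Kn) (hd n Ln) (hu n Nn) (hx n Mn)

  infix 5 _+i_
  record ℂ : Set where
    constructor _+i_
    field re im : ℝ
  open ℂ public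

  infix 4 _≃ᶜ_
  record _≃ᶜ_ (z w : ℂ) : Set where
    constructor _,_
    field
      re≃ : re z ≃ re w
      im≃ : im z ≃ im w
  open _≃ᶜ_ public

  infixl 6 _+ᶜ_
  infixl 7 _*ᶜ_
  infix  8 -ᶜ_

  _+ᶜ_ _*ᶜ_ : ℂ → ℂ → ℂ
  (a +i b) +ᶜ (c +i d) = a +ʳ c +i b +ʳ d
  (a +i b) *ᶜ (c +i d) = a *ʳ c +ʳ -ʳ (b *ʳ d) +i a *ʳ d +ʳ b *ʳ c

  -ᶜ_ : ℂ → ℂ
  -ᶜ (a +i b) = -ʳ a +i -ʳ b

  fromℝ : ℝ → ℂ
  fromℝ x = x +i 0ʳ

  0ᶜ 1ᶜ : ℂ
  0ᶜ = fromℝ 0ʳ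
  1ᶜ = fromℝ 1ʳ

  private

    pointwiseᶜ : ∀ {z w} → (∀ n → seq (re z) n ≡ seq (re w) n) → (∀ n → seq (im z) n ≡ seq (im w) n) → z ≃ᶜ w
    pointwiseᶜ p q = pointwise p , pointwise q

    ≃ᶜ-refl : ∀ {z} → z ≃ᶜ z
    ≃ᶜ-refl = ≃ʳ-refl , ≃ʳ-refl

    ≃ᶜ-sym : ∀ {z w} → z ≃ᶜ w → w ≃ᶜ z
    ≃ᶜ-sym (p , q) = ≃ʳ-sym p , ≃ʳ-sym q

    ≃ᶜ-trans : ∀ {z w v} → z ≃ᶜ w → w ≃ᶜ v → z ≃ᶜ v
    ≃ᶜ-trans (p , q) (r , s) = ≃ʳ-trans p r , ≃ʳ-trans q s

    +ᶜ-cong : ∀ {z w u v} → z ≃ᶜ w → u ≃ᶜ v → z +ᶜ u ≃ᶜ w +ᶜ v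
    +ᶜ-cong (p , q) (r , s) = +ʳ-cong p r , +ʳ-cong q s

    -ᶜ-cong : ∀ {z w} → z ≃ᶜ w → -ᶜ z ≃ᶜ -ᶜ w
    -ᶜ-cong (p , q) = -ʳ-cong p , -ʳ-cong q

    *ᶜ-cong : ∀ {z w u v} → z ≃ᶜ w → u ≃ᶜ v → z *ᶜ u ≃ᶜ w *ᶜ v
    *ᶜ-cong (p , q) (r , s) = +ʳ-cong (*ʳ-cong p r) (-ʳ-cong (*ʳ-cong q s)) , +ʳ-cong (*ʳ-cong p s) (*ʳ-cong q r)

    +ᶜ-assoc : ∀ z w v → (z +ᶜ w) +ᶜ v ≃ᶜ z +ᶜ (w +ᶜ v)
    +ᶜ-assoc (a +i b) (c +i d) (e +i f) = pointwiseᶜ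
      (λ n → +-assoc (seq a n) (seq c n) (seq e n)) (λ n → +-assoc (seq b n) (seq d n) (seq f n))

    +ᶜ-comm : ∀ z w → z +ᶜ w ≃ᶜ w +ᶜ z
    +ᶜ-comm (a +i b) (c +i d) = pointwiseᶜ
      (λ n → +-comm (seq a n) (seq c n)) (λ n → +-comm (seq b n) (seq d n))

    +ᶜ-identityˡ : ∀ z → 0ᶜ +ᶜ z ≃ᶜ z
    +ᶜ-identityˡ (a +i b) = pointwiseᶜ (λ n → +-identityˡ (seq a n)) (λ n → +-identityˡ (seq b n))

    -ᶜ-inverseˡ : ∀ z → -ᶜ z +ᶜ z ≃ᶜ 0ᶜ
    -ᶜ-inverseˡ (a +i b) = pointwiseᶜ (λ n → +-inverseˡ (seq a n)) (λ n → +-inverseˡ (seq b n))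

    *ᶜ-assoc : ∀ z w v → (z *ᶜ w) *ᶜ v ≃ᶜ z *ᶜ (w *ᶜ v)
    *ᶜ-assoc (a +i b) (c +i d) (e +i f) = pointwiseᶜ
      (λ n → solve 6 (λ a b c d e f →
        (a :* c :+ :- (b :* d)) :* e :+ :- ((a :* d :+ b :* c) :* f) :=
        a :* (c :* e :+ :- (d :* f)) :+ :- (b :* (c :* f :+ d :* e))) refl
        (seq a n) (seq b n) (seq c n) (seq d n) (seq e n) (seq f n))
      (λ n → solve 6 (λ a b c d e f →
        (a :* c :+ :- (b :* d)) :* f :+ (a :* d :+ b :* c) :* e :=
        a :* (c :* f :+ d :* e) :+ b :* (c :* e :+ :- (d :* f))) refl
        (seq a n) (seq b n) (seq c n) (seq d n) (seq e n) (seq f n))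

    *ᶜ-comm : ∀ z w → z *ᶜ w ≃ᶜ w *ᶜ z
    *ᶜ-comm (a +i b) (c +i d) = pointwiseᶜ
      (λ n → solve 4 (λ a b c d → a :* c :+ :- (b :* d) := c :* a :+ :- (d :* b)) refl
        (seq a n) (seq b n) (seq c n) (seq d n))
      (λ n → solve 4 (λ a b c d → a :* d :+ b :* c := c :* b :+ d :* a) refl
        (seq a n) (seq b n) (seq c n) (seq d n))

    *ᶜ-identityˡ : ∀ z → 1ᶜ *ᶜ z ≃ᶜ z
    *ᶜ-identityˡ (a +i b) = pointwiseᶜ
      (λ n → solve 2 (λ a b → con 1ℚ :* a :+ :- (con 0ℚ :* b) := a) refl (seq a n) (seq b n))
      (λ n → solve 2 (λ a b → con 1ℚ :* b :+ con 0ℚ :* a := b) refl (seq a n) (seq b n))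

    *ᶜ-distribˡ : ∀ z w v → z *ᶜ (w +ᶜ v) ≃ᶜ z *ᶜ w +ᶜ z *ᶜ v
    *ᶜ-distribˡ (a +i b) (c +i d) (e +i f) = pointwiseᶜ
      (λ n → solve 6 (λ a b c d e f →
        a :* (c :+ e) :+ :- (b :* (d :+ f)) :=
        (a :* c :+ :- (b :* d)) :+ (a :* e :+ :- (b :* f))) refl
        (seq a n) (seq b n) (seq c n) (seq d n) (seq e n) (seq f n))
      (λ n → solve 6 (λ a b c d e f →
        a :* (d :+ f) :+ b :* (c :+ e) :=
        (a :* d :+ b :* c) :+ (a :* f :+ b :* e)) refl
        (seq a n) (seq b n) (seq c n) (seq d n) (seq e n) (seq f n))

    ≃ᶜ-setoid : Setoid 0ℓ 0ℓ
    ≃ᶜ-setoid = record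
      { _≈_ = _≃ᶜ_
      ; isEquivalence = record
        { refl = λ {z} → ≃ᶜ-refl {z}
        ; sym = λ {z} {w} → ≃ᶜ-sym {z} {w}
        ; trans = λ {z} {w} {v} → ≃ᶜ-trans {z} {w} {v} } }

  open import Algebra.Consequences.Setoid ≃ᶜ-setoid

  ℂ-commutativeRing : CommutativeRing 0ℓ 0ℓ
  ℂ-commutativeRing = record
    { Carrier = ℂ
    ; _≈_ = _≃ᶜ_
    ; _+_ = _+ᶜ_
    ; _*_ = _*ᶜ_
    ; -_ = -ᶜ_
    ; 0# = 0ᶜ
    ; 1# = 1ᶜ
    ; isCommutativeRing = record
      { isRing = record
        { +-isAbelianGroup = record
          { isGroup = record
            { isMonoid = record
              { isSemigroup = record
                { isMagma = record
                  { isEquivalence = Setoid.isEquivalence ≃ᶜ-setoid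
                  ; ∙-cong = λ {x} {y} {u} {v} → +ᶜ-cong {x} {y} {u} {v} }
                ; assoc = +ᶜ-assoc }
              ; identity = comm∧idˡ⇒id +ᶜ-comm +ᶜ-identityˡ }
            ; inverse = comm∧invˡ⇒inv +ᶜ-comm -ᶜ-inverseˡ
            ; ⁻¹-cong = λ {x} {y} → -ᶜ-cong {x} {y} }
          ; comm = +ᶜ-comm }
        ; *-cong = λ {x} {y} {u} {v} → *ᶜ-cong {x} {y} {u} {v}
        ; *-assoc = *ᶜ-assoc
        ; *-identity = comm∧idˡ⇒id *ᶜ-comm *ᶜ-identityˡ
        ; distrib = comm∧distrˡ⇒distr (λ {x} {y} {u} {v} → +ᶜ-cong {x} {y} {u} {v}) *ᶜ-comm *ᶜ-distribˡ }
      ; *-comm = *ᶜ-comm } }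

open ComplexNumbers public using (ℝ; ℂ; _≃ᶜ_; _*ᶜ_; fromℝ; ℂ-commutativeRing)

open import Data.Fin.Base using (Fin; zero; suc; toℕ; inject₁; _≤_; _<_)
open import Data.Fin.Properties using (_≟_; _≤?_; _<?_; all?; <-cmp; ≤-antisym)

NonCrossing : {P : Set} (_≺_ _~_ : Rel P 0ℓ) → Set
NonCrossing _≺_ _~_ = ∀ i j k l → i ≺ j → j ≺ k → k ≺ l → i ~ k → j ~ l → i ~ j

-- A partition of {1,…,n} is encoded by the vector v sending every point to the
-- least element of its block.  Such vectors are exactly the idempotent maps
-- with v i ≤ i, so every partition has one and only one encoding.
IsPartition : ∀ {n} → Vec (Fin n) n → Set
IsPartition v = ∀ i → lookup v i ≤ i × lookup v (lookup v i) ≡ lookup v i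

SameLabel : ∀ {n} → Vec (Fin n) n → Rel (Fin n) 0ℓ
SameLabel v i j = lookup v i ≡ lookup v j

isPartition? : ∀ {n} (v : Vec (Fin n) n) → Dec (IsPartition v)
isPartition? v = all? λ i → (lookup v i ≤? i) ×-dec (lookup v (lookup v i) ≟ lookup v i)

isNonCrossing? : ∀ {n} (v : Vec (Fin n) n) → Dec (NonCrossing _<_ (SameLabel v))
isNonCrossing? v = all? λ i → all? λ j → all? λ k → all? λ l →
  (i <? j) →-dec ((j <? k) →-dec ((k <? l) →-dec
    ((lookup v i ≟ lookup v k) →-dec ((lookup v j ≟ lookup v l) →-dec (lookup v i ≟ lookup v j)))))

record NC (n : ℕ) : Set where
  constructor mkNC
  field
    labels         : Vec (Fin n) n
    .isPartition   : IsPartition labels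
    .isNonCrossing : NonCrossing _<_ (SameLabel labels)
open NC public

nonCrossing : ∀ {n} (π : NC n) → NonCrossing _<_ (SameLabel (labels π))
nonCrossing (mkNC v _ nc) = recompute (isNonCrossing? v) nc

_[_]~_ : ∀ {n} → Fin n → NC n → Fin n → Set
i [ π ]~ j = SameLabel (labels π) i j

words : ∀ {A : Set} → List A → (m : ℕ) → List (Vec A m)
words xs zero    = [] ∷ []
words xs (suc m) = cartesianProductWith _∷_ xs (words xs m)

toNC : ∀ {n} → Vec (Fin n) n → Maybe (NC n)
toNC v = Maybe.map (λ (p , q) → mkNC v p q) (dec⇒maybe (isPartition? v ×-dec isNonCrossing? v))

allNC : ∀ n → List (NC n)
allNC n = mapMaybe toNC (words (allFin n) n)

-- Blocks are listed in increasing order, and are indexed by their least elements.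
block : ∀ {n} → NC n → Fin n → List (Fin n)
block π a = filter (λ j → lookup (labels π) j ≟ a) (allFin _)

blocks : ∀ {n} → NC n → List (List (Fin n))
blocks π = List.map (block π) (filter (λ a → lookup (labels π) a ≟ a) (allFin _))

-- The values n and 0 are only the defaults for the empty list; blocks are non-empty.
minᵇ maxᵇ : ∀ {n} → List (Fin n) → ℕ
minᵇ {n} V = Extrema.min n (List.map toℕ V)
maxᵇ V = Extrema.max 0 (List.map toℕ V)

IsInner : ∀ {n} → NC n → List (Fin n) → Set
IsInner π V = Any (λ W → minᵇ W ℕ.< minᵇ V × minᵇ V ℕ.≤ maxᵇ V × maxᵇ V ℕ.< maxᵇ W) (blocks π)

isInner? : ∀ {n} (π : NC n) (V : List (Fin n)) → Dec (IsInner π V)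
isInner? π V = any? (λ W → (minᵇ W ℕ.<? minᵇ V) ×-dec ((minᵇ V ℕ.≤? maxᵇ V) ×-dec (maxᵇ V ℕ.<? maxᵇ W))) (blocks π)

inner : ∀ {n} → NC n → ℕ
inner π = length (filter (isInner? π) (blocks π))

-- Every block of σ is a union of blocks of π.
_⊑_ : ∀ {n} → NC n → NC n → Set
π ⊑ σ = ∀ i j → i [ π ]~ j → i [ σ ]~ j

-- The order 1 < 1' < 2 < 2' < ⋯ < n < n', where inj₁ i is the point i and
-- inj₂ i is the point i'.
_≺_ : ∀ {n} → Rel (Fin n ⊎ Fin n) 0ℓ
inj₁ i ≺ inj₁ j = i < j
inj₁ i ≺ inj₂ j = i ≤ j
inj₂ i ≺ inj₁ j = i < j
inj₂ i ≺ inj₂ j = i < j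

UnionNonCrossing : ∀ {n} → NC n → NC n → Set
UnionNonCrossing π σ = NonCrossing _≺_ (SumRel (_[ π ]~_) (_[ σ ]~_))

-- σ is the largest element of NC(n) for which the union of π and σ is non-crossing.
IsKreweras : ∀ {n} → NC n → NC n → Set
IsKreweras π σ = UnionNonCrossing π σ × (∀ τ → UnionNonCrossing π τ → τ ⊑ σ)

private

  least : ∀ {n} {P : Fin n → Set} → (∀ i → Dec (P i)) → ∀ j → P j →
          ∃ λ i → P i × (∀ k → P k → i ≤ k)
  least P? zero pj = zero , pj , λ _ _ → ℕ.z≤n
  least P? (suc j) pj with P? zero
  ... | yes p0 = zero , p0 , λ _ _ → ℕ.z≤n
  ... | no ¬p0 with least (P? ∘ suc) j pj
  ...   | i , pi , i≤ = suc i , pi , λ { zero p0 → ⊥-elim (¬p0 p0) ; (suc k) pk → ℕ.s≤s (i≤ k pk) }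

  module Label {n} (_R_ : Rel (Fin n) 0ℓ) (_R?_ : Decidable _R_)
               (R-refl : ∀ {i} → i R i) (R-sym : ∀ {i j} → i R j → j R i)
               (R-trans : ∀ {i j k} → i R j → j R k → i R k) where

    rep : Fin n → Fin n
    rep j = proj₁ (least (j R?_) j R-refl)

    rep-R : ∀ j → j R rep j
    rep-R j = proj₁ (proj₂ (least (j R?_) j R-refl))

    rep-least : ∀ j k → j R k → rep j ≤ k
    rep-least j = proj₂ (proj₂ (least (j R?_) j R-refl))

    rep-complete : ∀ {i j} → i R j → rep i ≡ rep j
    rep-complete {i} {j} iRj = ≤-antisym
      (rep-least i (rep j) (R-trans iRj (rep-R j)))
      (rep-least j (rep i) (R-trans (R-sym iRj) (rep-R i)))

    rep-sound : ∀ {i j} → rep i ≡ rep j → i R j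
    rep-sound {i} {j} eq = R-trans (rep-R i) (subst (_R j) (sym eq) (R-sym (rep-R j)))

    lab : Vec (Fin n) n
    lab = tabulate rep

    lab-sound : ∀ {i j} → SameLabel lab i j → i R j
    lab-sound {i} {j} eq = rep-sound (trans (sym (lookup∘tabulate rep i)) (trans eq (lookup∘tabulate rep j)))

    lab-complete : ∀ {i j} → i R j → SameLabel lab i j
    lab-complete {i} {j} iRj = trans (lookup∘tabulate rep i) (trans (rep-complete iRj) (sym (lookup∘tabulate rep j)))

    lab-isPartition : IsPartition lab
    lab-isPartition i = subst (_≤ i) (sym (lookup∘tabulate rep i)) (rep-least i i R-refl)
                      , lab-complete (subst (_R i) (sym (lookup∘tabulate rep i)) (R-sym (rep-R i)))

-- Existence of the Kreweras complement: i' and j' are joined iff every pair of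
-- points in the same block of π is separated by i' exactly when it is by j'.
module Kreweras {n} (π : NC n) where

  private

    _~_ : Rel (Fin n) 0ℓ
    _~_ = _[ π ]~_

    left : Fin n → Fin n → Bool
    left i a = does (a ≤? i)

    separates : Fin n → Fin n → Fin n → Bool
    separates i a b = left i a xor left i b

    _R_ : Rel (Fin n) 0ℓ
    i R j = ∀ a b → a ~ b → separates i a b ≡ separates j a b

    _R?_ : Decidable _R_
    i R? j = all? λ a → all? λ b →
      (lookup (labels π) a ≟ lookup (labels π) b) →-dec (separates i a b Bool.≟ separates j a b)

    open Label _R_ _R?_ (λ _ _ _ → refl) (λ r a b p → sym (r a b p)) (λ r s a b p → trans (r a b p) (s a b p))

    left-T : ∀ {i a} → a ≤ i → left i a ≡ true
    left-T {i} {a} p = dec-true (a ≤? i) p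

    left-F : ∀ {i a} → i < a → left i a ≡ false
    left-F {i} {a} p = dec-false (a ≤? i) (ℕ.<⇒≱ p)

    left-mono : ∀ {i j} a → i < j → left i a ≡ true → left j a ≡ true
    left-mono {i} {j} a i<j eq with a ≤? i
    ... | yes a≤i = left-T {j} {a} (ℕ.≤-trans a≤i (ℕ.<⇒≤ i<j))
    ... | no a≰i with () ← trans (sym (left-F (ℕ.≰⇒> a≰i))) eq

    interval : ∀ {a₁ a₂ a₃ a₄ b₁ b₂ b₃ b₄} →
      (a₁ ≡ true → a₂ ≡ true) → (a₂ ≡ true → a₃ ≡ true) → (a₃ ≡ true → a₄ ≡ true) →
      (b₁ ≡ true → b₂ ≡ true) → (b₂ ≡ true → b₃ ≡ true) → (b₃ ≡ true → b₄ ≡ true) →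
      a₁ xor b₁ ≡ a₃ xor b₃ → a₂ xor b₂ ≡ a₄ xor b₄ → a₁ xor b₁ ≡ a₂ xor b₂
    interval {true}  {false}                        p q r s t u e f with () ← p refl
    interval {_} {_} {_} {_} {true}  {false}        p q r s t u e f with () ← s refl
    interval {false} {false} {_} {_} {false} {false} p q r s t u e f = refl
    interval {false} {false} {_} {_} {true}  {true}  p q r s t u e f = refl
    interval {true}  {true}  {_} {_} {false} {false} p q r s t u e f = refl
    interval {true}  {true}  {_} {_} {true}  {true}  p q r s t u e f = refl
    interval {false} {true}  {_} {_} {false} {true}  p q r s t u e f = refl
    interval {false} {true}  {_} {_} {false} {false} {b₃} p q r s t u e f
      with refl ← q refl with refl ← r refl with b₃ | e
    ... | true | _ with refl ← u refl with () ← f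
    interval {false} {true}  {_} {_} {true}  {true}  p q r s t u e f
      with refl ← q refl with refl ← t refl with () ← e
    interval {false} {false} {a₃} {_} {false} {true} p q r s t u e f
      with refl ← t refl with refl ← u refl with a₃ | e
    ... | true | _ with refl ← r refl with () ← f
    interval {true}  {true}  {_} {_} {false} {true}  p q r s t u e f
      with refl ← q refl with refl ← t refl with () ← e

    R-nonCrossing : NonCrossing _<_ _R_
    R-nonCrossing i j k l i<j j<k k<l iRk jRl a b a~b = interval
      (left-mono a i<j) (left-mono a j<k) (left-mono a k<l)
      (left-mono b i<j) (left-mono b j<k) (left-mono b k<l) (iRk a b a~b) (jRl a b a~b)

    σ : NC n
    σ = mkNC lab lab-isPartition λ i j k l i<j j<k k<l p q →
      lab-complete (R-nonCrossing i j k l i<j j<k k<l (lab-sound p) (lab-sound q))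

    σ-union : UnionNonCrossing π σ
    σ-union (inj₁ i) (inj₁ j) (inj₁ k) (inj₁ l) i<j j<k k<l (inj₁ p) (inj₁ q) =
      inj₁ (nonCrossing π i j k l i<j j<k k<l p q)
    σ-union (inj₂ i) (inj₂ j) (inj₂ k) (inj₂ l) i<j j<k k<l (inj₂ p) (inj₂ q) =
      inj₂ (lab-complete (R-nonCrossing i j k l i<j j<k k<l (lab-sound p) (lab-sound q)))
    σ-union (inj₁ a) (inj₂ i) (inj₁ b) (inj₂ j) a≤i i<b b≤j (inj₁ a~b) (inj₂ q)
      with lab-sound q a b a~b
    ... | eq rewrite left-T a≤i | left-F i<b | left-T (ℕ.≤-trans a≤i (ℕ.<⇒≤ (ℕ.<-≤-trans i<b b≤j))) | left-T b≤j
      with () ← eq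
    σ-union (inj₂ i) (inj₁ a) (inj₂ j) (inj₁ b) i<a a≤j j<b (inj₂ p) (inj₁ a~b)
      with lab-sound p a b a~b
    ... | eq rewrite left-F i<a | left-F (ℕ.<-trans (ℕ.<-≤-trans i<a a≤j) j<b) | left-T a≤j | left-F j<b
      with () ← eq

    below-< : ∀ τ → UnionNonCrossing π τ → ∀ {i j} → i < j → i [ τ ]~ j → i R j
    below-< τ nc {i} {j} i<j iτj a b a~b with a ≤? i | a ≤? j | b ≤? i | b ≤? j
    ... | yes a≤i | no a≰j  | _       | _       = ⊥-elim (a≰j (ℕ.≤-trans a≤i (ℕ.<⇒≤ i<j)))
    ... | _       | _       | yes b≤i | no b≰j  = ⊥-elim (b≰j (ℕ.≤-trans b≤i (ℕ.<⇒≤ i<j)))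
    ... | yes a≤i | yes a≤j | yes b≤i | yes b≤j
      rewrite left-T a≤i | left-T a≤j | left-T b≤i | left-T b≤j = refl
    ... | yes a≤i | yes a≤j | no b≰i | no b≰j
      rewrite left-T a≤i | left-T a≤j | left-F (ℕ.≰⇒> b≰i) | left-F (ℕ.≰⇒> b≰j) = refl
    ... | no a≰i | no a≰j | yes b≤i | yes b≤j
      rewrite left-F (ℕ.≰⇒> a≰i) | left-F (ℕ.≰⇒> a≰j) | left-T b≤i | left-T b≤j = refl
    ... | no a≰i | no a≰j | no b≰i | no b≰j
      rewrite left-F (ℕ.≰⇒> a≰i) | left-F (ℕ.≰⇒> a≰j) | left-F (ℕ.≰⇒> b≰i) | left-F (ℕ.≰⇒> b≰j) = refl
    ... | no a≰i | yes a≤j | no b≰i | yes b≤j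
      rewrite left-F (ℕ.≰⇒> a≰i) | left-T a≤j | left-F (ℕ.≰⇒> b≰i) | left-T b≤j = refl
    ... | no a≰i  | yes a≤j | yes b≤i | yes _
      with () ← nc (inj₁ b) (inj₂ i) (inj₁ a) (inj₂ j) b≤i (ℕ.≰⇒> a≰i) a≤j (inj₁ (sym a~b)) (inj₂ iτj)
    ... | no a≰i  | yes a≤j | no _    | no b≰j
      with () ← nc (inj₂ i) (inj₁ a) (inj₂ j) (inj₁ b) (ℕ.≰⇒> a≰i) a≤j (ℕ.≰⇒> b≰j) (inj₂ iτj) (inj₁ a~b)
    ... | yes a≤i | yes _   | no b≰i  | yes b≤j
      with () ← nc (inj₁ a) (inj₂ i) (inj₁ b) (inj₂ j) a≤i (ℕ.≰⇒> b≰i) b≤j (inj₁ a~b) (inj₂ iτj)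
    ... | no _    | no a≰j  | no b≰i  | yes b≤j
      with () ← nc (inj₂ i) (inj₁ b) (inj₂ j) (inj₁ a) (ℕ.≰⇒> b≰i) b≤j (ℕ.≰⇒> a≰j) (inj₂ iτj) (inj₁ (sym a~b))

    σ-largest : ∀ τ → UnionNonCrossing π τ → τ ⊑ σ
    σ-largest τ nc i j iτj with <-cmp i j
    ... | tri< i<j _ _    = lab-complete (below-< τ nc i<j iτj)
    ... | tri≈ _ refl _   = refl
    ... | tri> _ _ j<i    = sym (lab-complete (below-< τ nc j<i (sym iτj)))

  kreweras : ∃ (IsKreweras π)
  kreweras = σ , σ-union , σ-largest

Kr : ∀ {n} → NC n → NC n
Kr π = proj₁ (Kreweras.kreweras π)

-- The scalars are a parameter so that everything can be reasoned about without
-- unfolding the construction of ℂ; the module is instantiated at ℂ below.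
module FreeProbability {c ℓ₀} (K : CommutativeRing c ℓ₀) where

  private
    module K = CommutativeRing K
    open K using () renaming (Carrier to 𝕂)
    open SemiringExp K.semiring using (_^_)

  sumNC : ∀ n → (NC n → 𝕂) → 𝕂
  sumNC n f = List.foldr K._+_ K.0# (List.map f (allNC n))

  infix 5 sumNC
  syntax sumNC n (λ π → e) = ∑[ π ∈NC n ] e

  record UnitalAlgebra a ℓ : Set (c ⊔ˡ ℓ₀ ⊔ˡ lsuc (a ⊔ˡ ℓ)) where
    infixr 7 _·_
    field
      ring : Ring a ℓ
    open Ring ring public
    field
      _·_          : 𝕂 → Carrier → Carrier
      isLeftModule : IsLeftModule K.ring _≈_ _+_ 0# -_ _·_
      ·-*-assocˡ   : ∀ k x y → (k · x) * y ≈ k · (x * y)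
      ·-*-assocʳ   : ∀ k x y → x * (k · y) ≈ k · (x * y)

    rawLeftModule : RawLeftModule 𝕂 a ℓ
    rawLeftModule = record { _≈ᴹ_ = _≈_ ; _+ᴹ_ = _+_ ; _*ₗ_ = _·_ ; 0ᴹ = 0# ; -ᴹ_ = -_ }

    product : ∀ {n} → Vec Carrier n → Carrier
    product = Vec.foldr′ _*_ 1#

  record NCProbabilitySpace a ℓ : Set (c ⊔ˡ ℓ₀ ⊔ˡ lsuc (a ⊔ˡ ℓ)) where
    field
      algebra : UnitalAlgebra a ℓ
    open UnitalAlgebra algebra public
    open LeftModuleMorphisms rawLeftModule (TensorUnit.rawLeftModule {R = K.rawRing})
    field
      φ        : Carrier → 𝕂
      φ-linear : IsLeftModuleHomomorphism φ
      φ-1      : φ 1# K.≈ K.1#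

  module Space {a ℓ} (𝒜 : NCProbabilitySpace a ℓ) where

    open NCProbabilitySpace 𝒜 public

    record IsUnitalSubalgebra {p} (S : Pred Carrier p) : Set (c ⊔ˡ a ⊔ˡ ℓ ⊔ˡ p) where
      field
        resp-≈   : ∀ {x y} → x ≈ y → x ∈ S → y ∈ S
        1-closed : 1# ∈ S
        +-closed : ∀ {x y} → x ∈ S → y ∈ S → x + y ∈ S
        *-closed : ∀ {x y} → x ∈ S → y ∈ S → x * y ∈ S
        ·-closed : ∀ k {x} → x ∈ S → k · x ∈ S

    -- s i tells which of the two subalgebras the i-th factor is taken from.
    FreelyIndependent : ∀ {p} (ℳ 𝒩 : Pred Carrier p) → Set (a ⊔ˡ ℓ₀ ⊔ˡ p)
    FreelyIndependent ℳ 𝒩 = ∀ k (s : Vec Bool (suc k)) (x : Vec Carrier (suc k)) →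
      (∀ i → lookup s (inject₁ i) ≢ lookup s (suc i)) →
      (∀ i → lookup x i ∈ (if lookup s i then ℳ else 𝒩)) →
      (∀ i → φ (lookup x i) K.≈ K.0#) →
      φ (product x) K.≈ K.0#

    -- A sequence of functionals is indexed by all n; the value at n = 0 is
    -- unconstrained and never used, since blocks are non-empty.
    Functionals : Set (c ⊔ˡ a)
    Functionals = ∀ n → Vec Carrier n → 𝕂

    record IsMultilinear {n} (ψ : Vec Carrier n → 𝕂) : Set (c ⊔ˡ ℓ₀ ⊔ˡ a ⊔ˡ ℓ) where
      field
        ψ-cong : ∀ {x y} → Pointwise _≈_ x y → ψ x K.≈ ψ y
        +-homo : ∀ x i u v → ψ (x [ i ]≔ (u + v)) K.≈ ψ (x [ i ]≔ u) K.+ ψ (x [ i ]≔ v)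
        ·-homo : ∀ x i k u → ψ (x [ i ]≔ (k · u)) K.≈ k K.* ψ (x [ i ]≔ u)

    _∣_ : ∀ {n} → Vec Carrier n → (V : List (Fin n)) → Vec Carrier (length V)
    x ∣ V = Vec.map (lookup x) (fromList V)

    _⟦_⟧ : Functionals → ∀ {n} → NC n → Vec Carrier n → 𝕂
    (ψ ⟦ π ⟧) x = List.foldr K._*_ K.1# (List.map (λ V → ψ (length V) (x ∣ V)) (blocks π))

    record IsTBooleanCumulants (t : 𝕂) (β : Functionals) : Set (c ⊔ˡ ℓ₀ ⊔ˡ a ⊔ˡ ℓ) where
      field
        multilinear    : ∀ n → .{{ℕ.NonZero n}} → IsMultilinear (β n)
        moment-formula : ∀ n → .{{_ : ℕ.NonZero n}} → ∀ (x : Vec Carrier n) →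
          φ (product x) K.≈ ∑[ π ∈NC n ] (t ^ inner π) K.* (β ⟦ π ⟧) x

open FreeProbability ℂ-commutativeRing public

{-# OPTIONS --safe #-}

-- A sequence of functionals is a formal power series on words, and inserting words
-- into the gaps of a block is substitution of series: Sub U sends every letter to U
-- times that letter.  If F collects the t-Boolean cumulants, then the Boolean cumulants
-- are b = Int N F with N = 1 + t b N, and the moments are (1 - b)⁻¹, so F is determined
-- by the moments.  The right-hand side of the theorem is the product X Y of the
-- solutions of X = Int Y Fˣ and Y = Int X Fʸ, and filling its gaps with N turns X and Y
-- into X̃ = Int (Ỹ N) Fˣ and Ỹ = Int (N X̃) Fʸ.  The resolvents
-- u = (x - X̃) (1 - Ỹ x)⁻¹ and v = (y - Ỹ) (1 - X̃ y)⁻¹ are then centred, and (1 - x y)⁻¹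
-- expands into alternating products of them; by freeness φ ((1 - x y)⁻¹) = (1 - X̃ Ỹ)⁻¹,
-- so the products xᵢ y have Boolean cumulants X̃ Ỹ and hence t-Boolean cumulants X Y.
--
-- The sums over NC(n + 1) are matched with these equations by splitting a partition into
-- the gap between the first point and its successor in its block, and the remaining
-- points.  In the Kreweras complement the first point joins the last block of the gap.

module Submission where

open import Algebra.Bundles using (Ring; CommutativeRing)
open import Data.Empty using (⊥; ⊥-elim; ⊥-elim-irr)
open import Data.Maybe.Base as Maybe using (Maybe; just; nothing)
open import Data.Nat.Base as ℕ using (ℕ; zero; suc; z≤n; s≤s; NonZero)
import Data.Nat.Properties as ℕ
open import Data.Product.Base using (Σ; ∃; ∃₂; _×_; _,_; proj₁; proj₂)
open import Data.Unit.Base using (⊤; tt)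
open import Function.Base using (_∘_; id)
open import Level using (_⊔_)
open import Relation.Binary.Definitions using (tri<; tri≈; tri>)
import Relation.Binary.Reasoning.Setoid as SetoidReasoning

-- The pair `N`, `M` encodes inner(π): every block in a gap of another block is inner, so the blocks
-- in a gap carry a factor t each and sum to `N`, while the outermost blocks of a word carry none;
-- hence N = 1 + t b N but M = 1 + b M. Working with `N` and `b` instead of rescaling by t to free
-- cumulants avoids division, so t = 0 is no exception. Words record only the letters x. Since y is
-- a constant series, substituting for its letter does not lengthen words, and that recursion is
-- well founded only because the substituted series has no constant term. Convergence is therefore
-- tracked throughout, by agreement on words shorter than n. The shifts X̃ and Ỹ are forced by
-- centring: with Z = Int W Fˣ, φ (x (1 - U x)⁻¹) = Z φ ((1 - U x)⁻¹) as soon as W = U + t U Z W,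
-- and U = Ỹ, W = Ỹ N satisfy this because N = 1 + t X̃ Ỹ N. The y side is the mirror image.

-- Non-commutative power series and guarded fixed points.

module FormalSeries where

  open import Data.List.Base using (List; []; _∷_; length)
  import Algebra.Construct.Pointwise as Pointwise

  -- Formal power series in non-commuting variables L, as functions on words.
  module Series {c ℓ l} (R : Ring c ℓ) (L : Set l) where

    open Ring R hiding (zero)
    open import Algebra.Properties.CommutativeSemigroup +-commutativeSemigroup using (interchange)
    open SetoidReasoning setoid

    𝓦 : Set (c ⊔ l)
    𝓦 = List L → Carrier

    infix 4 _≋_
    _≋_ : 𝓦 → 𝓦 → Set (ℓ ⊔ l)
    f ≋ g = ∀ w → f w ≈ g w

    infixl 6 _⊕_
    _⊕_ : 𝓦 → 𝓦 → 𝓦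
    (f ⊕ g) w = f w + g w

    ∂ : L → 𝓦 → 𝓦
    ∂ x f w = f (x ∷ w)

    const : Carrier → 𝓦
    const k []      = k
    const k (_ ∷ _) = 0#

    infixr 8 _•_
    _•_ : Carrier → 𝓦 → 𝓦
    (k • f) w = k * f w

    infixl 7 _⊛_
    -- The Cauchy product: a sum over all ways to cut the word in two, unfolded through the
    -- derivative of the left factor.
    _⊛_ : 𝓦 → 𝓦 → 𝓦
    (f ⊛ g) []      = f [] * g []
    (f ⊛ g) (x ∷ w) = f [] * g (x ∷ w) + (∂ x f ⊛ g) w

    0≋ : 𝓦
    0≋ _ = 0#

    ⊛-cong : ∀ {f f′ g g′} → f ≋ f′ → g ≋ g′ → f ⊛ g ≋ f′ ⊛ g′
    ⊛-cong p q []      = *-cong (p []) (q [])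
    ⊛-cong p q (x ∷ w) = +-cong (*-cong (p []) (q (x ∷ w))) (⊛-cong (λ v → p (x ∷ v)) q w)

    ⊛-zeroˡ : ∀ g → 0≋ ⊛ g ≋ 0≋
    ⊛-zeroˡ g []      = zeroˡ _
    ⊛-zeroˡ g (x ∷ w) = trans (+-cong (zeroˡ _) (⊛-zeroˡ g w)) (+-identityˡ _)

    const-⊛ : ∀ k g → const k ⊛ g ≋ k • g
    const-⊛ k g []      = refl
    const-⊛ k g (x ∷ w) = trans (+-congˡ (⊛-zeroˡ g w)) (+-identityʳ _)

    ⊛-const : ∀ f k w → (f ⊛ const k) w ≈ f w * k
    ⊛-const f k []      = refl
    ⊛-const f k (x ∷ w) = trans (+-cong (zeroʳ _) (⊛-const (∂ x f) k w)) (+-identityˡ _)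

    ⊛-distribʳ : ∀ h f g → (f ⊕ g) ⊛ h ≋ f ⊛ h ⊕ g ⊛ h
    ⊛-distribʳ h f g []      = distribʳ _ _ _
    ⊛-distribʳ h f g (x ∷ w) =
      trans (+-cong (distribʳ _ _ _) (⊛-distribʳ h (∂ x f) (∂ x g) w)) (interchange _ _ _ _)

    ⊛-distribˡ : ∀ f g h → f ⊛ (g ⊕ h) ≋ f ⊛ g ⊕ f ⊛ h
    ⊛-distribˡ f g h []      = distribˡ _ _ _
    ⊛-distribˡ f g h (x ∷ w) =
      trans (+-cong (distribˡ _ _ _) (⊛-distribˡ (∂ x f) g h w)) (interchange _ _ _ _)

    •-⊛ : ∀ k f g → (k • f) ⊛ g ≋ k • (f ⊛ g)
    •-⊛ k f g []      = *-assoc _ _ _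
    •-⊛ k f g (x ∷ w) =
      trans (+-cong (*-assoc _ _ _) (•-⊛ k (∂ x f) g w)) (sym (distribˡ _ _ _))

    ⊛-assoc : ∀ f g h → (f ⊛ g) ⊛ h ≋ f ⊛ (g ⊛ h)
    ⊛-assoc f g h []      = *-assoc _ _ _
    ⊛-assoc f g h (x ∷ w) = begin
      f [] * g [] * h (x ∷ w) + (((f [] • ∂ x g) ⊕ (∂ x f ⊛ g)) ⊛ h) w
        ≈⟨ +-cong (*-assoc _ _ _) (⊛-distribʳ h (f [] • ∂ x g) (∂ x f ⊛ g) w) ⟩
      f [] * (g [] * h (x ∷ w)) + (((f [] • ∂ x g) ⊛ h) w + ((∂ x f ⊛ g) ⊛ h) w)
        ≈⟨ +-congˡ (+-cong (•-⊛ _ (∂ x g) h w) (⊛-assoc (∂ x f) g h w)) ⟩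
      f [] * (g [] * h (x ∷ w)) + (f [] * (∂ x g ⊛ h) w + (∂ x f ⊛ (g ⊛ h)) w)
        ≈⟨ +-assoc _ _ _ ⟨
      f [] * (g [] * h (x ∷ w)) + f [] * (∂ x g ⊛ h) w + (∂ x f ⊛ (g ⊛ h)) w
        ≈⟨ +-congʳ (distribˡ _ _ _) ⟨
      f [] * (g [] * h (x ∷ w) + (∂ x g ⊛ h) w) + (∂ x f ⊛ (g ⊛ h)) w ∎

    ⊛-identityˡ : ∀ f → const 1# ⊛ f ≋ f
    ⊛-identityˡ f w = trans (const-⊛ 1# f w) (*-identityˡ _)

    ⊛-identityʳ : ∀ f → f ⊛ const 1# ≋ f
    ⊛-identityʳ f w = trans (⊛-const f 1# w) (*-identityʳ _)

    seriesRing : Ring (c ⊔ l) (ℓ ⊔ l)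
    seriesRing = record
      { Carrier = 𝓦 ; _≈_ = _≋_ ; _+_ = _⊕_ ; _*_ = _⊛_
      ; -_ = λ f w → - f w ; 0# = 0≋ ; 1# = const 1#
      ; isRing = record
        { +-isAbelianGroup = Pointwise.isAbelianGroup (List L) +-isAbelianGroup
        ; *-cong = ⊛-cong
        ; *-assoc = ⊛-assoc
        ; *-identity = ⊛-identityˡ , ⊛-identityʳ
        ; distrib = ⊛-distribˡ , ⊛-distribʳ } }

    module 𝓦 = Ring seriesRing

    shift : (L → 𝓦) → 𝓦
    shift Φ []      = 0#
    shift Φ (x ∷ w) = Φ x w

    ∂-⊛ : ∀ x f g → f [] ≈ 0# → ∂ x (f ⊛ g) ≋ ∂ x f ⊛ g
    ∂-⊛ x f g f0 w = trans (+-congʳ (trans (*-congʳ f0) (zeroˡ _))) (+-identityˡ _)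

    shift-⊛ : ∀ Φ g → shift Φ ⊛ g ≋ shift (λ x → Φ x ⊛ g)
    shift-⊛ Φ g []      = zeroˡ _
    shift-⊛ Φ g (x ∷ w) = ∂-⊛ x (shift Φ) g refl w

    infix 4 _≈[_]_
    -- Convergence in the topology of word length. Strictness makes the case n = 0 vacuous, which is
    -- the base case of the approximation arguments.
    _≈[_]_ : 𝓦 → ℕ → 𝓦 → Set (ℓ ⊔ l)
    f ≈[ n ] g = ∀ w → length w ℕ.< n → f w ≈ g w

    ≋⇒≈[] : ∀ {n f g} → f ≋ g → f ≈[ n ] g
    ≋⇒≈[] p w _ = p w

    ≈[]⇒≋ : ∀ {f g} → (∀ n → f ≈[ n ] g) → f ≋ g
    ≈[]⇒≋ p w = p (suc (length w)) w ℕ.≤-refl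

    ⊕-cong[] : ∀ {n f f′ g g′} → f ≈[ n ] f′ → g ≈[ n ] g′ → f ⊕ g ≈[ n ] f′ ⊕ g′
    ⊕-cong[] p q w w< = +-cong (p w w<) (q w w<)

    ⊛-cong[] : ∀ {n f f′ g g′} → f ≈[ n ] f′ → g ≈[ n ] g′ → f ⊛ g ≈[ n ] f′ ⊛ g′
    ⊛-cong[] p q []      w< = *-cong (p [] w<) (q [] w<)
    ⊛-cong[] p q (x ∷ w) w< = +-cong (*-cong (p [] (ℕ.≤-<-trans z≤n w<)) (q (x ∷ w) w<))
      (⊛-cong[] {suc (length w)} (λ v v≤ → p (x ∷ v) (ℕ.≤-<-trans v≤ w<))
                                (λ v v≤ → q v (ℕ.<-trans (ℕ.≤-<-trans (ℕ.s≤s⁻¹ v≤) (ℕ.n<1+n _)) w<)) w ℕ.≤-refl)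

    -- A left factor without constant term consumes at least one letter, so the right factor is read
    -- only on strictly shorter words.
    ⊛-raise : ∀ {n f g g′} → f [] ≈ 0# → g ≈[ n ] g′ → f ⊛ g ≈[ suc n ] f ⊛ g′
    ⊛-raise f0 q []      w< = trans (*-congʳ f0) (trans (zeroˡ _) (sym (trans (*-congʳ f0) (zeroˡ _))))
    ⊛-raise {n} {f} {g} {g′} f0 q (x ∷ w) (s≤s w<) = trans (∂-⊛ x f g f0 w)
      (trans (⊛-cong[] {n} {∂ x f} (λ _ _ → refl) q w w<) (sym (∂-⊛ x f g′ f0 w)))

    ⊛-raise₂ : ∀ {n f f′ g g′} → f [] ≈ 0# → f ≈[ suc n ] f′ → g ≈[ n ] g′ → f ⊛ g ≈[ suc n ] f′ ⊛ g′
    ⊛-raise₂ {n} {f} {f′} {g} {g′} f0 p q w w< =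
      trans (⊛-raise f0 q w w<) (⊛-cong[] {suc n} {f} {f′} {g′} p (λ _ _ → refl) w w<)

    shift-raise : ∀ {n Φ Ψ} → (∀ x → Φ x ≈[ n ] Ψ x) → shift Φ ≈[ suc n ] shift Ψ
    shift-raise p []      _        = refl
    shift-raise p (x ∷ w) (s≤s w<) = p x w w<

    -- Whole families are solved for at once: the index `J` is `⊤` for a single series, and a type
    -- of series for a substitution, whose value at one series depends on its values at the
    -- derivatives.
    module Fixpoint {j} {J : Set j} (T : (J → 𝓦) → J → 𝓦) where

      Contractive : Set (c ⊔ ℓ ⊔ l ⊔ j)
      Contractive = ∀ {n f g} → (∀ j → f j ≈[ n ] g j) → ∀ j → T f j ≈[ suc n ] T g j

      iterate : ℕ → J → 𝓦
      iterate zero    _ _ = 0#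
      iterate (suc n) = T (iterate n)

      -- The coefficient at a word of length n is final after n + 1 iterations, so the limit is read
      -- off along the diagonal.
      fix : J → 𝓦
      fix j w = iterate (suc (length w)) j w

      module _ (contractive : Contractive) where

        iterate-stable : ∀ {m n} → m ℕ.≤ n → ∀ j → iterate m j ≈[ m ] iterate n j
        iterate-stable (z≤n)   j w ()
        iterate-stable (s≤s p) = contractive (iterate-stable p)

        iterate≈fix : ∀ n j → iterate n j ≈[ n ] fix j
        iterate≈fix n j w w< = sym (iterate-stable w< j w ℕ.≤-refl)

        fix-eq : ∀ j → fix j ≋ T fix j
        fix-eq j w = contractive (iterate≈fix (length w)) j w ℕ.≤-refl

        fix-unique : ∀ {f g} → (∀ j → f j ≋ T f j) → (∀ j → g j ≋ T g j) → ∀ j → f j ≋ g j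
        fix-unique {f} {g} p q j = ≈[]⇒≋ (λ n → agree n j)
          where
          agree : ∀ n j → f j ≈[ n ] g j
          agree zero    j w ()
          agree (suc n) j w w< = trans (p j w) (trans (contractive (agree n) j w w<) (sym (q j w)))

    -- (1 - f)⁻¹
    star : 𝓦 → 𝓦
    star f = Fixpoint.fix {J = ⊤} (λ s _ → const 1# ⊕ f ⊛ s tt) tt

    module _ {f : 𝓦} (f0 : f [] ≈ 0#) where

      private
        contractive : ∀ h → Fixpoint.Contractive {J = ⊤} (λ s _ → h ⊕ f ⊛ s tt)
        contractive h p _ = ⊕-cong[] {f = h} (λ _ _ → refl) (⊛-raise f0 (p tt))

      star-eq : star f ≋ const 1# ⊕ f ⊛ star f
      star-eq = Fixpoint.fix-eq _ (contractive (const 1#)) tt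

      star-unique : ∀ {h s s′} → s ≋ h ⊕ f ⊛ s → s′ ≋ h ⊕ f ⊛ s′ → s ≋ s′
      star-unique {h} {s} {s′} p q =
        Fixpoint.fix-unique _ (contractive h) {λ _ → s} {λ _ → s′} (λ _ → p) (λ _ → q) tt

      -- The right-hand side also solves s = 1 + f s, so uniqueness turns the left recursion of
      -- `star` into the right one.
      star-eqʳ : star f ≋ const 1# ⊕ star f ⊛ f
      star-eqʳ = star-unique star-eq λ w → begin
          const 1# w + (star f ⊛ f) w
            ≈⟨ +-congˡ (⊛-cong {g = f} star-eq (λ _ → refl) w) ⟩
          const 1# w + ((const 1# ⊕ f ⊛ star f) ⊛ f) w
            ≈⟨ +-congˡ (⊛-distribʳ f (const 1#) (f ⊛ star f) w) ⟩
          const 1# w + ((const 1# ⊛ f) w + ((f ⊛ star f) ⊛ f) w)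
            ≈⟨ +-congˡ (+-cong (trans (⊛-identityˡ f w) (sym (⊛-identityʳ f w))) (⊛-assoc f (star f) f w)) ⟩
          const 1# w + ((f ⊛ const 1#) w + (f ⊛ (star f ⊛ f)) w)
            ≈⟨ +-congˡ (⊛-distribˡ f (const 1#) (star f ⊛ f) w) ⟨
          const 1# w + (f ⊛ (const 1# ⊕ star f ⊛ f)) w ∎

    -- Since h [] = 1, the constant terms of f and g agree; then the summand f [] h (x ∷ w) cancels
    -- and the claim passes to the derivatives.
    ⊛-cancelʳ : ∀ {h f g} → h [] ≈ 1# → f ⊛ h ≋ g ⊛ h → f ≋ g
    ⊛-cancelʳ {h} {f} {g} h1 p [] = trans (sym (*-identityʳ _)) (trans (*-congˡ (sym h1))
      (trans (p []) (trans (*-congˡ h1) (*-identityʳ _))))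
    ⊛-cancelʳ {h} {f} {g} h1 p (x ∷ w) = ⊛-cancelʳ {h} {∂ x f} {∂ x g} h1
      (λ v → +-cancelˡ _ _ _ (trans (p (x ∷ v)) (+-congʳ (*-congʳ (sym (⊛-cancelʳ {h} {f} {g} h1 p []))))) ) w
      where open import Algebra.Properties.Group +-group using () renaming (∙-cancelˡ to +-cancelˡ)

-- Substitution of series for the letters of a series.

module Substitutions where

  open FormalSeries
  open import Data.List.Base using ([]; _∷_; length)

  -- A continuous algebra homomorphism from series in the letters B to series in
  -- the letters L sends a letter b to U ⊛ ẑ b for a formal "generic letter" ẑ.
  -- Only the operator J : Φ ↦ Σ_b ẑ b ⊛ Φ b is recorded, because B may be infinite.
  module Substitution {c ℓ b l} (K : CommutativeRing c ℓ) (B : Set b) (L : Set l) where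

    private
      module K = CommutativeRing K
      module SB = Series K.ring B
    open Series K.ring L public

    ⊛-• : ∀ k f g → f ⊛ (k • g) ≋ k • (f ⊛ g)
    ⊛-• k f g w = begin
      (f ⊛ (k • g)) w         ≈⟨ ⊛-cong {f} (λ _ → K.refl) (const-⊛ k g) w ⟨
      (f ⊛ (const k ⊛ g)) w   ≈⟨ ⊛-assoc f (const k) g w ⟨
      ((f ⊛ const k) ⊛ g) w
        ≈⟨ ⊛-cong {g = g} (λ v → K.trans (⊛-const f k v) (K.*-comm _ _)) (λ _ → K.refl) w ⟩
      ((k • f) ⊛ g) w         ≈⟨ •-⊛ k f g w ⟩
      k K.* (f ⊛ g) w         ∎
      where open SetoidReasoning K.setoid

    •-cong : ∀ {k k′ f g} → k K.≈ k′ → f ≋ g → k • f ≋ k′ • g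
    •-cong p q w = K.*-cong p (q w)

    const-+ : ∀ j k → const (j K.+ k) ≋ const j ⊕ const k
    const-+ j k []      = K.refl
    const-+ j k (_ ∷ _) = K.sym (K.+-identityˡ _)

    const-* : ∀ j k → const (j K.* k) ≋ j • const k
    const-* j k []      = K.refl
    const-* j k (_ ∷ _) = K.sym (K.zeroʳ _)

    const-cong : ∀ {j k} → j K.≈ k → const j ≋ const k
    const-cong p []      = p
    const-cong p (_ ∷ _) = K.refl

    •-⊕ : ∀ k f g → k • (f ⊕ g) ≋ k • f ⊕ k • g
    •-⊕ k f g w = K.distribˡ _ _ _

    -- The properties of Φ ↦ Σ_b ẑ b ⊛ Φ b used below: continuity, linearity, and compatibility with
    -- multiplication from the right, on the side away from ẑ b. `J-local` gains no precision, since
    -- a letter may be sent to something of length zero; the gain is demanded of U ⊛ ẑ in `Raises`.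
    record IsLetter (J : (B → 𝓦) → 𝓦) : Set (c ⊔ ℓ ⊔ b ⊔ l) where
      field
        J-local : ∀ {n Φ Ψ} → (∀ b → Φ b ≈[ n ] Ψ b) → J Φ ≈[ n ] J Ψ
        J-⊕     : ∀ Φ Ψ → J (λ b → Φ b ⊕ Ψ b) ≋ J Φ ⊕ J Ψ
        J-•     : ∀ k Φ → J (λ b → k • Φ b) ≋ k • J Φ
        J-⊛     : ∀ Φ g → J (λ b → Φ b ⊛ g) ≋ J Φ ⊛ g

      J-cong : ∀ {Φ Ψ} → (∀ b → Φ b ≋ Ψ b) → J Φ ≋ J Ψ
      J-cong p w = J-local {suc (length w)} (λ b → ≋⇒≈[] (p b)) w ℕ.≤-refl

    module Sub {J : (B → 𝓦) → 𝓦} (isLetter : IsLetter J) where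

      open IsLetter isLetter
      open SetoidReasoning 𝓦.setoid

      -- The guard that makes the recursion of `Sub U` contractive. It holds for every U if ẑ reads
      -- a letter, and for U without constant term if ẑ is evaluated.
      Raises : 𝓦 → Set (c ⊔ ℓ ⊔ b ⊔ l)
      Raises U = ∀ {n Φ Ψ} → (∀ b → Φ b ≈[ n ] Ψ b) → U ⊛ J Φ ≈[ suc n ] U ⊛ J Ψ

      raises-⊛ : ∀ V {U} → Raises U → Raises (V ⊛ U)
      raises-⊛ V {U} r {n} {Φ} {Ψ} p w w< = K.trans (⊛-assoc V U (J Φ) w)
        (K.trans (⊛-cong[] {suc n} {V} {V} (λ _ _ → K.refl) (r p) w w<) (K.sym (⊛-assoc V U (J Ψ) w)))

      raises-cong : ∀ {U V} → U ≋ V → Raises U → Raises V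
      raises-cong {U} {V} e r {n} {Φ} {Ψ} p w w< = K.trans (⊛-cong {g = J Φ} (λ v → K.sym (e v)) (λ _ → K.refl) w)
        (K.trans (r p w w<) (⊛-cong {g = J Ψ} e (λ _ → K.refl) w))

      Sub : 𝓦 → SB.𝓦 → 𝓦
      Sub U = Fixpoint.fix (λ S F → const (F []) ⊕ U ⊛ J (λ b → S (SB.∂ b F)))

      -- Sub U F = const (F []) ⊕ U ⊛ Int U F: only the gaps between the letters
      -- of F are filled with U.
      Int : 𝓦 → SB.𝓦 → 𝓦
      Int U F = J (λ b → Sub U (SB.∂ b F))

      module _ {U : 𝓦} (raises : Raises U) where

        coalgebra-contractive : ∀ {i} {I : Set i} (h : I → 𝓦) (d : B → I → I) →
          Fixpoint.Contractive (λ S i → h i ⊕ U ⊛ J (λ b → S (d b i)))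
        coalgebra-contractive h d p i = ⊕-cong[] {f = h i} (λ _ _ → K.refl) (raises (λ b → p (d b i)))

        -- Coinduction: i is a state with output h i and transitions d b i, and such a system has
        -- one solution. The laws of `Sub` below are instances, each with its own type of states.
        coalgebra-unique : ∀ {i} {I : Set i} (h : I → 𝓦) (d : B → I → I) {f g : I → 𝓦} →
          (∀ i → f i ≋ h i ⊕ U ⊛ J (λ b → f (d b i))) →
          (∀ i → g i ≋ h i ⊕ U ⊛ J (λ b → g (d b i))) → ∀ i → f i ≋ g i
        coalgebra-unique h d = Fixpoint.fix-unique _ (coalgebra-contractive h d)

        Sub-eq : ∀ F → Sub U F ≋ const (F []) ⊕ U ⊛ Int U F
        Sub-eq = Fixpoint.fix-eq _ (coalgebra-contractive (λ F → const (F [])) SB.∂)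

        Sub-unique : ∀ {S : SB.𝓦 → 𝓦} → (∀ F → S F ≋ const (F []) ⊕ U ⊛ J (λ b → S (SB.∂ b F))) →
                     ∀ F → S F ≋ Sub U F
        Sub-unique p = coalgebra-unique (λ F → const (F [])) SB.∂ p Sub-eq

        -- A family indexed by functions need not respect pointwise equality, so the states are
        -- pairs of equal series together with the proof of equality.
        Sub-cong : ∀ {F G} → F SB.≋ G → Sub U F ≋ Sub U G
        Sub-cong {F} {G} F≋G = coalgebra-unique {I = ∃₂ SB._≋_}
          (λ (F , _ , _) → const (F [])) (λ b (F , G , p) → SB.∂ b F , SB.∂ b G , (λ v → p (b ∷ v)))
          {λ (F , _) → Sub U F} {λ (_ , G , _) → Sub U G}
          (λ (F , _) → Sub-eq F)
          (λ (F , G , p) w → K.trans (Sub-eq G w) (K.+-congʳ (const-cong (K.sym (p [])) w)))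
          (F , G , F≋G)

        Int-cong : ∀ {F G} → F SB.≋ G → Int U F ≋ Int U G
        Int-cong p = J-cong (λ b → Sub-cong (λ v → p (b ∷ v)))

        Sub-⊕ : ∀ F G → Sub U (F SB.⊕ G) ≋ Sub U F ⊕ Sub U G
        Sub-⊕ F G = coalgebra-unique {I = SB.𝓦 × SB.𝓦}
          (λ (F , G) → const (F [] K.+ G [])) (λ b (F , G) → SB.∂ b F , SB.∂ b G)
          {λ (F , G) → Sub U (F SB.⊕ G)} {λ (F , G) → Sub U F ⊕ Sub U G}
          (λ (F , G) → Sub-eq (F SB.⊕ G)) (λ (F , G) → split F G) (F , G)
          where
          open import Algebra.Properties.CommutativeSemigroup 𝓦.+-commutativeSemigroup using (interchange)
          split : ∀ F G → Sub U F ⊕ Sub U G ≋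
            const (F [] K.+ G []) ⊕ U ⊛ J (λ b → Sub U (SB.∂ b F) ⊕ Sub U (SB.∂ b G))
          split F G = begin
            Sub U F ⊕ Sub U G
              ≈⟨ 𝓦.+-cong {Sub U F} {_} {Sub U G} (Sub-eq F) (Sub-eq G) ⟩
            (const (F []) ⊕ U ⊛ Int U F) ⊕ (const (G []) ⊕ U ⊛ Int U G)
              ≈⟨ interchange (const (F [])) (U ⊛ Int U F) (const (G [])) (U ⊛ Int U G) ⟩
            (const (F []) ⊕ const (G [])) ⊕ (U ⊛ Int U F ⊕ U ⊛ Int U G)
              ≈⟨ 𝓦.+-cong (const-+ (F []) (G [])) (⊛-distribˡ U (Int U F) (Int U G)) ⟨
            const (F [] K.+ G []) ⊕ U ⊛ (Int U F ⊕ Int U G)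
              ≈⟨ 𝓦.+-cong {const (F [] K.+ G [])} 𝓦.refl
                   (⊛-cong {U} 𝓦.refl (J-⊕ (λ b → Sub U (SB.∂ b F)) (λ b → Sub U (SB.∂ b G)))) ⟨
            const (F [] K.+ G []) ⊕ U ⊛ J (λ b → Sub U (SB.∂ b F) ⊕ Sub U (SB.∂ b G)) ∎

        Int-⊕ : ∀ F G → Int U (F SB.⊕ G) ≋ Int U F ⊕ Int U G
        Int-⊕ F G = 𝓦.trans (J-cong (λ b → Sub-⊕ (SB.∂ b F) (SB.∂ b G)))
          (J-⊕ (λ b → Sub U (SB.∂ b F)) (λ b → Sub U (SB.∂ b G)))

        Sub-• : ∀ k F → Sub U (k SB.• F) ≋ k • Sub U F
        Sub-• k = coalgebra-unique {I = SB.𝓦} (λ F → const (k K.* F [])) SB.∂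
          {λ F → Sub U (k SB.• F)} {λ F → k • Sub U F} (λ F → Sub-eq (k SB.• F)) λ F → begin
            k • Sub U F                               ≈⟨ •-cong K.refl (Sub-eq F) ⟩
            k • (const (F []) ⊕ U ⊛ Int U F)          ≈⟨ •-⊕ k (const (F [])) (U ⊛ Int U F) ⟩
            k • const (F []) ⊕ k • (U ⊛ Int U F)      ≈⟨ 𝓦.+-cong (const-* k (F [])) (⊛-• k U (Int U F)) ⟨
            const (k K.* F []) ⊕ U ⊛ (k • Int U F)
              ≈⟨ 𝓦.+-cong {const (k K.* F [])} 𝓦.refl (⊛-cong {U} 𝓦.refl (J-• k (λ b → Sub U (SB.∂ b F)))) ⟨
            const (k K.* F []) ⊕ U ⊛ J (λ b → k • Sub U (SB.∂ b F)) ∎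

        Int-• : ∀ k F → Int U (k SB.• F) ≋ k • Int U F
        Int-• k F = 𝓦.trans (J-cong (λ b → Sub-• k (SB.∂ b F))) (J-• k (λ b → Sub U (SB.∂ b F)))

        -- The state (F , G) differentiates F only and outputs F [] • Sub U G; the product rule puts
        -- both sides into this form.
        Sub-⊛ : ∀ F G → Sub U (F SB.⊛ G) ≋ Sub U F ⊛ Sub U G
        Sub-⊛ F G = coalgebra-unique h d
          {λ (F , G) → Sub U (F SB.⊛ G)} {λ (F , G) → Sub U F ⊛ Sub U G}
          (λ (F , G) → eq₁ F G) (λ (F , G) → eq₂ F G) (F , G)
          where
          d : B → SB.𝓦 × SB.𝓦 → SB.𝓦 × SB.𝓦
          d b (F , G) = SB.∂ b F , G
          h : SB.𝓦 × SB.𝓦 → 𝓦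
          h (F , G) = F [] • Sub U G
          eq₁ : ∀ F G → Sub U (F SB.⊛ G) ≋ F [] • Sub U G ⊕ U ⊛ J (λ b → Sub U (SB.∂ b F SB.⊛ G))
          eq₁ F G = begin
            Sub U (F SB.⊛ G)
              ≈⟨ Sub-eq (F SB.⊛ G) ⟩
            const (F [] K.* G []) ⊕ U ⊛ J (λ b → Sub U (F [] SB.• SB.∂ b G SB.⊕ SB.∂ b F SB.⊛ G))
              ≈⟨ 𝓦.+-cong (const-* (F []) (G [])) (⊛-cong {U} 𝓦.refl (𝓦.trans
                   (J-cong (λ b → 𝓦.trans (Sub-⊕ (F [] SB.• SB.∂ b G) (SB.∂ b F SB.⊛ G))
                      (𝓦.+-cong {y = F [] • Sub U (SB.∂ b G)} (Sub-• (F []) (SB.∂ b G)) 𝓦.refl)))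
                   (J-⊕ (λ b → F [] • Sub U (SB.∂ b G)) (λ b → Sub U (SB.∂ b F SB.⊛ G))))) ⟩
            F [] • const (G []) ⊕ U ⊛ (J (λ b → F [] • Sub U (SB.∂ b G)) ⊕ J (λ b → Sub U (SB.∂ b F SB.⊛ G)))
              ≈⟨ 𝓦.+-cong {F [] • const (G [])} 𝓦.refl (𝓦.trans (⊛-distribˡ U _ _)
                   (𝓦.+-cong (𝓦.trans (⊛-cong {U} 𝓦.refl (J-• (F []) (λ b → Sub U (SB.∂ b G)))) (⊛-• (F []) U (Int U G))) 𝓦.refl)) ⟩
            F [] • const (G []) ⊕ (F [] • (U ⊛ Int U G) ⊕ U ⊛ J (λ b → Sub U (SB.∂ b F SB.⊛ G)))
              ≈⟨ 𝓦.+-assoc _ _ _ ⟨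
            (F [] • const (G []) ⊕ F [] • (U ⊛ Int U G)) ⊕ U ⊛ J (λ b → Sub U (SB.∂ b F SB.⊛ G))
              ≈⟨ 𝓦.+-cong {y = F [] • Sub U G} (𝓦.trans (𝓦.sym (•-⊕ (F []) (const (G [])) (U ⊛ Int U G)))
                   (•-cong K.refl (𝓦.sym (Sub-eq G)))) 𝓦.refl ⟩
            F [] • Sub U G ⊕ U ⊛ J (λ b → Sub U (SB.∂ b F SB.⊛ G)) ∎
          eq₂ : ∀ F G → Sub U F ⊛ Sub U G ≋ F [] • Sub U G ⊕ U ⊛ J (λ b → Sub U (SB.∂ b F) ⊛ Sub U G)
          eq₂ F G = begin
            Sub U F ⊛ Sub U G
              ≈⟨ ⊛-cong {g = Sub U G} (Sub-eq F) 𝓦.refl ⟩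
            (const (F []) ⊕ U ⊛ Int U F) ⊛ Sub U G
              ≈⟨ ⊛-distribʳ (Sub U G) (const (F [])) (U ⊛ Int U F) ⟩
            const (F []) ⊛ Sub U G ⊕ (U ⊛ Int U F) ⊛ Sub U G
              ≈⟨ 𝓦.+-cong (const-⊛ (F []) (Sub U G)) (⊛-assoc U (Int U F) (Sub U G)) ⟩
            F [] • Sub U G ⊕ U ⊛ (Int U F ⊛ Sub U G)
              ≈⟨ 𝓦.+-cong {F [] • Sub U G} 𝓦.refl (⊛-cong {U} 𝓦.refl (J-⊛ (λ b → Sub U (SB.∂ b F)) (Sub U G))) ⟨
            F [] • Sub U G ⊕ U ⊛ J (λ b → Sub U (SB.∂ b F) ⊛ Sub U G) ∎

        Int-⊛ : ∀ F G → Int U (F SB.⊛ G) ≋ F [] • Int U G ⊕ Int U F ⊛ Sub U G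
        Int-⊛ F G = begin
          J (λ b → Sub U (F [] SB.• SB.∂ b G SB.⊕ SB.∂ b F SB.⊛ G))
            ≈⟨ J-cong (λ b → 𝓦.trans (Sub-⊕ (F [] SB.• SB.∂ b G) (SB.∂ b F SB.⊛ G))
                 (𝓦.+-cong (Sub-• (F []) (SB.∂ b G)) (Sub-⊛ (SB.∂ b F) G))) ⟩
          J (λ b → F [] • Sub U (SB.∂ b G) ⊕ Sub U (SB.∂ b F) ⊛ Sub U G)
            ≈⟨ J-⊕ (λ b → F [] • Sub U (SB.∂ b G)) (λ b → Sub U (SB.∂ b F) ⊛ Sub U G) ⟩
          J (λ b → F [] • Sub U (SB.∂ b G)) ⊕ J (λ b → Sub U (SB.∂ b F) ⊛ Sub U G)
            ≈⟨ 𝓦.+-cong (J-• (F []) (λ b → Sub U (SB.∂ b G))) (J-⊛ (λ b → Sub U (SB.∂ b F)) (Sub U G)) ⟩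
          F [] • Int U G ⊕ Int U F ⊛ Sub U G ∎

      -- Each unfolding of `Sub-eq` gains one letter of precision, up to the bound n to which U and
      -- V are known to agree.
      Sub-congˡ[] : ∀ {U V} → Raises U → Raises V → ∀ {n} → U ≈[ n ] V → ∀ F → Sub U F ≈[ n ] Sub V F
      Sub-congˡ[] {U} {V} rU rV {n} U≈V F = agree n ℕ.≤-refl F
        where
        agree : ∀ m → m ℕ.≤ n → ∀ F → Sub U F ≈[ m ] Sub V F
        agree zero    _   F w ()
        agree (suc m) m<n F w w< = K.trans (Sub-eq rU F w) (K.trans
          (K.+-congˡ (K.trans (rU (λ b → agree m (ℕ.<⇒≤ m<n) (SB.∂ b F)) w w<)
            (⊛-cong[] {suc m} {U} {V} {Int V F} (λ v v< → U≈V v (ℕ.≤-trans v< m<n)) (λ _ _ → K.refl) w w<)))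
          (K.sym (Sub-eq rV F w)))

      Int-congˡ[] : ∀ {U V} → Raises U → Raises V → ∀ {n} → U ≈[ n ] V → ∀ F → Int U F ≈[ n ] Int V F
      Int-congˡ[] rU rV p F = J-local (λ b → Sub-congˡ[] rU rV p (SB.∂ b F))

      Sub-congˡ : ∀ {U V} → Raises U → U ≋ V → ∀ F → Sub U F ≋ Sub V F
      Sub-congˡ rU p F = ≈[]⇒≋ (λ n → Sub-congˡ[] rU (raises-cong p rU) (≋⇒≈[] p) F)

      Int-congˡ : ∀ {U V} → Raises U → U ≋ V → ∀ F → Int U F ≋ Int V F
      Int-congˡ rU p F = J-cong (λ b → Sub-congˡ rU p (SB.∂ b F))

-- Cumulant series, subordination and boxed convolution.

module CumulantSeries where

  open FormalSeries
  open Substitutions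
  open import Data.List.Base using ([]; _∷_)

  module ShiftLetter {c ℓ l} (K : CommutativeRing c ℓ) (L : Set l) where

    private module K = CommutativeRing K
    open Substitution K L L

    shift-isLetter : IsLetter shift
    shift-isLetter = record
      { J-local = λ { p [] _ → K.refl ; p (x ∷ w) w< → p x w (ℕ.<⇒≤ w<) }
      ; J-⊕     = λ { Φ Ψ [] → K.sym (K.+-identityˡ _) ; Φ Ψ (x ∷ w) → K.refl }
      ; J-•     = λ { k Φ [] → K.sym (K.zeroʳ _) ; k Φ (x ∷ w) → K.refl }
      ; J-⊛     = λ Φ g → 𝓦.sym (shift-⊛ Φ g) }

    open Sub shift-isLetter public

    shift-raises : ∀ U → Raises U
    shift-raises U p = ⊛-cong[] {f = U} (λ _ _ → K.refl) (shift-raise p)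

    -- `Int` uses U only after a first letter has been read, hence on strictly shorter words,
    -- whatever U [] is.
    Int-raise : ∀ {n U V} → U ≈[ n ] V → ∀ F → Int U F ≈[ suc n ] Int V F
    Int-raise p F = shift-raise λ x → Sub-congˡ[] (shift-raises _) (shift-raises _) p (∂ x F)

  module EvalLetter {c ℓ l} (K : CommutativeRing c ℓ) (L : Set l) where

    private module K = CommutativeRing K
    open Substitution K ⊤ L

    -- The letter y leaves no trace in the words over L: its generic letter is the unit, and
    -- `Sub U d` is the ordinary composition d(U).
    eval : (⊤ → 𝓦) → 𝓦
    eval Φ = Φ tt

    eval-isLetter : IsLetter eval
    eval-isLetter = record
      { J-local = λ p → p tt ; J-⊕ = λ _ _ → 𝓦.refl ; J-• = λ _ _ → 𝓦.refl ; J-⊛ = λ _ _ → 𝓦.refl }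

    open Sub eval-isLetter public

    eval-raises : ∀ {U} → U [] K.≈ K.0# → Raises U
    eval-raises U0 p = ⊛-raise U0 (p tt)

  module Composition {c ℓ b l} (K : CommutativeRing c ℓ) (B : Set b) (L : Set l)
    {J : (B → Substitution.𝓦 K B L) → Substitution.𝓦 K B L} (isLetter : Substitution.IsLetter K B L J) where

    private
      module K = CommutativeRing K
      module SB = Substitution K B B
      module CB = ShiftLetter K B
    open Substitution K B L
    open IsLetter isLetter
    open Sub isLetter
    open SetoidReasoning 𝓦.setoid

    module _ {U : 𝓦} (raises : Raises U) where

      Sub-0 : Sub U SB.0≋ ≋ 0≋
      Sub-0 = begin
        Sub U SB.0≋                  ≈⟨ Sub-cong raises (λ _ → K.zeroˡ K.0#) ⟨
        Sub U (K.0# SB.• SB.0≋)      ≈⟨ Sub-• raises K.0# SB.0≋ ⟩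
        K.0# • Sub U SB.0≋           ≈⟨ (λ _ → K.zeroˡ _) ⟩
        0≋                           ∎

      Int-const : ∀ k → Int U (SB.const k) ≋ 0≋
      Int-const k = begin
        J (λ b → Sub U SB.0≋)   ≈⟨ J-cong (λ _ → Sub-0) ⟩
        J (λ b → 0≋)            ≈⟨ J-cong (λ _ _ → K.zeroˡ K.0#) ⟨
        J (λ b → K.0# • 0≋)     ≈⟨ J-• K.0# (λ _ → 0≋) ⟩
        K.0# • J (λ b → 0≋)     ≈⟨ (λ _ → K.zeroˡ _) ⟩
        0≋                      ∎

      Sub-const : ∀ k → Sub U (SB.const k) ≋ const k
      Sub-const k = begin
        Sub U (SB.const k)                      ≈⟨ Sub-eq raises (SB.const k) ⟩
        const k ⊕ U ⊛ Int U (SB.const k)        ≈⟨ 𝓦.+-cong {const k} 𝓦.refl (⊛-cong {U} 𝓦.refl (Int-const k)) ⟩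
        const k ⊕ U ⊛ 0≋                        ≈⟨ 𝓦.+-cong {const k} 𝓦.refl (𝓦.zeroʳ U) ⟩
        const k ⊕ 0≋                            ≈⟨ 𝓦.+-identityʳ (const k) ⟩
        const k                                 ∎

      Sub-guarded : ∀ F → F [] K.≈ K.0# → Sub U F ≋ U ⊛ Int U F
      Sub-guarded F F0 = begin
        Sub U F                       ≈⟨ Sub-eq raises F ⟩
        const (F []) ⊕ U ⊛ Int U F    ≈⟨ 𝓦.+-cong {y = 0≋} (λ { [] → F0 ; (_ ∷ _) → K.refl }) 𝓦.refl ⟩
        0≋ ⊕ U ⊛ Int U F              ≈⟨ 𝓦.+-identityˡ _ ⟩
        U ⊛ Int U F                   ∎

      Int-⊛-guarded : ∀ F G → F [] K.≈ K.0# → Int U (F SB.⊛ G) ≋ Int U F ⊛ Sub U G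
      Int-⊛-guarded F G F0 = begin
        Int U (F SB.⊛ G)                            ≈⟨ Int-⊛ raises F G ⟩
        F [] • Int U G ⊕ Int U F ⊛ Sub U G
          ≈⟨ 𝓦.+-cong {F [] • Int U G} {0≋} (λ w → K.trans (K.*-congʳ F0) (K.zeroˡ _)) 𝓦.refl ⟩
        0≋ ⊕ Int U F ⊛ Sub U G                      ≈⟨ 𝓦.+-identityˡ _ ⟩
        Int U F ⊛ Sub U G                           ∎

      -- The inner substitution sends b to N b and the outer one sends this to Sub U N ⊛ U ⊛ ẑ b, so
      -- the composite is again a substitution, with series Sub U N ⊛ U.
      Sub-∘ : ∀ N F → Sub U (CB.Sub N F) ≋ Sub (Sub U N ⊛ U) F
      Sub-∘ N F = Sub-unique (raises-⊛ (Sub U N) raises) {λ F → Sub U (CB.Sub N F)} (λ F → begin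
        Sub U (CB.Sub N F)
          ≈⟨ Sub-cong raises (CB.Sub-eq (CB.shift-raises N) F) ⟩
        Sub U (SB.const (F []) SB.⊕ N SB.⊛ CB.Int N F)
          ≈⟨ Sub-⊕ raises (SB.const (F [])) (N SB.⊛ CB.Int N F) ⟩
        Sub U (SB.const (F [])) ⊕ Sub U (N SB.⊛ CB.Int N F)
          ≈⟨ 𝓦.+-cong (Sub-const (F [])) (Sub-⊛ raises N (CB.Int N F)) ⟩
        const (F []) ⊕ Sub U N ⊛ Sub U (CB.Int N F)
          ≈⟨ 𝓦.+-cong {const (F [])} 𝓦.refl (⊛-cong {Sub U N} 𝓦.refl (Sub-guarded (CB.Int N F) K.refl)) ⟩
        const (F []) ⊕ Sub U N ⊛ (U ⊛ Int U (CB.Int N F))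
          ≈⟨ 𝓦.+-cong {const (F [])} 𝓦.refl (⊛-assoc (Sub U N) U (Int U (CB.Int N F))) ⟨
        const (F []) ⊕ Sub U N ⊛ U ⊛ Int U (CB.Int N F) ∎) F

      Int-∘ : ∀ N F → Int U (CB.Int N F) ≋ Int (Sub U N ⊛ U) F
      Int-∘ N F = J-cong (λ b → Sub-∘ N (SB.∂ b F))

  -- N and b are the moment series and the Boolean cumulant series attached to
  -- the free cumulants t F; Boolean means that M = (1 - b)⁻¹ and N = (1 - t b)⁻¹.
  module Cumulants {c ℓ l} (K : CommutativeRing c ℓ) (t : CommutativeRing.Carrier K) (L : Set l)
    (F : Substitution.𝓦 K L L) where

    private module K = CommutativeRing K
    open Substitution K L L
    open ShiftLetter K L

    private
      T : (⊤ → 𝓦) → ⊤ → 𝓦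
      T N _ = const K.1# ⊕ t • (Int (N tt) F ⊛ N tt)

      T-contractive : Fixpoint.Contractive T
      T-contractive {n} {f} {g} p _ = ⊕-cong[] {f = const K.1#} (λ _ _ → K.refl)
        (λ w w< → K.*-congˡ (⊛-raise₂ {f = Int (f tt) F} {Int (g tt) F} K.refl (Int-raise (p tt) F) (p tt) w w<))

    N b M : 𝓦
    N = Fixpoint.fix T tt
    b = Int N F
    M = star b

    N-eq : N ≋ const K.1# ⊕ t • (b ⊛ N)
    N-eq = Fixpoint.fix-eq T T-contractive tt

    M-eq : M ≋ const K.1# ⊕ b ⊛ M
    M-eq = star-eq K.refl

    M-[] : M [] K.≈ K.1#
    M-[] = K.trans (M-eq []) (K.trans (K.+-congˡ (K.zeroˡ _)) (K.+-identityʳ _))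

  module Subordination {c ℓ b l} (K : CommutativeRing c ℓ) (t : CommutativeRing.Carrier K)
    (B : Set b) (L : Set l) {J : (B → Substitution.𝓦 K B L) → Substitution.𝓦 K B L}
    (isLetter : Substitution.IsLetter K B L J) (F : Substitution.𝓦 K B B) where

    private
      module K = CommutativeRing K
      module SB = Substitution K B B
      module C = Cumulants K t B F
    open Substitution K B L
    open IsLetter isLetter
    open Sub isLetter
    open Composition K B L isLetter
    open SetoidReasoning 𝓦.setoid

    -- `W-eq` is the equation N = 1 + t b N after substituting U ⊛ ẑ for the letters, multiplied by
    -- U from the right. Its one solution is `W′`, and through it `Int W F` becomes the Boolean
    -- cumulant series with its gaps filled by U.
    module _ {U W : 𝓦} (rU : Raises U) (rW : Raises W) (W-eq : W ≋ U ⊕ t • (U ⊛ (Int W F ⊛ W))) where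

      private
        W′ : 𝓦
        W′ = Sub U C.N ⊛ U

        rW′ : Raises W′
        rW′ = raises-⊛ (Sub U C.N) rU

        b≋ : Int U C.b ≋ Int W′ F
        b≋ = Int-∘ rU C.N F

        SubN-eq : Sub U C.N ≋ const K.1# ⊕ t • (U ⊛ Int W′ F ⊛ Sub U C.N)
        SubN-eq = begin
          Sub U C.N
            ≈⟨ Sub-cong rU C.N-eq ⟩
          Sub U (SB.const K.1# SB.⊕ t SB.• (C.b SB.⊛ C.N))
            ≈⟨ Sub-⊕ rU (SB.const K.1#) (t SB.• (C.b SB.⊛ C.N)) ⟩
          Sub U (SB.const K.1#) ⊕ Sub U (t SB.• (C.b SB.⊛ C.N))
            ≈⟨ 𝓦.+-cong (Sub-const rU K.1#) (𝓦.trans (Sub-• rU t (C.b SB.⊛ C.N)) (•-cong K.refl (Sub-⊛ rU C.b C.N))) ⟩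
          const K.1# ⊕ t • (Sub U C.b ⊛ Sub U C.N)
            ≈⟨ 𝓦.+-cong {const K.1#} 𝓦.refl (•-cong K.refl (⊛-cong {g = Sub U C.N}
                 (𝓦.trans (Sub-guarded rU C.b K.refl) (⊛-cong {U} 𝓦.refl b≋)) 𝓦.refl)) ⟩
          const K.1# ⊕ t • (U ⊛ Int W′ F ⊛ Sub U C.N) ∎

        W′-eq : W′ ≋ U ⊕ t • (U ⊛ (Int W′ F ⊛ W′))
        W′-eq = begin
          Sub U C.N ⊛ U
            ≈⟨ ⊛-cong {g = U} SubN-eq 𝓦.refl ⟩
          (const K.1# ⊕ t • (U ⊛ Int W′ F ⊛ Sub U C.N)) ⊛ U
            ≈⟨ ⊛-distribʳ U (const K.1#) (t • (U ⊛ Int W′ F ⊛ Sub U C.N)) ⟩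
          const K.1# ⊛ U ⊕ (t • (U ⊛ Int W′ F ⊛ Sub U C.N)) ⊛ U
            ≈⟨ 𝓦.+-cong (⊛-identityˡ U) (𝓦.trans (•-⊛ t (U ⊛ Int W′ F ⊛ Sub U C.N) U)
                 (•-cong K.refl (𝓦.trans (⊛-assoc (U ⊛ Int W′ F) (Sub U C.N) U) (⊛-assoc U (Int W′ F) W′)))) ⟩
          U ⊕ t • (U ⊛ (Int W′ F ⊛ W′)) ∎

        -- W occurs in the gaps of `Int W F` and once more behind it. Moving the trailing factor
        -- under `J` lets a single use of `rU` raise the precision of both.
        pull : ∀ V → U ⊛ (Int V F ⊛ V) ≋ U ⊛ J (λ b → Sub V (SB.∂ b F) ⊛ V)
        pull V = ⊛-cong {U} 𝓦.refl (𝓦.sym (J-⊛ (λ b → Sub V (SB.∂ b F)) V))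

        agree : ∀ n → W ≈[ n ] W′
        agree zero    w ()
        agree (suc n) w w< = K.trans (W-eq w) (K.trans
          (K.+-congˡ (K.*-congˡ (K.trans (pull W w) (K.trans
            (rU (λ b → ⊛-cong[] {n} (Sub-congˡ[] rW rW′ (agree n) (SB.∂ b F)) (agree n)) w w<)
            (K.sym (pull W′ w))))))
          (K.sym (W′-eq w)))

      Int-boolean : Int W F ≋ Int U C.b
      Int-boolean = 𝓦.trans (Int-congˡ rW (≈[]⇒≋ agree) F) (𝓦.sym b≋)

      -- This is M = 1 + b M under `Int U`. When M consists of moments, `Sub U M` is the expectation
      -- of (1 - U ẑ)⁻¹ and `Int U M` that of ẑ (1 - U ẑ)⁻¹, so the identity says that ẑ - Int W F
      -- times the resolvent has expectation 0.
      Int-moment : Int U C.M ≋ Int W F ⊛ (const K.1# ⊕ U ⊛ Int U C.M)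
      Int-moment = begin
        Int U C.M
          ≈⟨ Int-cong rU C.M-eq ⟩
        Int U (SB.const K.1# SB.⊕ C.b SB.⊛ C.M)
          ≈⟨ Int-⊕ rU (SB.const K.1#) (C.b SB.⊛ C.M) ⟩
        Int U (SB.const K.1#) ⊕ Int U (C.b SB.⊛ C.M)
          ≈⟨ 𝓦.+-cong (Int-const rU K.1#) (Int-⊛-guarded rU C.b C.M K.refl) ⟩
        0≋ ⊕ Int U C.b ⊛ Sub U C.M
          ≈⟨ 𝓦.+-identityˡ _ ⟩
        Int U C.b ⊛ Sub U C.M
          ≈⟨ ⊛-cong (𝓦.sym Int-boolean) (𝓦.trans (Sub-eq rU C.M)
               (𝓦.+-cong {y = const K.1#} {U ⊛ Int U C.M} (const-cong C.M-[]) 𝓦.refl)) ⟩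
        Int W F ⊛ (const K.1# ⊕ U ⊛ Int U C.M) ∎

  -- G is the boxed convolution of F and d.
  module Boxed {c ℓ l} (K : CommutativeRing c ℓ) (L : Set l)
    (F : Substitution.𝓦 K L L) (d : Substitution.𝓦 K ⊤ ⊤) where

    private
      module K = CommutativeRing K
      module ST = Substitution K ⊤ ⊤
      module Cx = ShiftLetter K L
      module Cy = EvalLetter K L
    open Substitution K L L
    open Composition K L L Cx.shift-isLetter using (Sub-const; Sub-guarded; Int-⊛-guarded; Int-∘)
    open SetoidReasoning 𝓦.setoid

    private
      -- Dropping the constant term makes `T` contractive on all series, as `Fixpoint` demands; the
      -- fixed point has none, so its equation is unaffected.
      tail : 𝓦 → 𝓦
      tail X = shift (λ x → ∂ x X)

      T : (⊤ → 𝓦) → ⊤ → 𝓦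
      T X _ = Cx.Int (Cy.Int (tail (X tt)) d) F

      T-contractive : Fixpoint.Contractive T
      T-contractive {n} {f} {g} p _ = Cx.Int-raise (Cy.Int-congˡ[] {tail (f tt)} {tail (g tt)} (Cy.eval-raises K.refl)
        (Cy.eval-raises K.refl) {n} (λ { [] _ → K.refl ; (x ∷ w) w< → p tt (x ∷ w) w< }) d) F

    -- Between neighbouring points of a block of π lies a stretch y x ⋯ x y whose ends share a block
    -- of Kr(π); between neighbouring points of a block of Kr(π) lies a stretch x y ⋯ y x whose ends
    -- share a block of π. Hence Y fills the gaps of F and X those of d.
    X Y G : 𝓦
    X = Fixpoint.fix T tt
    Y = Cy.Int X d
    G = X ⊛ Y

    X-raises : Cy.Raises X
    X-raises = Cy.eval-raises K.refl

    X-eq : X ≋ Cx.Int Y F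
    X-eq = begin
      X                               ≈⟨ Fixpoint.fix-eq T T-contractive tt ⟩
      Cx.Int (Cy.Int (tail X) d) F
        ≈⟨ Cx.Int-congˡ (Cx.shift-raises _) (Cy.Int-congˡ (Cy.eval-raises K.refl)
             (λ { [] → K.refl ; (x ∷ w) → K.refl }) d) F ⟩
      Cx.Int Y F                      ∎

    module _ (N : 𝓦) where

      private
        r : Cx.Raises N
        r = Cx.shift-raises N

      -- N enters between consecutive pairs x y, that is, before every x but the first of the
      -- product X Y. The leading factor X therefore takes `Int`, and Y, all of whose letters come
      -- later, takes `Sub`.
      X̃ Ỹ : 𝓦
      X̃ = Cx.Int N X
      Ỹ = Cx.Sub N Y

      Int-G : Cx.Int N G ≋ X̃ ⊛ Ỹ
      Int-G = Int-⊛-guarded r X Y K.refl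

      X̃-eq : X̃ ≋ Cx.Int (Ỹ ⊛ N) F
      X̃-eq = 𝓦.trans (Cx.Int-cong r X-eq) (Int-∘ r Y F)

      SubX-[] : Cx.Sub N X [] K.≈ K.0#
      SubX-[] = K.trans (Sub-guarded r X K.refl []) (K.zeroʳ _)

      Sub-∘-eval : ∀ e → Cx.Sub N (Cy.Sub X e) ≋ Cy.Sub (Cx.Sub N X) e
      Sub-∘-eval = Cy.Sub-unique (Cy.eval-raises SubX-[]) {λ e → Cx.Sub N (Cy.Sub X e)} λ e → begin
        Cx.Sub N (Cy.Sub X e)
          ≈⟨ Cx.Sub-cong r (Cy.Sub-eq X-raises e) ⟩
        Cx.Sub N (const (e []) ⊕ X ⊛ Cy.Int X e)
          ≈⟨ Cx.Sub-⊕ r (const (e [])) (X ⊛ Cy.Int X e) ⟩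
        Cx.Sub N (const (e [])) ⊕ Cx.Sub N (X ⊛ Cy.Int X e)
          ≈⟨ 𝓦.+-cong (Sub-const r (e [])) (Cx.Sub-⊛ r X (Cy.Int X e)) ⟩
        const (e []) ⊕ Cx.Sub N X ⊛ Cx.Sub N (Cy.Int X e) ∎

      Ỹ-eq : Ỹ ≋ Cy.Int (N ⊛ X̃) d
      Ỹ-eq = 𝓦.trans (Sub-∘-eval (ST.∂ tt d))
        (Cy.Sub-congˡ (Cy.eval-raises SubX-[]) (Sub-guarded r X K.refl) (ST.∂ tt d))

-- Freeness: resolvents and alternating products.

module Freeness where

  open import Defs using (module FreeProbability)
  open FormalSeries
  open Substitutions
  open CumulantSeries
  open import Algebra.Module.Structures using (IsLeftModule)
  open import Algebra.Module.Morphism.Structures using (module LeftModuleMorphisms)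
  open import Data.Bool.Base using (Bool; true; false; if_then_else_; not)
  open import Data.Fin.Base using (zero; suc; inject₁)
  open import Data.List.Base using (List; []; _∷_; length)
  open import Data.Vec.Base using (Vec; []; _∷_; lookup)
  open import Relation.Binary.PropositionalEquality as ≡ using (_≡_; _≢_)
  open import Relation.Unary using (Pred; _∈_)

  -- With x = a + X and y = b + Y, the resolvents u = a (1 - Y x)⁻¹ and
  -- v = b (1 - X y)⁻¹ expand E = (1 - x y)⁻¹ into alternating products.
  module Factorisation {c ℓ} (R : Ring c ℓ) where

    open Ring R
    open import Algebra.Properties.Group +-group using () renaming (∙-cancelʳ to +-cancelʳ)
    open import Algebra.Properties.CommutativeSemigroup +-commutativeSemigroup using (x∙yz≈y∙xz)
    open SetoidReasoning setoid

    absorb : ∀ {a q f} → q ≈ 1# + q * f → a * q ≈ a + a * q * f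
    absorb {a} {q} {f} p = begin
      a * q                ≈⟨ *-congˡ p ⟩
      a * (1# + q * f)     ≈⟨ distribˡ a 1# (q * f) ⟩
      a * 1# + a * (q * f) ≈⟨ +-cong (*-identityʳ a) (sym (*-assoc a q f)) ⟩
      a + a * q * f        ∎

    module _ {x y X Y a b E p q} (x≈ : x ≈ a + X) (y≈ : y ≈ b + Y) (E≈ : E ≈ 1# + x * (y * E))
             (p≈ : p ≈ 1# + p * (Y * x)) (q≈ : q ≈ 1# + q * (X * y)) where

      private
        u v r S : Carrier
        u = a * p
        v = b * q
        r = b * E
        S = u * (Y + r)

        yE : y * E ≈ r + Y * E
        yE = trans (*-congʳ y≈) (distribʳ E b Y)

        xyE : x * (y * E) ≈ a * (y * E) + X * (y * E)
        xyE = trans (*-congʳ x≈) (distribʳ (y * E) a X)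

      -- By `absorb`, u (1 - Y x) = a, so u y E can be expanded in two ways that share the term u Y
      -- x y E. Cancelling it replaces an inversion of 1 - Y x.
      ayE≈ : a * (y * E) ≈ S
      ayE≈ = +-cancelʳ (u * (Y * (x * (y * E)))) _ _ (begin
        a * (y * E) + u * (Y * (x * (y * E)))
          ≈⟨ +-congˡ (trans (*-congˡ (sym (*-assoc Y x (y * E)))) (sym (*-assoc u (Y * x) (y * E)))) ⟩
        a * (y * E) + u * (Y * x) * (y * E)
          ≈⟨ distribʳ (y * E) a (u * (Y * x)) ⟨
        (a + u * (Y * x)) * (y * E)
          ≈⟨ *-congʳ (absorb p≈) ⟨
        u * (y * E)
          ≈⟨ *-congˡ (begin
            y * E                                ≈⟨ yE ⟩
            r + Y * E                            ≈⟨ +-congˡ (*-congˡ E≈) ⟩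
            r + Y * (1# + x * (y * E))           ≈⟨ +-congˡ (trans (distribˡ Y 1# (x * (y * E))) (+-congʳ (*-identityʳ Y))) ⟩
            r + (Y + Y * (x * (y * E)))          ≈⟨ trans (x∙yz≈y∙xz r Y _) (sym (+-assoc Y r _)) ⟩
            Y + r + Y * (x * (y * E))            ∎) ⟩
        u * (Y + r + Y * (x * (y * E)))
          ≈⟨ distribˡ u (Y + r) _ ⟩
        S + u * (Y * (x * (y * E))) ∎)

      -- The same cancellation with X y. The right-hand side v + v u (Y + r) contains r only behind
      -- v u, so iterating it produces products that alternate between v and u.
      remainder : r ≈ v + v * S
      remainder = +-cancelʳ (v * (X * (y * E))) _ _ (begin
        r + v * (X * (y * E))
          ≈⟨ +-congˡ (trans (*-congˡ (sym (*-assoc X y E))) (sym (*-assoc v (X * y) E))) ⟩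
        b * E + v * (X * y) * E
          ≈⟨ distribʳ E b (v * (X * y)) ⟨
        (b + v * (X * y)) * E
          ≈⟨ *-congʳ (absorb q≈) ⟨
        v * E
          ≈⟨ *-congˡ (trans E≈ (+-congˡ (trans xyE (+-congʳ ayE≈)))) ⟩
        v * (1# + (S + X * (y * E)))
          ≈⟨ trans (distribˡ v 1# _) (+-cong (*-identityʳ v) (distribˡ v S _)) ⟩
        v + (v * S + v * (X * (y * E)))
          ≈⟨ +-assoc v (v * S) _ ⟨
        v + v * S + v * (X * (y * E)) ∎)

      expansion : E ≈ 1# + (S + (X * r + X * Y * E))
      expansion = begin
        E                                       ≈⟨ E≈ ⟩
        1# + x * (y * E)                        ≈⟨ +-congˡ (trans xyE (+-cong ayE≈ (*-congˡ yE))) ⟩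
        1# + (S + X * (r + Y * E))              ≈⟨ +-congˡ (+-congˡ (trans (distribˡ X r (Y * E)) (+-congˡ (sym (*-assoc X Y E))))) ⟩
        1# + (S + (X * r + X * Y * E))          ∎

  module FreeSeries {c ℓ₀ a ℓ} (K : CommutativeRing c ℓ₀)
    (𝒜 : FreeProbability.NCProbabilitySpace K a ℓ) where

    private module K = CommutativeRing K
    open FreeProbability.Space K 𝒜 hiding (zero)
    module ML = IsLeftModule isLeftModule
    open LeftModuleMorphisms.IsLeftModuleHomomorphism φ-linear
      public using () renaming (⟦⟧-cong to φ-cong; +ᴹ-homo to φ-+; *ₗ-homo to φ-·; 0ᴹ-homo to φ-0)

    module _ {l} (L : Set l) where

      private
        module SK = Series K.ring L
        module SA = Series ring L

      ι : SK.𝓦 → SA.𝓦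
      ι f w = f w · 1#

      φ̂ : SA.𝓦 → SK.𝓦
      φ̂ f w = φ (f w)

      -- Scalar coefficients are central, so they leave φ even from behind a prefix z.
      ι-⊛ : ∀ z f g → (λ w → φ (z * (ι f SA.⊛ g) w)) SK.≋ f SK.⊛ (λ w → φ (z * g w))
      ι-⊛ z f g []      = K.trans (φ-cong (pull (f []) z (g []))) (φ-· (f []) (z * g []))
        where
        pull : ∀ k z x → z * ((k · 1#) * x) ≈ k · (z * x)
        pull k z x = trans (*-congˡ (trans (·-*-assocˡ k 1# x) (ML.*ₗ-congˡ (*-identityˡ x)))) (·-*-assocʳ k z x)
      ι-⊛ z f g (x ∷ w) = K.trans (φ-cong (distribˡ z _ _)) (K.trans (φ-+ _ _)
        -- The first summand is the case of the empty word for two constant functions.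
        (K.+-cong (ι-⊛ z (λ _ → f []) (λ _ → g (x ∷ w)) []) (ι-⊛ z (SK.∂ x f) g w)))

      φ̂-ι : ∀ f g → φ̂ (ι f SA.⊛ g) SK.≋ f SK.⊛ φ̂ g
      φ̂-ι f g w = K.trans (φ-cong (sym (*-identityˡ _)))
        (K.trans (ι-⊛ 1# f g w) (SK.⊛-cong {f} SK.𝓦.refl (λ v → φ-cong (*-identityˡ _)) w))

      φ̂-⊕ : ∀ f g → φ̂ (f SA.⊕ g) SK.≋ φ̂ f SK.⊕ φ̂ g
      φ̂-⊕ f g w = φ-+ (f w) (g w)

      φ̂-1 : φ̂ (SA.const 1#) SK.≋ SK.const K.1#
      φ̂-1 []      = φ-1
      φ̂-1 (_ ∷ _) = φ-0

    module Resolvent {b l} (B : Set b) (L : Set l) (val : B → Carrier)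
      (t : CommutativeRing.Carrier K) (F : Substitution.𝓦 K B B)
      {J : (B → Substitution.𝓦 K B L) → Substitution.𝓦 K B L} (isLetter : Substitution.IsLetter K B L J) where

      private
        module SB = Series K.ring B
        module SA = Series ring L
        module C = Cumulants K t B F
      open Substitution K B L
      open IsLetter isLetter
      open Sub isLetter

      prod : List B → Carrier
      prod []      = 1#
      prod (b ∷ w) = val b * prod w

      moments : Carrier → SB.𝓦
      moments z w = φ (z * prod w)

      module _ (ẑ : SA.𝓦)
        (generic : ∀ z f → (λ w → φ (z * (ẑ SA.⊛ f) w)) ≋ J (λ b w → φ (z * val b * f w)))
        {U : 𝓦} (rU : Raises U) {q : SA.𝓦} (q-eq : q SA.≋ SA.const 1# SA.⊕ ι L U SA.⊛ ẑ SA.⊛ q) where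

        -- Unfolding q once moves one letter into the prefix, so the states are the prefixes z with
        -- transitions z ↦ z * val b; likewise the derivative of `moments z` at b is
        -- `moments (z * val b)`.
        φ-resolvent : ∀ z → (λ w → φ (z * q w)) ≋ Sub U (moments z)
        φ-resolvent = coalgebra-unique rU (λ z → const (φ z)) (λ b z → z * val b)
          {λ z w → φ (z * q w)} {λ z → Sub U (moments z)}
          (λ z w → K.trans (φ-cong (trans (*-congˡ (q-eq w)) (distribˡ z _ _))) (K.trans (φ-+ _ _)
            (K.+-cong (unit z w) (K.trans (φ-cong (*-congˡ (SA.⊛-assoc (ι L U) ẑ q w)))
              (K.trans (ι-⊛ L z U (ẑ SA.⊛ q) w) (⊛-cong {U} 𝓦.refl (generic z q) w))))))
          (λ z → 𝓦.trans (Sub-eq rU (moments z)) (𝓦.+-cong {x = const (φ (z * 1#))} (const-cong (φ-cong (*-identityʳ z)))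
            (⊛-cong {U} 𝓦.refl (J-cong λ b → Sub-cong rU λ w → φ-cong (sym (*-assoc z (val b) (prod w)))))))
          where
          unit : ∀ z w → φ (z * SA.const 1# w) K.≈ const (φ z) w
          unit z []      = φ-cong (*-identityʳ z)
          unit z (_ ∷ _) = K.trans (φ-cong (zeroʳ z)) φ-0

        φ-letter-resolvent : φ̂ L (ẑ SA.⊛ q) ≋ Int U (moments 1#)
        φ-letter-resolvent w = K.trans (φ-cong (sym (*-identityˡ _))) (K.trans (generic 1# q w)
          (J-cong (λ b v → K.trans (φ-resolvent (1# * val b) v)
            (Sub-cong rU (λ u → φ-cong (*-assoc 1# (val b) (prod u))) v)) w))

        -- Both φ̂ q and φ̂ (ẑ q) are known from the moments, and `Int-moment` says that the second
        -- is Z times the first.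
        centred : ∀ {W} → Raises W → W ≋ U ⊕ t • (U ⊛ (Int W F ⊛ W)) → moments 1# SB.≋ C.M →
          φ̂ L ((ẑ SA.⊕ ι L (λ w → K.- Int W F w)) SA.⊛ q) ≋ 0≋
        centred {W} rW W-eq moments≋M = begin
          φ̂ L ((ẑ SA.⊕ ι L (λ w → K.- Z w)) SA.⊛ q)
            ≈⟨ (λ w → φ-cong (SA.⊛-distribʳ q ẑ (ι L (λ w → K.- Z w)) w)) ⟩
          φ̂ L (ẑ SA.⊛ q SA.⊕ ι L (λ w → K.- Z w) SA.⊛ q)
            ≈⟨ φ̂-⊕ L (ẑ SA.⊛ q) (ι L (λ w → K.- Z w) SA.⊛ q) ⟩
          φ̂ L (ẑ SA.⊛ q) ⊕ φ̂ L (ι L (λ w → K.- Z w) SA.⊛ q)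
            ≈⟨ 𝓦.+-cong φ-letter-resolvent (φ̂-ι L (λ w → K.- Z w) q) ⟩
          Int U (moments 1#) ⊕ 𝓦.- Z ⊛ φ̂ L q
            ≈⟨ 𝓦.+-cong (𝓦.trans (Int-cong rU moments≋M) (Subordination.Int-moment K t B L isLetter F rU rW W-eq))
                 (⊛-cong {𝓦.- Z} 𝓦.refl φ̂q) ⟩
          Z ⊛ (const K.1# ⊕ U ⊛ Int U C.M) ⊕ 𝓦.- Z ⊛ (const K.1# ⊕ U ⊛ Int U C.M)
            ≈⟨ ⊛-distribʳ (const K.1# ⊕ U ⊛ Int U C.M) Z (𝓦.- Z) ⟨
          (Z ⊕ 𝓦.- Z) ⊛ (const K.1# ⊕ U ⊛ Int U C.M)
            ≈⟨ ⊛-cong {g = const K.1# ⊕ U ⊛ Int U C.M} (𝓦.-‿inverseʳ Z) 𝓦.refl ⟩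
          0≋ ⊛ (const K.1# ⊕ U ⊛ Int U C.M)
            ≈⟨ ⊛-zeroˡ _ ⟩
          0≋ ∎
          where
          open SetoidReasoning 𝓦.setoid
          Z : 𝓦
          Z = Int W F
          φ̂q : φ̂ L q ≋ const K.1# ⊕ U ⊛ Int U C.M
          φ̂q = begin
            φ̂ L q
              ≈⟨ (λ w → φ-cong (trans (q-eq w) (+-congˡ (SA.⊛-assoc (ι L U) ẑ q w)))) ⟩
            φ̂ L (SA.const 1# SA.⊕ ι L U SA.⊛ (ẑ SA.⊛ q))
              ≈⟨ φ̂-⊕ L (SA.const 1#) (ι L U SA.⊛ (ẑ SA.⊛ q)) ⟩
            φ̂ L (SA.const 1#) ⊕ φ̂ L (ι L U SA.⊛ (ẑ SA.⊛ q))
              ≈⟨ 𝓦.+-cong (φ̂-1 L) (φ̂-ι L U (ẑ SA.⊛ q)) ⟩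
            const K.1# ⊕ U ⊛ φ̂ L (ẑ SA.⊛ q)
              ≈⟨ 𝓦.+-cong {const K.1#} 𝓦.refl (⊛-cong {U} 𝓦.refl (𝓦.trans φ-letter-resolvent (Int-cong rU moments≋M))) ⟩
            const K.1# ⊕ U ⊛ Int U C.M ∎

    module Alternating {p} (ℳ 𝒩 : Pred Carrier p) (free : FreelyIndependent ℳ 𝒩) where

      Side : Bool → Pred Carrier p
      Side s = if s then ℳ else 𝒩

      Centred : Bool → Carrier → Set (ℓ₀ ⊔ p)
      Centred s z = z ∈ Side s × φ z K.≈ K.0#

      data Alt : Bool → ∀ {k} → Vec Carrier (suc k) → Set (a ⊔ ℓ₀ ⊔ p) where
        [_]  : ∀ {s z} → Centred s z → Alt s (z ∷ [])
        _∷_  : ∀ {s z k} {zs : Vec Carrier (suc k)} → Centred s z → Alt (not s) zs → Alt s (z ∷ zs)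

      -- The index is the side of the leftmost factor, which `extend` must alternate with. Closure
      -- under sums suffices: a scalar multiple is taken into a centred factor, as in `uY∈`.
      data Span (s : Bool) : Carrier → Set (a ⊔ ℓ ⊔ ℓ₀ ⊔ p) where
        alt  : ∀ {k} {zs : Vec Carrier (suc k)} → Alt s zs → Span s (product zs)
        null : Span s 0#
        _⊞_  : ∀ {x y} → Span s x → Span s y → Span s (x + y)
        resp : ∀ {x y} → x ≈ y → Span s x → Span s y

      private
        signs : ∀ {s k} {zs : Vec Carrier (suc k)} → Alt s zs → Vec Bool (suc k)
        signs {s} [ _ ]   = s ∷ []
        signs {s} (_ ∷ q) = s ∷ signs q

        not-≢ : ∀ s → s ≢ not s
        not-≢ true  ()
        not-≢ false ()

        signs-head : ∀ {s k} {zs : Vec Carrier (suc k)} (q : Alt s zs) → lookup (signs q) zero ≡ s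
        signs-head [ _ ]   = ≡.refl
        signs-head (_ ∷ _) = ≡.refl

        signs-alternate : ∀ {s k} {zs : Vec Carrier (suc k)} (q : Alt s zs) i →
          lookup (signs q) (inject₁ i) ≢ lookup (signs q) (suc i)
        signs-alternate {s} (_ ∷ q) zero    e = not-≢ s (≡.trans e (signs-head q))
        signs-alternate     (_ ∷ q) (suc i) e = signs-alternate q i e

        sides : ∀ {s k} {zs : Vec Carrier (suc k)} (q : Alt s zs) i → lookup zs i ∈ Side (lookup (signs q) i)
        sides [ z ]   zero    = proj₁ z
        sides (z ∷ q) zero    = proj₁ z
        sides (z ∷ q) (suc i) = sides q i

        centres : ∀ {s k} {zs : Vec Carrier (suc k)} (q : Alt s zs) i → φ (lookup zs i) K.≈ K.0#
        centres [ z ]   zero    = proj₂ z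
        centres (z ∷ q) zero    = proj₂ z
        centres (z ∷ q) (suc i) = centres q i

      φ-span : ∀ {s z} → Span s z → φ z K.≈ K.0#
      φ-span (alt {k} {zs} q) = free k (signs q) zs (signs-alternate q) (sides q) (centres q)
      φ-span null             = φ-0
      φ-span (p ⊞ q)          = K.trans (φ-+ _ _) (K.trans (K.+-cong (φ-span p) (φ-span q)) (K.+-identityˡ _))
      φ-span (resp e p)       = K.trans (φ-cong (sym e)) (φ-span p)

      single : ∀ {s z} → Centred s z → Span s z
      single c = resp (*-identityʳ _) (alt [ c ])

      extend : ∀ {s z y} → Centred s z → Span (not s) y → Span s (z * y)
      extend c (alt q)    = alt (c ∷ q)
      extend c null       = resp (sym (zeroʳ _)) null
      extend c (p ⊞ q)    = resp (sym (distribˡ _ _ _)) (extend c p ⊞ extend c q)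
      extend c (resp e p) = resp (*-congˡ e) (extend c p)

    module _ {l} (L : Set l) where

      private module SA = Series ring L

      module _ {p q r} {P : Pred Carrier p} {Q : Pred Carrier q} {S : Pred Carrier r}
        (S-+ : ∀ {x y} → S x → S y → S (x + y)) (S-* : ∀ {x y} → P x → Q y → S (x * y)) where

        -- A coefficient of a product involves only words no longer than w, and `⊛-closed-guarded`
        -- reads its right factor on strictly shorter ones. The bounds allow both inside inductions
        -- on length.
        ⊛-closed : ∀ {f g} w → (∀ v → length v ℕ.≤ length w → P (f v)) →
                   (∀ v → length v ℕ.≤ length w → Q (g v)) → S ((f SA.⊛ g) w)
        ⊛-closed []      pf qg = S-* (pf [] z≤n) (qg [] z≤n)
        ⊛-closed (x ∷ w) pf qg = S-+ (S-* (pf [] z≤n) (qg (x ∷ w) ℕ.≤-refl))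
          (⊛-closed w (λ v v≤ → pf (x ∷ v) (s≤s v≤)) (λ v v≤ → qg v (ℕ.m≤n⇒m≤1+n v≤)))

        ⊛-closed-guarded : (∀ {x y} → x ≈ y → S x → S y) → S 0# → ∀ {f g} w → f [] ≈ 0# →
          (∀ v → P (f v)) → (∀ v → length v ℕ.< length w → Q (g v)) → S ((f SA.⊛ g) w)
        ⊛-closed-guarded S-resp S0 {f} {g} []      f0 pf qg = S-resp (sym (trans (*-congʳ f0) (zeroˡ _))) S0
        ⊛-closed-guarded S-resp S0 {f} {g} (x ∷ w) f0 pf qg = S-resp (sym (SA.∂-⊛ x f g f0 w))
          (⊛-closed w (λ v _ → pf (x ∷ v)) (λ v v≤ → qg v (s≤s v≤)))

    module _ {l p} (L : Set l) {S : Pred Carrier p} (isUnitalSubalgebra : IsUnitalSubalgebra S) where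

      open IsUnitalSubalgebra isUnitalSubalgebra
      private
        module SA = Series ring L
        module SK = Series K.ring L

      0-closed : 0# ∈ S
      0-closed = resp-≈ (ML.*ₗ-zeroˡ 1#) (·-closed K.0# 1-closed)

      ι-closed : ∀ f w → ι L f w ∈ S
      ι-closed f w = ·-closed (f w) 1-closed

      const-closed : ∀ {z} → z ∈ S → ∀ w → SA.const z w ∈ S
      const-closed z∈ []      = z∈
      const-closed z∈ (_ ∷ _) = 0-closed

      ⊛-∈ : ∀ {f g} → (∀ w → f w ∈ S) → (∀ w → g w ∈ S) → ∀ w → (f SA.⊛ g) w ∈ S
      ⊛-∈ f∈ g∈ w = ⊛-closed L {P = S} {S} {S} +-closed *-closed w (λ v _ → f∈ v) (λ v _ → g∈ v)

      star-∈ : ∀ {f} → f [] ≈ 0# → (∀ w → f w ∈ S) → ∀ w → SA.star f w ∈ S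
      star-∈ {f} f0 f∈ w = go (suc (length w)) w ℕ.≤-refl
        where
        go : ∀ n w → length w ℕ.< n → SA.star f w ∈ S
        go (suc n) w (s≤s w<) = resp-≈ (sym (SA.star-eq f0 w)) (+-closed (const-closed 1-closed w)
          (⊛-closed-guarded L {P = S} {S} {S} +-closed *-closed resp-≈ 0-closed w f0 f∈ (λ v v< → go n v (ℕ.<-≤-trans v< w<))))

    module Main {p} (ℳ 𝒩 : Pred Carrier p) (isℳ : IsUnitalSubalgebra ℳ) (is𝒩 : IsUnitalSubalgebra 𝒩)
      (free : FreelyIndependent ℳ 𝒩) {l} (L : Set l) (val : L → Carrier) (val∈ : ∀ x → val x ∈ ℳ)
      (y : Carrier) (y∈ : y ∈ 𝒩) where

      open Alternating ℳ 𝒩 free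
      private
        module SA = Series ring L
        module SK = Series K.ring L
        module M = IsUnitalSubalgebra isℳ
        module N = IsUnitalSubalgebra is𝒩

      -- x̂ is the sum of val x times the letter x and ŷ has no letter, so the coefficient of E at
      -- x₁ ⋯ xₙ is x₁ y ⋯ xₙ y.
      x̂ ŷ E : SA.𝓦
      x̂ = SA.shift (λ x → SA.const (val x))
      ŷ = SA.const y
      E = SA.star (x̂ SA.⊛ ŷ)

      x̂∈ : ∀ w → x̂ w ∈ ℳ
      x̂∈ []      = 0-closed L isℳ
      x̂∈ (x ∷ w) = const-closed L isℳ (val∈ x) w

      module _ (X Y : SK.𝓦) (X0 : X [] K.≈ K.0#) where

        private
          ιX0 : ι L X [] ≈ 0#
          ιX0 = trans (ML.*ₗ-congʳ X0) (ML.*ₗ-zeroˡ 1#)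

          Yx0 : (ι L Y SA.⊛ x̂) [] ≈ 0#
          Yx0 = zeroʳ _

          Xy0 : (ι L X SA.⊛ ŷ) [] ≈ 0#
          Xy0 = trans (*-congʳ ιX0) (zeroˡ y)

        neg : SK.𝓦 → SK.𝓦
        neg f w = K.- f w

        pˣ pʸ u v : SA.𝓦
        pˣ  = SA.star (ι L Y SA.⊛ x̂)
        pʸ = SA.star (ι L X SA.⊛ ŷ)
        u   = (x̂ SA.⊕ ι L (neg X)) SA.⊛ pˣ
        v   = (ŷ SA.⊕ ι L (neg Y)) SA.⊛ pʸ

        pˣ-eq : pˣ SA.≋ SA.const 1# SA.⊕ ι L Y SA.⊛ x̂ SA.⊛ pˣ
        pˣ-eq = SA.star-eq Yx0

        pʸ-eq : pʸ SA.≋ SA.const 1# SA.⊕ ι L X SA.⊛ ŷ SA.⊛ pʸ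
        pʸ-eq = SA.star-eq Xy0

        module _ (u-centred : φ̂ L u SK.≋ SK.0≋) (v-centred : φ̂ L v SK.≋ SK.0≋) where

          private
            split : ∀ z f → z SA.≋ z SA.⊕ ι L (neg f) SA.⊕ ι L f
            split z f w = sym (trans (+-assoc _ _ _) (trans (+-congˡ (trans (sym (ML.*ₗ-distribʳ 1# _ _))
              (trans (ML.*ₗ-congʳ (K.-‿inverseˡ (f w))) (ML.*ₗ-zeroˡ 1#)))) (+-identityʳ _)))

            E-eq : E SA.≋ SA.const 1# SA.⊕ x̂ SA.⊛ (ŷ SA.⊛ E)
            E-eq w = trans (SA.star-eq {x̂ SA.⊛ ŷ} (zeroˡ _) w) (+-congˡ (SA.⊛-assoc x̂ ŷ E w))

            module F = Factorisation SA.seriesRing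

            r S : SA.𝓦
            r = (ŷ SA.⊕ ι L (neg Y)) SA.⊛ E
            S = u SA.⊛ (ι L Y SA.⊕ r)

            r-eq : r SA.≋ v SA.⊕ v SA.⊛ S
            r-eq = F.remainder {x̂} {ŷ} {ι L X} {ι L Y} {x̂ SA.⊕ ι L (neg X)} {ŷ SA.⊕ ι L (neg Y)} {E} {pˣ} {pʸ}
              (split x̂ X) (split ŷ Y) E-eq (SA.star-eqʳ Yx0) (SA.star-eqʳ Xy0)

            E-expansion : E SA.≋ SA.const 1# SA.⊕ (S SA.⊕ (ι L X SA.⊛ r SA.⊕ ι L X SA.⊛ ι L Y SA.⊛ E))
            E-expansion = F.expansion {x̂} {ŷ} {ι L X} {ι L Y} {x̂ SA.⊕ ι L (neg X)} {ŷ SA.⊕ ι L (neg Y)} {E} {pˣ} {pʸ}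
              (split x̂ X) (split ŷ Y) E-eq (SA.star-eqʳ Yx0) (SA.star-eqʳ Xy0)

            u∈ : ∀ w → Centred true (u w)
            u∈ w = ⊛-∈ L isℳ (λ v → M.+-closed (x̂∈ v) (ι-closed L isℳ (neg X) v))
                     (star-∈ L isℳ Yx0 (⊛-∈ L isℳ (ι-closed L isℳ Y) x̂∈)) w , u-centred w

            v∈ : ∀ w → Centred false (v w)
            v∈ w = ⊛-∈ L is𝒩 (λ v → N.+-closed (const-closed L is𝒩 y∈ v) (ι-closed L is𝒩 (neg Y) v))
                     (star-∈ L is𝒩 Xy0 (⊛-∈ L is𝒩 (ι-closed L is𝒩 X) (const-closed L is𝒩 y∈))) w , v-centred w

            u0 : u [] ≈ 0#
            u0 = trans (*-congʳ (trans (+-identityˡ _) (trans (ML.*ₗ-congʳ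
              (K.trans (K.-‿cong X0) (K.trans (K.sym (K.+-identityˡ _)) (K.-‿inverseʳ K.0#)))) (ML.*ₗ-zeroˡ 1#)))) (zeroˡ _)

            uY∈ : ∀ w → Span true ((u SA.⊛ ι L Y) w)
            uY∈ w = ⊛-closed L {P = Centred true} {λ z → ∃ λ k → z ≈ k · 1#} {Span true} _⊞_ (λ {x} {z} cx (k , z≈) →
                resp (trans (sym (trans (·-*-assocʳ k x 1#) (ML.*ₗ-congˡ (*-identityʳ x)))) (*-congˡ (sym z≈)))
                  (single (M.·-closed k (proj₁ cx) , K.trans (φ-· k x) (K.trans (K.*-congˡ (proj₂ cx)) (K.zeroʳ k)))))
              {u} {ι L Y} w (λ v _ → u∈ v) (λ v _ → Y v , refl)

            S∈ : ∀ w → (∀ v → length v ℕ.< length w → Span false (r v)) → Span true (S w)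
            S∈ w r∈ = resp (sym (SA.⊛-distribˡ u (ι L Y) r w))
              (uY∈ w ⊞ ⊛-closed-guarded L {P = Centred true} {Span false} {Span true} _⊞_ extend resp null w u0 u∈ r∈)

            -- In r = v + v u (Y + r) the series u has no constant term, so the inner r is needed on
            -- shorter words only: each coefficient of r is a finite sum of alternating products.
            r∈ : ∀ n w → length w ℕ.< n → Span false (r w)
            r∈ (suc n) w (s≤s w<) = resp (sym (r-eq w)) (single (v∈ w) ⊞ ⊛-closed L {P = Centred false} {Span true} {Span false} _⊞_ extend w (λ v _ → v∈ v)
              (λ v v≤ → S∈ v (λ z z< → r∈ n z (ℕ.<-≤-trans z< (ℕ.≤-trans v≤ w<)))))

            φr : φ̂ L r SK.≋ SK.0≋
            φr w = φ-span (r∈ (suc (length w)) w ℕ.≤-refl)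

            φS : φ̂ L S SK.≋ SK.0≋
            φS w = φ-span (S∈ w (λ v _ → r∈ (suc (length v)) v ℕ.≤-refl))

          φE : φ̂ L E SK.≋ SK.const K.1# SK.⊕ X SK.⊛ Y SK.⊛ φ̂ L E
          φE = begin
            φ̂ L E
              ≈⟨ (λ w → φ-cong (E-expansion w)) ⟩
            φ̂ L (SA.const 1# SA.⊕ (S SA.⊕ (ι L X SA.⊛ r SA.⊕ ι L X SA.⊛ ι L Y SA.⊛ E)))
              ≈⟨ (λ w → K.trans (φ-+ _ _) (K.+-congˡ (K.trans (φ-+ _ _) (K.+-congˡ (φ-+ _ _))))) ⟩
            φ̂ L (SA.const 1#) SK.⊕ (φ̂ L S SK.⊕ (φ̂ L (ι L X SA.⊛ r) SK.⊕ φ̂ L (ι L X SA.⊛ ι L Y SA.⊛ E)))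
              ≈⟨ SK.𝓦.+-cong (φ̂-1 L) (SK.𝓦.+-cong φS (SK.𝓦.+-cong
                   (SK.𝓦.trans (φ̂-ι L X r) (SK.𝓦.trans (SK.⊛-cong {X} SK.𝓦.refl φr) (SK.𝓦.zeroʳ X)))
                   (SK.𝓦.trans (λ w → φ-cong (SA.⊛-assoc (ι L X) (ι L Y) E w)) (SK.𝓦.trans (φ̂-ι L X (ι L Y SA.⊛ E))
                     (SK.𝓦.trans (SK.⊛-cong {X} SK.𝓦.refl (φ̂-ι L Y E)) (SK.𝓦.sym (SK.⊛-assoc X Y (φ̂ L E)))))))) ⟩
            SK.const K.1# SK.⊕ (SK.0≋ SK.⊕ (SK.0≋ SK.⊕ X SK.⊛ Y SK.⊛ φ̂ L E))
              ≈⟨ (λ w → K.+-congˡ (K.trans (K.+-identityˡ _) (K.+-identityˡ _))) ⟩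
            SK.const K.1# SK.⊕ X SK.⊛ Y SK.⊛ φ̂ L E ∎
            where open SetoidReasoning SK.𝓦.setoid

-- Boolean cumulants of the products, and recovery of the t-Boolean ones.

module FreeProducts where

  open import Defs using (module FreeProbability)
  open FormalSeries
  open Substitutions
  open CumulantSeries
  open Freeness
  open import Data.List.Base using (List; []; _∷_)
  open import Relation.Unary using (Pred; _∈_)

  module CumulantsInjective {c ℓ l} (K : CommutativeRing c ℓ) (t : CommutativeRing.Carrier K) (L : Set l)
    (F G : Substitution.𝓦 K L L) where

    private
      module K = CommutativeRing K
      module CF = Cumulants K t L F
      module CG = Cumulants K t L G
    open Substitution K L L
    open ShiftLetter K L
    open SetoidReasoning 𝓦.setoid
    open import Algebra.Properties.Group K.+-group using () renaming (∙-cancelˡ to +-cancelˡ; ∙-cancelʳ to +-cancelʳ)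

    -- N f = f + t b (N f) expresses f through N f.
    N-cancelˡ : ∀ {f g} → CG.N ⊛ f ≋ CG.N ⊛ g → f ≋ g
    N-cancelˡ {f} {g} p w = +-cancelʳ (t K.* (CG.b ⊛ (CG.N ⊛ f)) w) (f w) (g w)
      (K.trans (K.sym (unfold f w)) (K.trans (p w) (K.trans (unfold g w)
        (K.+-congˡ (K.*-congˡ (⊛-cong {CG.b} 𝓦.refl (𝓦.sym p) w))))))
      where
      unfold : ∀ f → CG.N ⊛ f ≋ f ⊕ t • (CG.b ⊛ (CG.N ⊛ f))
      unfold f = begin
        CG.N ⊛ f                                            ≈⟨ ⊛-cong {g = f} CG.N-eq 𝓦.refl ⟩
        (const K.1# ⊕ t • (CG.b ⊛ CG.N)) ⊛ f                ≈⟨ ⊛-distribʳ f (const K.1#) (t • (CG.b ⊛ CG.N)) ⟩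
        const K.1# ⊛ f ⊕ (t • (CG.b ⊛ CG.N)) ⊛ f
          ≈⟨ 𝓦.+-cong (⊛-identityˡ f) (𝓦.trans (•-⊛ t (CG.b ⊛ CG.N) f) (•-cong K.refl (⊛-assoc CG.b CG.N f))) ⟩
        f ⊕ t • (CG.b ⊛ (CG.N ⊛ f)) ∎

    -- The constant term is read off at the empty word; after cancelling it and N, the equality of
    -- the `Int` series at x ∷ v is the hypothesis for the derivatives at x.
    Sub-injective : ∀ w {f g} → Sub CG.N f ≋ Sub CG.N g → f w K.≈ g w
    Sub-injective [] {f} {g} p = K.trans (K.sym (head f)) (K.trans (p []) (head g))
      where
      head : ∀ f → Sub CG.N f [] K.≈ f []
      head f = K.trans (Sub-eq (shift-raises CG.N) f []) (K.trans (K.+-congˡ (K.zeroʳ _)) (K.+-identityʳ _))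
    Sub-injective (x ∷ w) {f} {g} p = Sub-injective w {∂ x f} {∂ x g} (λ v → Int-eq (x ∷ v))
      where
      r = shift-raises CG.N
      Int-eq : Int CG.N f ≋ Int CG.N g
      Int-eq = N-cancelˡ λ v → +-cancelˡ (const (f []) v) _ _ (K.trans (K.sym (Sub-eq r f v)) (K.trans (p v)
        (K.trans (Sub-eq r g v) (K.+-congʳ (const-cong (K.sym (Sub-injective [] {f} {g} p)) v)))))

    module _ (M-star : CF.M ≋ const K.1# ⊕ CG.b ⊛ CF.M) where

      private
        b≋b : CF.b ≋ CG.b
        b≋b = ⊛-cancelʳ {CF.M} CF.M-[]
          (λ w → +-cancelˡ (const K.1# w) _ _ (K.trans (K.sym (CF.M-eq w)) (M-star w)))

        N≋N : CF.N ≋ CG.N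
        N≋N = star-unique {t • CG.b} (K.zeroʳ t)
          (𝓦.trans CF.N-eq (𝓦.+-cong {const K.1#} 𝓦.refl (𝓦.trans (•-cong K.refl (⊛-cong {g = CF.N} b≋b 𝓦.refl))
            (𝓦.sym (•-⊛ t CG.b CF.N)))))
          (𝓦.trans CG.N-eq (𝓦.+-cong {const K.1#} 𝓦.refl (𝓦.sym (•-⊛ t CG.b CG.N))))

        Int≋ : Int CG.N F ≋ Int CG.N G
        Int≋ = 𝓦.trans (𝓦.sym (Int-congˡ (shift-raises CF.N) N≋N F)) b≋b

      -- Cancelling M between `M-star` and `CF.M-eq` identifies the two b, then the two N as (1 - t
      -- b)⁻¹, and `Sub-injective` finally F and G. `Int` does not see constant terms, hence the
      -- restriction to x ∷ w.
      cumulants-injective : ∀ x w → F (x ∷ w) K.≈ G (x ∷ w)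
      cumulants-injective x w = Sub-injective w {∂ x F} {∂ x G} (λ v → Int≋ (x ∷ v))

  module FreeProduct {c ℓ₀ a ℓ} (K : CommutativeRing c ℓ₀) (t : CommutativeRing.Carrier K)
    (𝒜 : FreeProbability.NCProbabilitySpace K a ℓ) where

    private module K = CommutativeRing K
    open FreeProbability.Space K 𝒜 hiding (zero)
    open FreeSeries K 𝒜

    module _ {p} (ℳ 𝒩 : Pred Carrier p) (isℳ : IsUnitalSubalgebra ℳ) (is𝒩 : IsUnitalSubalgebra 𝒩)
      (free : FreelyIndependent ℳ 𝒩) {l} (L : Set l) (val : L → Carrier) (val∈ : ∀ x → val x ∈ ℳ)
      (y : Carrier) (y∈ : y ∈ 𝒩)
      (Fˣ : Substitution.𝓦 K L L) (Fʸ : Substitution.𝓦 K ⊤ ⊤) where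

      private
        module SA = Series ring L
        module ST = Series K.ring ⊤
        module Cx = ShiftLetter K L
        module Cy = EvalLetter K L
        module Rx = Resolvent L L val t Fˣ Cx.shift-isLetter
        module Ry = Resolvent ⊤ L (λ _ → y) t Fʸ Cy.eval-isLetter
        module P = Main ℳ 𝒩 isℳ is𝒩 free L val val∈ y y∈
        module MX = Cumulants K t L Fˣ
        module MY = Cumulants K t ⊤ Fʸ
      open Substitution K L L
      open Boxed K L Fˣ Fʸ
      private module CG = Cumulants K t L G
      open SetoidReasoning 𝓦.setoid

      module _ (momentsˣ : Rx.moments 1# ≋ MX.M) (momentsʸ : Ry.moments 1# ST.≋ MY.M) where

        private
          N X₁ Y₁ Wx Wy : 𝓦
          N  = CG.N
          X₁ = X̃ N
          Y₁ = Ỹ N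
          Wx = Y₁ ⊛ N
          Wy = N ⊛ X₁

          -- Equal to X₁ and Y₁ by `X̃-eq` and `Ỹ-eq`, but literally of the form `Int W F` that
          -- occurs in `centred`.
          Zx Zy : 𝓦
          Zx = Cx.Int Wx Fˣ
          Zy = Cy.Int Wy Fʸ

          N-eq : N ≋ const K.1# ⊕ t • (Zx ⊛ Zy ⊛ N)
          N-eq = 𝓦.trans CG.N-eq (𝓦.+-cong {const K.1#} 𝓦.refl (•-cong K.refl
            (⊛-cong {g = N} (𝓦.trans (Int-G N) (⊛-cong (X̃-eq N) (Ỹ-eq N))) 𝓦.refl)))

          -- Multiplying N = 1 + t Zx Zy N by Zy on the left and regrouping gives the subordination
          -- equation with U = Zy; `Wy-eq` multiplies by Zx on the right.
          Wx-eq : Wx ≋ Zy ⊕ t • (Zy ⊛ (Zx ⊛ Wx))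
          Wx-eq = begin
            Y₁ ⊛ N
              ≈⟨ ⊛-cong (Ỹ-eq N) N-eq ⟩
            Zy ⊛ (const K.1# ⊕ t • (Zx ⊛ Zy ⊛ N))
              ≈⟨ ⊛-distribˡ Zy (const K.1#) (t • (Zx ⊛ Zy ⊛ N)) ⟩
            Zy ⊛ const K.1# ⊕ Zy ⊛ (t • (Zx ⊛ Zy ⊛ N))
              ≈⟨ 𝓦.+-cong (⊛-identityʳ Zy) (𝓦.trans (⊛-• t Zy (Zx ⊛ Zy ⊛ N)) (•-cong K.refl (⊛-cong {Zy} 𝓦.refl
                   (𝓦.trans (⊛-assoc Zx Zy N) (⊛-cong {Zx} 𝓦.refl (⊛-cong {g = N} (𝓦.sym (Ỹ-eq N)) 𝓦.refl)))))) ⟩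
            Zy ⊕ t • (Zy ⊛ (Zx ⊛ Wx)) ∎

          Wy-eq : Wy ≋ Zx ⊕ t • (Zx ⊛ (Zy ⊛ Wy))
          Wy-eq = begin
            N ⊛ X₁
              ≈⟨ ⊛-cong {g = X₁} N-eq 𝓦.refl ⟩
            (const K.1# ⊕ t • (Zx ⊛ Zy ⊛ N)) ⊛ X₁
              ≈⟨ ⊛-distribʳ X₁ (const K.1#) (t • (Zx ⊛ Zy ⊛ N)) ⟩
            const K.1# ⊛ X₁ ⊕ (t • (Zx ⊛ Zy ⊛ N)) ⊛ X₁
              ≈⟨ 𝓦.+-cong (𝓦.trans (⊛-identityˡ X₁) (X̃-eq N)) (𝓦.trans (•-⊛ t (Zx ⊛ Zy ⊛ N) X₁) (•-cong K.refl
                   (𝓦.trans (⊛-assoc (Zx ⊛ Zy) N X₁) (⊛-assoc Zx Zy Wy)))) ⟩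
            Zx ⊕ t • (Zx ⊛ (Zy ⊛ Wy)) ∎

          generic-x : ∀ z f → (λ w → φ (z * (P.x̂ SA.⊛ f) w)) ≋ shift (λ x w → φ (z * val x * f w))
          generic-x z f []      = K.trans (φ-cong (trans (*-congˡ (zeroˡ _)) (zeroʳ z))) φ-0
          generic-x z f (x ∷ w) = φ-cong (trans (*-congˡ (trans (SA.shift-⊛ (λ x → SA.const (val x)) f (x ∷ w))
            (SA.const-⊛ (val x) f w))) (sym (*-assoc z (val x) (f w))))

          generic-y : ∀ z f → (λ w → φ (z * (P.ŷ SA.⊛ f) w)) ≋ (λ w → φ (z * y * f w))
          generic-y z f w = φ-cong (trans (*-congˡ (SA.const-⊛ y f w)) (sym (*-assoc z y (f w))))

          Wy-raises : Cy.Raises Wy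
          Wy-raises = Cy.eval-raises (K.zeroʳ _)

        φE : φ̂ L P.E ≋ const K.1# ⊕ CG.b ⊛ φ̂ L P.E
        φE = begin
          φ̂ L P.E
            ≈⟨ P.φE Zx Zy K.refl
                 (Rx.centred P.x̂ generic-x (Cx.shift-raises Zy) (P.pˣ-eq Zx Zy K.refl) (Cx.shift-raises Wx) Wx-eq momentsˣ)
                 (Ry.centred P.ŷ generic-y (Cy.eval-raises K.refl) (P.pʸ-eq Zx Zy K.refl) Wy-raises Wy-eq momentsʸ) ⟩
          const K.1# ⊕ Zx ⊛ Zy ⊛ φ̂ L P.E
            ≈⟨ 𝓦.+-cong {const K.1#} 𝓦.refl (⊛-cong {g = φ̂ L P.E}
                 (𝓦.sym (𝓦.trans (Int-G N) (⊛-cong (X̃-eq N) (Ỹ-eq N)))) 𝓦.refl) ⟩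
          const K.1# ⊕ CG.b ⊛ φ̂ L P.E ∎

        prod-xy : List L → Carrier
        prod-xy []      = 1#
        prod-xy (x ∷ w) = val x * y * prod-xy w

        E-prod : ∀ w → P.E w ≈ prod-xy w
        E-prod []      = trans (SA.star-eq {P.x̂ SA.⊛ P.ŷ} (zeroˡ _) []) (trans (+-congˡ (trans (*-congʳ (zeroˡ _)) (zeroˡ _))) (+-identityʳ _))
        E-prod (x ∷ w) = trans (SA.star-eq {P.x̂ SA.⊛ P.ŷ} (zeroˡ _) (x ∷ w)) (trans (+-identityˡ _)
          (trans (SA.∂-⊛ x (P.x̂ SA.⊛ P.ŷ) P.E (zeroˡ _) w)
          (trans (SA.⊛-cong {g = P.E} xy SA.𝓦.refl w) (trans (SA.const-⊛ (val x * y) P.E w) (*-congˡ (E-prod w))))))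
          where
          scale : ∀ v → val x * P.ŷ v ≈ SA.const (val x * y) v
          scale []      = refl
          scale (_ ∷ _) = zeroʳ _
          xy : SA.∂ x (P.x̂ SA.⊛ P.ŷ) SA.≋ SA.const (val x * y)
          xy v = trans (SA.shift-⊛ (λ x → SA.const (val x)) P.ŷ (x ∷ v)) (trans (SA.const-⊛ (val x) P.ŷ v) (scale v))

        module _ (H : 𝓦) (moments-xy : (λ w → φ (prod-xy w)) ≋ Cumulants.M K t L H) where

          cumulants-of-products : ∀ x w → H (x ∷ w) K.≈ G (x ∷ w)
          cumulants-of-products = CumulantsInjective.cumulants-injective K t L H G (begin
            CH.M
              ≈⟨ CH≋ ⟩
            φ̂ L P.E
              ≈⟨ φE ⟩
            const K.1# ⊕ CG.b ⊛ φ̂ L P.E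
              ≈⟨ 𝓦.+-cong {const K.1#} 𝓦.refl (⊛-cong {CG.b} 𝓦.refl CH≋) ⟨
            const K.1# ⊕ CG.b ⊛ CH.M ∎)
            where
            module CH = Cumulants K t L H
            CH≋ : CH.M ≋ φ̂ L P.E
            CH≋ w = K.trans (K.sym (moments-xy w)) (φ-cong (sym (E-prod w)))

-- Decomposition of non-crossing partitions at the first point.

module Nodes where

  open import Defs using (NC; mkNC; labels; NonCrossing; nonCrossing; isPartition?)
  open import Data.Bool.Base using (Bool; true; false; if_then_else_)
  open import Data.Fin.Base using (Fin; zero; suc; toℕ; _↑ˡ_; _↑ʳ_; splitAt; _≤_; _<_)
  open import Data.Fin.Properties using (_≟_; splitAt-↑ˡ; splitAt-↑ʳ; toℕ-↑ˡ; toℕ-↑ʳ; ↑ˡ-injective; ↑ʳ-injective; suc-injective; toℕ-injective)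
  open import Data.List.Base as List using ()
  open import Data.Sum.Base using ([_,_]′)
  open import Data.Vec.Base as Vec using (Vec; lookup; tabulate)
  open import Data.Vec.Properties using (lookup∘tabulate; tabulate∘lookup; tabulate-cong)
  open import Relation.Binary.PropositionalEquality using (_≡_; _≢_; refl; sym; trans; cong; subst; subst₂)
  open import Relation.Nullary using (¬_; does; yes; no; recompute; contradiction)

  Labelling : ℕ → Set
  Labelling n = Fin n → Fin n

  IsPart : ∀ {n} → Labelling n → Set
  IsPart v = ∀ i → v i ≤ i × v (v i) ≡ v i

  IsNC : ∀ {n} → Labelling n → Set
  IsNC v = NonCrossing _<_ (λ i j → v i ≡ v j)

  module _ {n} (π : NC n) where

    lab : Labelling n
    lab = lookup (labels π)

    lab-nc : IsNC lab
    lab-nc = nonCrossing π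

  lab-part : ∀ {n} (π : NC n) → IsPart (lab π)
  lab-part (mkNC v p _) = recompute (isPartition? v) p

  NC-≡ : ∀ {n} {π ρ : NC n} → labels π ≡ labels ρ → π ≡ ρ
  NC-≡ refl = refl

  lab-injective : ∀ {n} {π ρ : NC n} → (∀ i → lab π i ≡ lab ρ i) → π ≡ ρ
  lab-injective {π = π} {ρ} p = NC-≡ (trans (sym (tabulate∘lookup (labels π))) (trans (tabulate-cong p) (tabulate∘lookup (labels ρ))))

  tabulateNC : ∀ {n} (v : Labelling n) → .(IsPart v) → .(IsNC v) → NC n
  tabulateNC v p q = mkNC (tabulate v)
    (λ i → subst (_≤ i) (sym (l i)) (proj₁ (p i)) , trans (l (lookup (tabulate v) i)) (trans (cong v (l i)) (trans (proj₂ (p i)) (sym (l i)))))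
    (λ i j k m i<j j<k k<m e f → trans (l i) (trans (q i j k m i<j j<k k<m
      (trans (sym (l i)) (trans e (l k))) (trans (sym (l j)) (trans f (l m)))) (sym (l j))))
    where
    l : ∀ i → lookup (tabulate v) i ≡ v i
    l = lookup∘tabulate v

  -- The points i and w i are equivalent for both labellings, so v i = v (w i) ≤ w i, and
  -- symmetrically.
  part-unique : ∀ {n} {v w : Labelling n} → IsPart v → IsPart w →
    (∀ i j → v i ≡ v j → w i ≡ w j) → (∀ i j → w i ≡ w j → v i ≡ v j) → ∀ i → v i ≡ w i
  part-unique {v = v} {w} pv pw f g i = toℕ-injective (ℕ.≤-antisym
    (subst (_≤ w i) (g _ _ (proj₂ (pw i))) (proj₁ (pv (w i))))
    (subst (_≤ v i) (f _ _ (proj₂ (pv i))) (proj₁ (pw (v i)))))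

  is : ∀ {n} → Maybe (Fin n) → Fin n → Bool
  is nothing  _ = false
  is (just m) k = does (m ≟ k)

  is-true : ∀ {n} {m : Maybe (Fin n)} {k} → is m k ≡ true → m ≡ just k
  is-true {m = just m} {k} e with m ≟ k
  ... | yes refl = refl

  is-just : ∀ {n} (k : Fin n) → is (just k) k ≡ true
  is-just k with k ≟ k
  ... | yes _  = refl
  ... | no k≢k = contradiction refl k≢k

  -- Least points label their blocks, so this is also the label of the block of the first point.
  firstPoint : ∀ n → Maybe (Fin n)
  firstPoint zero    = nothing
  firstPoint (suc n) = just zero

  is-first⇒zero : ∀ {n} {k : Fin (suc n)} → is (firstPoint (suc n)) k ≡ true → k ≡ zero
  is-first⇒zero {k = zero} _ = refl

  -- The points 0, 1, …, a + b: the point 0, a gap of a points, and the remaining b points.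
  gap : ∀ {a} b → Fin a → Fin (suc (a ℕ.+ b))
  gap b i = suc (i ↑ˡ b)

  rest : ∀ a {b} → Fin b → Fin (suc (a ℕ.+ b))
  rest a i = suc (a ↑ʳ i)

  data View {a b} : Fin (suc (a ℕ.+ b)) → Set where
    origin : View zero
    gapᵛ   : ∀ i → View (gap b i)
    restᵛ  : ∀ i → View (rest a i)

  view : ∀ a b (i : Fin (suc (a ℕ.+ b))) → View {a} {b} i
  view a       b zero = origin
  view zero    b (suc i) = restᵛ i
  view (suc a) b (suc zero) = gapᵛ zero
  view (suc a) b (suc (suc i)) with view a b (suc i)
  ... | gapᵛ j  = gapᵛ (suc j)
  ... | restᵛ j = restᵛ j

  module _ {a b : ℕ} where

    gap-injective : ∀ {i j} → gap {a} b i ≡ gap b j → i ≡ j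
    gap-injective e = ↑ˡ-injective b _ _ (suc-injective e)

    rest-injective : ∀ {i j} → rest a {b} i ≡ rest a j → i ≡ j
    rest-injective e = ↑ʳ-injective a _ _ (suc-injective e)

    gap<rest : ∀ i j → gap {a} b i < rest a {b} j
    gap<rest i j = s≤s (subst₂ ℕ._<_ (sym (toℕ-↑ˡ i b)) (sym (toℕ-↑ʳ a j))
      (ℕ.<-≤-trans (Data.Fin.Properties.toℕ<n i) (ℕ.m≤m+n a (toℕ j))))

    gap≢rest : ∀ {i j} → gap {a} b i ≢ rest a {b} j
    gap≢rest {i} {j} e = ℕ.<-irrefl (cong toℕ e) (gap<rest i j)

    gap-≤ : ∀ {i j : Fin a} → i ≤ j → gap {a} b i ≤ gap b j
    gap-≤ {i} {j} p = s≤s (subst₂ ℕ._≤_ (sym (toℕ-↑ˡ i b)) (sym (toℕ-↑ˡ j b)) p)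

    gap-≤⁻¹ : ∀ {i j : Fin a} → gap {a} b i ≤ gap b j → i ≤ j
    gap-≤⁻¹ {i} {j} (s≤s p) = subst₂ ℕ._≤_ (toℕ-↑ˡ i b) (toℕ-↑ˡ j b) p

    gap-< : ∀ {i j : Fin a} → i < j → gap {a} b i < gap b j
    gap-< {i} {j} p = s≤s (subst₂ ℕ._<_ (sym (toℕ-↑ˡ i b)) (sym (toℕ-↑ˡ j b)) p)

    gap-<⁻¹ : ∀ {i j : Fin a} → gap {a} b i < gap b j → i < j
    gap-<⁻¹ {i} {j} (s≤s p) = subst₂ ℕ._<_ (toℕ-↑ˡ i b) (toℕ-↑ˡ j b) p

    rest-≤ : ∀ {i j : Fin b} → i ≤ j → rest a {b} i ≤ rest a j
    rest-≤ {i} {j} p = s≤s (subst₂ ℕ._≤_ (sym (toℕ-↑ʳ a i)) (sym (toℕ-↑ʳ a j)) (ℕ.+-monoʳ-≤ a p))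

    rest-≤⁻¹ : ∀ {i j : Fin b} → rest a {b} i ≤ rest a j → i ≤ j
    rest-≤⁻¹ {i} {j} (s≤s p) = ℕ.+-cancelˡ-≤ a _ _ (subst₂ ℕ._≤_ (toℕ-↑ʳ a i) (toℕ-↑ʳ a j) p)

    rest-< : ∀ {i j : Fin b} → i < j → rest a {b} i < rest a j
    rest-< {i} {j} p = s≤s (subst₂ ℕ._<_ (sym (toℕ-↑ʳ a i)) (sym (toℕ-↑ʳ a j)) (ℕ.+-monoʳ-< a p))

    rest-<⁻¹ : ∀ {i j : Fin b} → rest a {b} i < rest a j → i < j
    rest-<⁻¹ {i} {j} (s≤s p) = ℕ.+-cancelˡ-< a _ _ (subst₂ ℕ._<_ (toℕ-↑ʳ a i) (toℕ-↑ʳ a j) p)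

  -- Join the point 0 to the block mp of v, if any, and to the block mq of w, if any.
  module Glue {a b} (v : Labelling a) (mp : Maybe (Fin a)) (w : Labelling b) (mq : Maybe (Fin b)) where

    gapLabel : Fin a → Fin (suc (a ℕ.+ b))
    gapLabel k = if is mp k then zero else gap b k

    restLabel : Fin b → Fin (suc (a ℕ.+ b))
    restLabel k = if is mq k then zero else rest a k

    glue : Labelling (suc (a ℕ.+ b))
    glue zero    = zero
    glue (suc i) = [ gapLabel ∘ v , restLabel ∘ w ]′ (splitAt a i)

    glue-gap : ∀ i → glue (gap b i) ≡ gapLabel (v i)
    glue-gap i = cong [ gapLabel ∘ v , restLabel ∘ w ]′ (splitAt-↑ˡ a i b)

    glue-rest : ∀ i → glue (rest a i) ≡ restLabel (w i)
    glue-rest i = cong [ gapLabel ∘ v , restLabel ∘ w ]′ (splitAt-↑ʳ a b i)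

    gapLabel-injective : ∀ {k l} → gapLabel k ≡ gapLabel l → k ≡ l
    gapLabel-injective {k} {l} e with is mp k in p | is mp l in q
    ... | false | false = gap-injective e
    ... | true  | true  with refl ← trans (sym (is-true {m = mp} p)) (is-true {m = mp} q) = refl

    restLabel-injective : ∀ {k l} → restLabel k ≡ restLabel l → k ≡ l
    restLabel-injective {k} {l} e with is mq k in p | is mq l in q
    ... | false | false = rest-injective e
    ... | true  | true  with refl ← trans (sym (is-true {m = mq} p)) (is-true {m = mq} q) = refl

    gapLabel≡rest : ∀ {k l} → gapLabel k ≢ rest a l
    gapLabel≡rest {k} {l} e with is mp k | e
    ... | false | e = gap≢rest e

    restLabel≡gap : ∀ {k l} → restLabel k ≢ gap b l
    restLabel≡gap {k} {l} e with is mq k | e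
    ... | false | e = gap≢rest (sym e)

    gapLabel≡zero : ∀ {k} → gapLabel k ≡ zero → is mp k ≡ true
    gapLabel≡zero {k} e with is mp k | e
    ... | true | _ = refl

    restLabel≡zero : ∀ {k} → restLabel k ≡ zero → is mq k ≡ true
    restLabel≡zero {k} e with is mq k | e
    ... | true | _ = refl

    gapLabel≡gap : ∀ {k l} → gapLabel k ≡ gap b l → k ≡ l
    gapLabel≡gap {k} e with is mp k | e
    ... | false | e = gap-injective e

    restLabel≡rest : ∀ {k l} → restLabel k ≡ rest a l → k ≡ l
    restLabel≡rest {k} e with is mq k | e
    ... | false | e = rest-injective e

    glue-part : IsPart v → IsPart w → IsPart glue
    glue-part pv pw i with view a b i
    ... | origin = z≤n , refl
    ... | gapᵛ i = subst (_≤ gap b i) (sym (glue-gap i)) below , trans (cong glue (glue-gap i)) (trans idem (sym (glue-gap i)))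
      where
      below : gapLabel (v i) ≤ gap b i
      below with is mp (v i)
      ... | true  = z≤n
      ... | false = gap-≤ (proj₁ (pv i))
      idem : glue (gapLabel (v i)) ≡ gapLabel (v i)
      idem with is mp (v i) in e
      ... | true  = refl
      ... | false = trans (glue-gap (v i)) (trans (cong gapLabel (proj₂ (pv i))) (cong (λ c → if c then zero else gap b (v i)) e))
    ... | restᵛ i = subst (_≤ rest a i) (sym (glue-rest i)) below , trans (cong glue (glue-rest i)) (trans idem (sym (glue-rest i)))
      where
      below : restLabel (w i) ≤ rest a i
      below with is mq (w i)
      ... | true  = z≤n
      ... | false = rest-≤ (proj₁ (pw i))
      idem : glue (restLabel (w i)) ≡ restLabel (w i)
      idem with is mq (w i) in e
      ... | true  = refl
      ... | false = trans (glue-rest (w i)) (trans (cong restLabel (proj₂ (pw i))) (cong (λ c → if c then zero else rest a (w i)) e))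

    glue≡gap : ∀ i {l} → glue i ≡ gap b l → ∃ λ k → i ≡ gap b k × v k ≡ l
    glue≡gap i e with view a b i
    ... | gapᵛ k  = k , refl , gapLabel≡gap (trans (sym (glue-gap k)) e)
    ... | restᵛ k = ⊥-elim (restLabel≡gap (trans (sym (glue-rest k)) e))

  -- The remaining points start at the successor of 0 in its block, so 0 joins their first block and
  -- no block of the gap. For b = 0 the point 0 is a singleton and all other points form the gap.
  module NodeGlue {a b} (v : Labelling a) (w : Labelling b) where

    open Glue v nothing w (firstPoint b) public

    private
      -- If 0 < j < k < l with 0 ~ k and j ~ l, then non-crossing puts j into the block of 0. This
      -- is the case of `glue-nc` in which i is the origin.
      lemma : ∀ {b} (w : Labelling b) → IsPart w → IsNC w → ∀ j k l → j < k → k < l →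
              is (firstPoint b) (w k) ≡ true → w j ≡ w l → is (firstPoint b) (w j) ≡ true
      lemma {suc b} w pw nw j k l j<k k<l e f with is-first⇒zero {b} {w k} e
      ... | wk≡0 with j ≟ zero
      ...   | yes refl = subst (λ z → is (just zero) z ≡ true) (sym (toℕ-injective (ℕ.n≤0⇒n≡0 (proj₁ (pw zero))))) refl
      ...   | no j≢0 = subst (λ z → is (just zero) z ≡ true) (trans (sym w0) (nw zero j k l 0<j j<k k<l (trans w0 (sym wk≡0)) f)) refl
        where
        w0 : w zero ≡ zero
        w0 = toℕ-injective (ℕ.n≤0⇒n≡0 (proj₁ (pw zero)))
        0<j : _<_ {suc b} zero j
        0<j = ℕ.n≢0⇒n>0 (λ e → j≢0 (toℕ-injective e))

    glue-nc : IsPart w → IsNC v → IsNC w → IsNC glue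
    glue-nc pw nv nw i j k l i<j j<k k<l i~k j~l with view a b j | view a b l | view a b k
    glue-nc pw nv nw i .zero k l () j<k k<l i~k j~l | origin | _ | _
    glue-nc pw nv nw i j k .zero i<j j<k () i~k j~l | _ | origin | _
    glue-nc pw nv nw i j .zero l i<j () k<l i~k j~l | _ | _ | origin
    ... | gapᵛ j | restᵛ l | _ = ⊥-elim (restLabel≡gap (sym (trans (sym (glue-gap j)) (trans j~l (glue-rest l)))))
    ... | restᵛ j | gapᵛ l | _ = ⊥-elim (restLabel≡gap (trans (sym (glue-rest j)) (trans j~l (glue-gap l))))
    ... | gapᵛ j | gapᵛ l | restᵛ k = ⊥-elim (ℕ.<-asym k<l (gap<rest l k))
    ... | restᵛ j | restᵛ l | gapᵛ k = ⊥-elim (ℕ.<-asym j<k (gap<rest k j))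
    ... | gapᵛ j | gapᵛ l | gapᵛ k with glue≡gap i (trans i~k (glue-gap k))
    ...   | i , refl , vi≡vk = trans (glue-gap i) (trans (cong gapLabel
              (nv i j k l (gap-<⁻¹ i<j) (gap-<⁻¹ j<k) (gap-<⁻¹ k<l) vi≡vk
                (gapLabel-injective (trans (sym (glue-gap j)) (trans j~l (glue-gap l)))))) (sym (glue-gap j)))
    glue-nc pw nv nw i j k l i<j j<k k<l i~k j~l | restᵛ j′ | restᵛ l′ | restᵛ k′ with view a b i
    ... | gapᵛ i′ = ⊥-elim (restLabel≡gap (sym (trans (sym (glue-gap i′)) (trans i~k (glue-rest k′)))))
    ... | restᵛ i′ = trans (glue-rest i′) (trans (cong restLabel
            (nw i′ j′ k′ l′ (rest-<⁻¹ i<j) (rest-<⁻¹ j<k) (rest-<⁻¹ k<l)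
              (restLabel-injective (trans (sym (glue-rest i′)) (trans i~k (glue-rest k′))))
              (restLabel-injective (trans (sym (glue-rest j′)) (trans j~l (glue-rest l′)))))) (sym (glue-rest j′)))
    ... | origin = sym (trans (glue-rest j′) (cong (λ c → if c then zero else rest a (w j′))
            (lemma w pw nw j′ k′ l′ (rest-<⁻¹ j<k) (rest-<⁻¹ k<l)
              (restLabel≡zero (sym (trans i~k (glue-rest k′))))
              (restLabel-injective (trans (sym (glue-rest j′)) (trans j~l (glue-rest l′)))))))

  node : ∀ {a b} → NC a → NC b → NC (suc (a ℕ.+ b))
  node ρ σ = tabulateNC glue (glue-part (lab-part ρ) (lab-part σ)) (glue-nc (lab-part σ) (lab-nc ρ) (lab-nc σ))
    where open NodeGlue (lab ρ) (lab σ)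

  nodeAt : ∀ {a b n} → a ℕ.+ b ≡ n → NC a → NC b → NC (suc n)
  nodeAt refl = node

  lab-node : ∀ {a b} (ρ : NC a) (σ : NC b) i → lab (node ρ σ) i ≡ NodeGlue.glue (lab ρ) (lab σ) i
  lab-node ρ σ = lookup∘tabulate _

  embed : ∀ {m n} → m ≡ n → Fin m → Fin n
  embed refl i = i

  -- Used to find the successor of 0 in its block. If there is none, then b = 0 and the second
  -- condition is void.
  firstHit : ∀ n (p : Fin n → Bool) → ∃ λ a → ∃ λ b → Σ (a ℕ.+ b ≡ n) λ e →
    (∀ i → p (embed e (i ↑ˡ b)) ≡ false) × (∀ j → firstPoint b ≡ just j → p (embed e (a ↑ʳ j)) ≡ true)
  firstHit zero    p = 0 , 0 , refl , (λ ()) , (λ _ ())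
  firstHit (suc n) p with p zero in e
  ... | true = 0 , suc n , refl , (λ ()) , λ { .zero refl → e }
  ... | false with firstHit n (p ∘ suc)
  ...   | a , b , refl , f , g = suc a , b , refl , (λ { zero → e ; (suc i) → f i }) , g

  module Restrict {a b} (π : NC (suc (a ℕ.+ b)))
    (gap≢0 : ∀ i → lab π (gap b i) ≢ zero) (rest≡0 : ∀ j → firstPoint b ≡ just j → lab π (rest a j) ≡ zero) where

    private
      u : Labelling (suc (a ℕ.+ b))
      u = lab π

      gapPart : ∀ i → ∃ λ k → u (gap b i) ≡ gap b k
      gapPart i with u (gap b i) in e | view a b (u (gap b i))
      ... | .zero | origin  = contradiction e (gap≢0 i)
      ... | _     | gapᵛ k  = k , refl
      ... | _     | restᵛ k = ⊥-elim (ℕ.<⇒≱ (gap<rest i k) (subst (_≤ gap b i) e (proj₁ (lab-part π (gap b i)))))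

      v : Labelling a
      v i = proj₁ (gapPart i)

      u-gap : ∀ i → u (gap b i) ≡ gap b (v i)
      u-gap i = proj₂ (gapPart i)

      restLabel : Fin b → Fin (suc (a ℕ.+ b))
      restLabel = Glue.restLabel v nothing id (firstPoint b)

      u-0 : u zero ≡ zero
      u-0 = toℕ-injective (ℕ.n≤0⇒n≡0 (proj₁ (lab-part π zero)))

    -- After restriction to the remaining points, the label 0 becomes their first point, which
    -- `restLabel` sends back to 0.
    restPart : ∀ j → ∃ λ k → u (rest a j) ≡ restLabel k
    restPart j with u (rest a j) in e | view a b (u (rest a j))
    ... | .zero | origin  = start j
      where
      start : ∀ {b} → Fin b → ∃ λ k → zero ≡ Glue.restLabel {a} {b} v nothing id (firstPoint b) k
      start {suc b} _ = zero , refl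
    ... | _ | restᵛ k = k , unjoined (is (firstPoint b) k) refl
      where
      unjoined : ∀ c → is (firstPoint b) k ≡ c → rest a k ≡ (if is (firstPoint b) k then zero else rest a k)
      unjoined false q = sym (cong (λ c → if c then zero else rest a k) q)
      unjoined true  q with () ← trans (sym (rest≡0 k (is-true {m = firstPoint b} q)))
                                  (trans (cong u (sym e)) (trans (proj₂ (lab-part π (rest a j))) e))
    ... | _ | gapᵛ k = ⊥-elim crossing
      where
      u-k : u (gap b k) ≡ gap b k
      u-k = trans (cong u (sym e)) (trans (proj₂ (lab-part π (rest a j))) e)
      start : ∀ {b} (j : Fin b) → ∃ λ f → firstPoint b ≡ just f × f ≤ j
      start {suc b} j = zero , refl , z≤n
      -- No block reaches from the gap to the rest: 0 ~ f and k ~ j with 0 < k < f < j would cross,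
      -- and f = j would put j into the block of 0.
      crossing : ⊥
      crossing with start j
      ... | f , f-first , f≤j with f ≟ j
      ...   | yes refl with () ← trans (sym (rest≡0 f f-first)) e
      ...   | no f≢j with () ← trans (sym u-0) (trans (lab-nc π zero (gap b k) (rest a f) (rest a j)
                  (s≤s z≤n) (gap<rest k f) (rest-< (ℕ.≤∧≢⇒< f≤j (λ q → f≢j (toℕ-injective q))))
                  (trans u-0 (sym (rest≡0 f f-first))) (trans u-k (sym e))) u-k)

    private
      w : Labelling b
      w j = proj₁ (restPart j)

      u-rest : ∀ j → u (rest a j) ≡ restLabel (w j)
      u-rest j = proj₂ (restPart j)

      restLabel-injective : ∀ {k l} → restLabel k ≡ restLabel l → k ≡ l
      restLabel-injective = Glue.restLabel-injective v nothing id (firstPoint b)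

      v-part : IsPart v
      v-part i = gap-≤⁻¹ (subst (_≤ gap b i) (u-gap i) (proj₁ (lab-part π (gap b i))))
               , gap-injective (trans (sym (u-gap (v i))) (trans (cong u (sym (u-gap i)))
                   (trans (proj₂ (lab-part π (gap b i))) (u-gap i))))

      v-nc : IsNC v
      v-nc i j k l i<j j<k k<l e f = gap-injective (trans (sym (u-gap i)) (trans
        (lab-nc π (gap b i) (gap b j) (gap b k) (gap b l) (gap-< i<j) (gap-< j<k) (gap-< k<l)
          (trans (u-gap i) (trans (cong (gap b) e) (sym (u-gap k)))) (trans (u-gap j) (trans (cong (gap b) f) (sym (u-gap l)))))
        (u-gap j)))

      w-part : IsPart w
      w-part j with is (firstPoint b) (w j) in e | u-rest j
      ... | false | q = rest-≤⁻¹ (subst (_≤ rest a j) q (proj₁ (lab-part π (rest a j))))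
                      , restLabel-injective (trans (sym (u-rest (w j))) (trans (trans (cong u (sym q))
                          (trans (proj₂ (lab-part π (rest a j))) q)) (sym (cong (λ c → if c then zero else rest a (w j)) e))))
      ... | true  | q = below (is-true {m = firstPoint b} e)
                      , restLabel-injective (trans (sym (u-rest (w j))) (trans (rest≡0 (w j) (is-true {m = firstPoint b} e))
                          (sym (cong (λ c → if c then zero else rest a (w j)) e))))
        where
        below : ∀ {b} {k l : Fin b} → firstPoint b ≡ just k → k ≤ l
        below {suc b} refl = z≤n

      w-nc : IsNC w
      w-nc i j k l i<j j<k k<l e f = restLabel-injective (trans (sym (u-rest i)) (trans
        (lab-nc π (rest a i) (rest a j) (rest a k) (rest a l) (rest-< i<j) (rest-< j<k) (rest-< k<l)
          (trans (u-rest i) (trans (cong restLabel e) (sym (u-rest k)))) (trans (u-rest j) (trans (cong restLabel f) (sym (u-rest l)))))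
        (u-rest j)))

    gapNC : NC a
    gapNC = tabulateNC v v-part v-nc

    restNC : NC b
    restNC = tabulateNC w w-part w-nc

    node-restrict : node gapNC restNC ≡ π
    node-restrict = lab-injective λ i → trans (lab-node gapNC restNC i) (labels≡ i)
      where
      open NodeGlue (lab gapNC) (lab restNC) using (glue; glue-gap; glue-rest)
      labels≡ : ∀ i → glue i ≡ u i
      labels≡ i with view a b i
      ... | origin  = sym u-0
      ... | gapᵛ i  = trans (glue-gap i) (trans (cong (gap b) (lookup∘tabulate v i)) (sym (u-gap i)))
      ... | restᵛ i = trans (glue-rest i) (trans (cong restLabel (lookup∘tabulate w i)) (sym (u-rest i)))

  does-zero : ∀ {n} (i : Fin (suc n)) → does (i ≟ zero) ≡ true → i ≡ zero
  does-zero zero _ = refl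

  node-surjective : ∀ {n} (π : NC (suc n)) → ∃ λ a → ∃ λ b → Σ (a ℕ.+ b ≡ n) λ e → Σ (NC a) λ ρ → Σ (NC b) λ σ → nodeAt e ρ σ ≡ π
  node-surjective {n} π with firstHit n (λ i → does (lab π (suc i) ≟ zero))
  ... | a , b , refl , f , g = a , b , refl , gapNC , restNC , node-restrict
    where
    open Restrict {a} {b} π
      (λ i e → contradiction (trans (sym (f i)) (cong (λ z → does (z ≟ zero)) e)) λ ())
      (λ j e → does-zero (lab π (suc (a ↑ʳ j))) (g j e))

  node-rest-zero : ∀ {a b} (ρ : NC a) (σ : NC b) j → firstPoint b ≡ just j → lab (node ρ σ) (rest a j) ≡ zero
  node-rest-zero {a} {suc b} ρ σ .zero refl = trans (lab-node ρ σ (rest a zero)) (trans (glue-rest zero)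
    (cong restLabel (toℕ-injective {j = zero} (ℕ.n≤0⇒n≡0 (proj₁ (lab-part σ zero))))))
    where open NodeGlue (lab ρ) (lab σ)

  node-gap-nonzero : ∀ {a b} (ρ : NC a) (σ : NC b) i → lab (node ρ σ) (gap b i) ≢ zero
  node-gap-nonzero ρ σ i e = contradiction (trans (sym (glue-gap i)) (trans (sym (lab-node ρ σ _)) e)) λ ()
    where open NodeGlue (lab ρ) (lab σ)

  -- The point a + 1 has label 0 in the first partition and lies in the gap of the second, where no
  -- label is 0. If b = 0 there is no such point, but then a is already maximal.
  nodeAt-size : ∀ {n a b a′ b′} (e : a ℕ.+ b ≡ n) (e′ : a′ ℕ.+ b′ ≡ n) {ρ : NC a} {σ : NC b} {ρ′ : NC a′} {σ′ : NC b′} →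
    nodeAt e ρ σ ≡ nodeAt e′ ρ′ σ′ → ¬ (a ℕ.< a′)
  nodeAt-size {n} {a} {b} {a′} {b′} refl e′ {ρ} {σ} {ρ′} {σ′} p a<a′ = go b refl
    where
    firstRest : ∀ {m} (q : b ≡ suc m) → lab (node ρ σ) (rest a (subst Fin (sym q) zero)) ≡ zero
    firstRest refl = node-rest-zero ρ σ zero refl
    gapLab : ∀ {a′ b′ n} (e′ : a′ ℕ.+ b′ ≡ n) {ρ′ : NC a′} {σ′ : NC b′} (i : Fin (suc n)) → 0 ℕ.< toℕ i → toℕ i ℕ.≤ a′ →
      lab (nodeAt e′ ρ′ σ′) i ≢ zero
    gapLab {a′} {b′} refl {ρ′} {σ′} i 0<i i≤ q with view a′ b′ i
    ... | origin  = contradiction 0<i λ ()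
    ... | gapᵛ j  = node-gap-nonzero ρ′ σ′ j q
    ... | restᵛ j = ℕ.<⇒≱ (s≤s (subst (a′ ℕ.≤_) (sym (toℕ-↑ʳ a′ j)) (ℕ.m≤m+n a′ (toℕ j)))) i≤
    go : ∀ m → b ≡ m → _
    go zero    refl = ℕ.<⇒≱ a<a′ (subst (a′ ℕ.≤_) (trans e′ (ℕ.+-identityʳ a)) (ℕ.m≤m+n a′ b′))
    go (suc m) refl = gapLab e′ {ρ′} {σ′} (rest a zero) (s≤s z≤n)
      (ℕ.≤-trans (ℕ.≤-reflexive (cong suc (trans (toℕ-↑ʳ a zero) (ℕ.+-identityʳ a)))) a<a′)
      (trans (cong (λ (π : NC (suc (a ℕ.+ suc m))) → lab π (rest a zero)) (sym p)) (firstRest refl))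

  node-injective : ∀ {a b} {ρ ρ′ : NC a} {σ σ′ : NC b} → node ρ σ ≡ node ρ′ σ′ → ρ ≡ ρ′ × σ ≡ σ′
  node-injective {a} {b} {ρ} {ρ′} {σ} {σ′} p = lab-injective (λ i → gap-injective (trans (sym (G.glue-gap i)) (trans (at (gap b i)) (G′.glue-gap i))))
                    , lab-injective (λ i → G.restLabel-injective (trans (sym (G.glue-rest i)) (trans (at (rest a i)) (G′.glue-rest i))))
    where
    module G = NodeGlue (lab ρ) (lab σ)
    module G′ = NodeGlue (lab ρ′) (lab σ′)
    at : ∀ i → G.glue i ≡ G′.glue i
    at i = trans (sym (lab-node ρ σ i)) (trans (cong (λ π → lab π i) p) (lab-node ρ′ σ′ i))

-- Enumeration of NC(n + 1) by the decomposition.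

module Enumeration where

  open import Defs hiding (sumNC)
  open Nodes
  open import Data.Fin.Base using (Fin)
  open import Data.List.Base as List using (List; []; _∷_; _++_; map; concatMap; foldr; allFin; mapMaybe; cartesianProductWith)
  open import Data.List.Membership.Propositional using (_∈_)
  open import Data.List.Membership.Propositional.Properties using (∈-map⁺; ∈-concat⁺′; ∈-cartesianProductWith⁺; ∈-cartesianProductWith⁻; ∈-allFin)
  open import Data.List.Membership.Propositional.Properties.WithK using (unique∧set⇒bag)
  open import Data.List.Relation.Binary.BagAndSetEquality using (∼bag⇒↭)
  open import Data.List.Relation.Binary.Disjoint.Propositional using (Disjoint)
  open import Data.List.Relation.Binary.Permutation.Propositional as ↭ using (_↭_)
  open import Data.List.Relation.Unary.All as All using (All; []; _∷_)
  open import Data.List.Relation.Unary.All.Properties as All using ()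
  open import Data.List.Relation.Unary.AllPairs as AllPairs using (AllPairs; []; _∷_)
  open import Data.List.Relation.Unary.AllPairs.Properties as AllPairs using ()
  open import Data.List.Relation.Unary.Any using (here; there)
  open import Data.List.Relation.Unary.Unique.Propositional using (Unique)
  open import Data.List.Relation.Unary.Unique.Propositional.Properties using (cartesianProductWith⁺; allFin⁺; concat⁺)
  open import Data.Vec.Base as Vec using (Vec; []; _∷_)
  open import Data.Vec.Properties using (∷-injective)
  open import Function.Bundles using (mk⇔)
  open import Relation.Binary.PropositionalEquality as ≡ using (_≡_; _≢_; cong)
  open import Relation.Nullary using (yes; no; _×-dec_; recompute; contradiction)

  words-complete : ∀ {A : Set} {xs : List A} → (∀ x → x ∈ xs) → ∀ {m} (v : Vec A m) → v ∈ words xs m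
  words-complete p []      = here ≡.refl
  words-complete p (x ∷ v) = ∈-cartesianProductWith⁺ _∷_ (p x) (words-complete p v)

  words-unique : ∀ {A : Set} {xs : List A} → Unique xs → ∀ m → Unique (words xs m)
  words-unique u zero    = [] ∷ []
  words-unique u (suc m) = cartesianProductWith⁺ _∷_ ∷-injective u (words-unique u m)

  toNC-labels : ∀ {n} (π : NC n) → toNC (labels π) ≡ just π
  toNC-labels (mkNC v p q) with isPartition? v ×-dec isNonCrossing? v
  ... | yes _ = ≡.refl
  ... | no ¬r = contradiction (recompute (isPartition? v) p , recompute (isNonCrossing? v) q) ¬r

  labels-toNC : ∀ {n} {v : Vec (Fin n) n} {π} → toNC v ≡ just π → labels π ≡ v
  labels-toNC {v = v} e with isPartition? v ×-dec isNonCrossing? v | e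
  ... | yes _ | ≡.refl = ≡.refl

  allNC-complete : ∀ {n} (π : NC n) → π ∈ allNC n
  allNC-complete {n} π = collect (words (allFin n) n) (words-complete ∈-allFin (labels π))
    where
    collect : ∀ vs → labels π ∈ vs → π ∈ mapMaybe toNC vs
    collect (v ∷ vs) (here ≡.refl) rewrite toNC-labels π = here ≡.refl
    collect (v ∷ vs) (there p) with toNC v
    ... | just _  = there (collect vs p)
    ... | nothing = collect vs p

  allNC-unique : ∀ n → Unique (allNC n)
  allNC-unique n = collect (words-unique (allFin⁺ n) n)
    where
    fresh : ∀ {v vs} {π : NC n} → labels π ≡ v → All (v ≢_) vs → All (π ≢_) (mapMaybe toNC vs)
    fresh e [] = []
    fresh {vs = v′ ∷ vs} e (p ∷ ps) with toNC v′ in e′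
    ... | just σ  = (λ { ≡.refl → p (≡.trans (≡.sym e) (labels-toNC e′)) }) ∷ fresh e ps
    ... | nothing = fresh e ps
    collect : ∀ {vs} → Unique vs → Unique (mapMaybe toNC vs)
    collect [] = []
    collect {v ∷ vs} (p ∷ ps) with toNC v in e
    ... | just π  = fresh (labels-toNC e) p ∷ collect ps
    ... | nothing = collect ps

  Cut : ℕ → Set
  Cut n = ∃ λ a → ∃ λ b → a ℕ.+ b ≡ n

  shiftCut : ∀ {n} → Cut n → Cut (suc n)
  shiftCut (a , b , e) = suc a , b , cong suc e

  -- The order is the one produced by the recursion of `⊛`, so that `⊛-cuts` needs no rearrangement.
  cuts : ∀ n → List (Cut n)
  cuts zero    = (0 , 0 , ≡.refl) ∷ []
  cuts (suc n) = (0 , suc n , ≡.refl) ∷ map shiftCut (cuts n)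

  cuts-complete : ∀ {n} a b (e : a ℕ.+ b ≡ n) → (a , b , e) ∈ cuts n
  cuts-complete zero    zero    ≡.refl = here ≡.refl
  cuts-complete zero    (suc b) ≡.refl = here ≡.refl
  cuts-complete (suc a) b       ≡.refl = there (∈-map⁺ shiftCut (cuts-complete a b ≡.refl))

  cuts-distinct : ∀ n → AllPairs (λ c d → proj₁ c ≢ proj₁ d) (cuts n)
  cuts-distinct zero    = [] ∷ []
  cuts-distinct (suc n) = All.map⁺ (All.universal (λ _ ()) (cuts n))
    ∷ AllPairs.map⁺ (AllPairs.map (λ p q → p (ℕ.suc-injective q)) (cuts-distinct n))

  nodes : ∀ {n} → Cut n → List (NC (suc n))
  nodes (a , b , e) = cartesianProductWith (nodeAt e) (allNC a) (allNC b)

  -- Two repetition-free lists with the same elements: every partition is a node for exactly one cut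
  -- and one pair.
  nodes-permutation : ∀ n → allNC (suc n) ↭ concatMap nodes (cuts n)
  nodes-permutation n = ∼bag⇒↭ (unique∧set⇒bag (allNC-unique (suc n)) unique
    (λ {π} → mk⇔ (λ _ → complete π) (λ _ → allNC-complete π)))
    where
    complete : ∀ π → π ∈ concatMap nodes (cuts n)
    complete π with node-surjective π
    ... | a , b , e , ρ , σ , ≡.refl = ∈-concat⁺′
      (∈-cartesianProductWith⁺ (nodeAt e) (allNC-complete ρ) (allNC-complete σ)) (∈-map⁺ nodes (cuts-complete a b e))
    nodes-unique : ∀ c → Unique (nodes c)
    nodes-unique (a , b , ≡.refl) = cartesianProductWith⁺ node node-injective (allNC-unique a) (allNC-unique b)
    disjoint : ∀ (c d : Cut n) → proj₁ c ≢ proj₁ d → Disjoint (nodes c) (nodes d)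
    disjoint (a , b , e) (a′ , b′ , e′) a≢a′ (p , q)
      with ∈-cartesianProductWith⁻ (nodeAt e) (allNC a) (allNC b) p
         | ∈-cartesianProductWith⁻ (nodeAt e′) (allNC a′) (allNC b′) q
    ... | ρ , σ , _ , _ , r | ρ′ , σ′ , _ , _ , s with ℕ.<-cmp a a′
    ...   | tri< a<a′ _ _ = nodeAt-size e e′ (≡.trans (≡.sym r) s) a<a′
    ...   | tri≈ _ a≡a′ _ = a≢a′ a≡a′
    ...   | tri> _ _ a′<a = nodeAt-size e′ e (≡.trans (≡.sym s) r) a′<a
    unique : Unique (concatMap nodes (cuts n))
    unique = concat⁺ (All.map⁺ (All.universal nodes-unique (cuts n)))
      (AllPairs.map⁺ (AllPairs.map (λ {c} {d} → disjoint c d) (cuts-distinct n)))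

  module Sums {c ℓ} (K : CommutativeRing c ℓ) where

    open CommutativeRing K hiding (zero)
    open import Algebra.Properties.CommutativeSemigroup +-commutativeSemigroup using (x∙yz≈y∙xz; interchange)
    open FreeProbability K using (sumNC)

    sum : ∀ {a} {A : Set a} → List A → (A → Carrier) → Carrier
    sum xs f = foldr _+_ 0# (map f xs)

    module _ {a} {A : Set a} where

      sum-cong : ∀ {f g : A → Carrier} → (∀ x → f x ≈ g x) → ∀ xs → sum xs f ≈ sum xs g
      sum-cong p []       = refl
      sum-cong p (x ∷ xs) = +-cong (p x) (sum-cong p xs)

      sum-↭ : ∀ {xs ys : List A} f → xs ↭ ys → sum xs f ≈ sum ys f
      sum-↭ f ↭.refl         = refl
      sum-↭ f (↭.prep x p)   = +-congˡ (sum-↭ f p)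
      sum-↭ f (↭.swap x y p) = trans (+-congˡ (+-congˡ (sum-↭ f p))) (x∙yz≈y∙xz _ _ _)
      sum-↭ f (↭.trans p q)  = trans (sum-↭ f p) (sum-↭ f q)

      sum-++ : ∀ f (xs : List A) {ys} → sum (xs ++ ys) f ≈ sum xs f + sum ys f
      sum-++ f []       = sym (+-identityˡ _)
      sum-++ f (x ∷ xs) = trans (+-congˡ (sum-++ f xs)) (sym (+-assoc _ _ _))

      sum-*ˡ : ∀ k f (xs : List A) → sum xs (λ x → k * f x) ≈ k * sum xs f
      sum-*ˡ k f []       = sym (zeroʳ k)
      sum-*ˡ k f (x ∷ xs) = trans (+-congˡ (sum-*ˡ k f xs)) (sym (distribˡ k _ _))

      sum-+ : ∀ f g (xs : List A) → sum xs (λ x → f x + g x) ≈ sum xs f + sum xs g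
      sum-+ f g []       = sym (+-identityˡ _)
      sum-+ f g (x ∷ xs) = trans (+-congˡ (sum-+ f g xs)) (interchange _ _ _ _)

    sum-map : ∀ {a b} {A : Set a} {B : Set b} (f : A → Carrier) (g : B → A) xs → sum (map g xs) f ≡ sum xs (f ∘ g)
    sum-map f g []       = ≡.refl
    sum-map f g (x ∷ xs) = cong (f (g x) +_) (sum-map f g xs)

    sum-concatMap : ∀ {a b} {A : Set a} {B : Set b} (f : A → Carrier) (g : B → List A) xs → sum (concatMap g xs) f ≈ sum xs (λ x → sum (g x) f)
    sum-concatMap f g []       = refl
    sum-concatMap f g (x ∷ xs) = trans (sum-++ f (g x)) (+-congˡ (sum-concatMap f g xs))

    sum-product : ∀ {a b c} {A : Set a} {B : Set b} {C : Set c} (h : B → C → A) (f : A → Carrier) p q →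
      (∀ x y → f (h x y) ≈ p x * q y) → ∀ xs ys → sum (cartesianProductWith h xs ys) f ≈ sum xs p * sum ys q
    sum-product h f p q e []       ys = sym (zeroˡ _)
    sum-product h f p q e (x ∷ xs) ys = trans (sum-++ f (map (h x) ys))
      (trans (+-cong (trans (reflexive (sum-map f (h x) ys))
        (trans (sum-cong (e x) ys) (sum-*ˡ (p x) q ys))) (sum-product h f p q e xs ys))
      (sym (distribʳ _ _ _)))

    -- The factors may depend on the cut because the weight of the gap depends on whether any points
    -- remain behind it.
    sumNC-suc : ∀ {n} (f : NC (suc n) → Carrier) (P Q : (c : Cut n) → Carrier)
      (p : ((a , b , e) : Cut n) → NC a → Carrier) (q : ((a , b , e) : Cut n) → NC b → Carrier) →
      (∀ a b (e : a ℕ.+ b ≡ n) ρ σ → f (nodeAt e ρ σ) ≈ p (a , b , e) ρ * q (a , b , e) σ) →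
      (∀ a b (e : a ℕ.+ b ≡ n) → sumNC a (p (a , b , e)) ≈ P (a , b , e)) →
      (∀ a b (e : a ℕ.+ b ≡ n) → sumNC b (q (a , b , e)) ≈ Q (a , b , e)) →
      sumNC (suc n) f ≈ sum (cuts n) (λ c → P c * Q c)
    sumNC-suc {n} f P Q p q split sp sq = trans (sum-↭ f (nodes-permutation n))
      (trans (sum-concatMap f nodes (cuts n)) (sum-cong (λ (a , b , e) →
        trans (sum-product (nodeAt e) f (p (a , b , e)) (q (a , b , e)) (split a b e) (allNC a) (allNC b))
          (*-cong (sp a b e) (sq a b e))) (cuts n)))

-- The Kreweras complement of a decomposed partition.

module KrewerasOfNodes where

  open import Defs hiding (sumNC)
  open Nodes
  open import Data.Bool.Base using (true; if_then_else_)
  open import Data.Fin.Base using (Fin; zero; suc; toℕ; _≤_; _<_; fromℕ)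
  open import Data.Fin.Properties using (_≟_; toℕ-injective; toℕ-fromℕ; toℕ≤pred[n]; <-cmp; ≤-antisym)
  open import Data.Sum.Base using (inj₁; inj₂)
  open import Data.Sum.Relation.Binary.Pointwise using (inj₁; inj₂)
  open import Data.Vec.Properties using (lookup∘tabulate)
  open import Relation.Binary.PropositionalEquality using (_≡_; _≢_; refl; sym; trans; cong; subst)
  open import Relation.Nullary using (¬_; does; yes; no; contradiction)

  -- The interval (i , j] is a union of blocks of v.
  Closed : ∀ {n} → Labelling n → Fin n → Fin n → Set
  Closed v i j = ∀ a b → v a ≡ v b → i < a → a ≤ j → i < b × b ≤ j

  module _ {n} (π : NC n) where

    -- A point of (i , j] joined to a point outside it would cross the arc from i' to j'.
    Kr⇒Closed : ∀ {i j} → i < j → lab (Kr π) i ≡ lab (Kr π) j → Closed (lab π) i j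
    Kr⇒Closed {i} {j} i<j i~j a b a~b i<a a≤j = ℕ.≰⇒> left , ℕ.≮⇒≥ right
      where
      union : UnionNonCrossing π (Kr π)
      union = proj₁ (proj₂ (Kreweras.kreweras π))
      left : ¬ b ≤ i
      left b≤i with () ← union (inj₁ b) (inj₂ i) (inj₁ a) (inj₂ j) b≤i i<a a≤j (inj₁ (sym a~b)) (inj₂ i~j)
      right : ¬ j < b
      right j<b with () ← union (inj₂ i) (inj₁ a) (inj₂ j) (inj₁ b) i<a a≤j j<b (inj₂ i~j) (inj₁ a~b)

    module _ {i j : Fin n} (i<j : i < j) (closed : Closed (lab π) i j) where

      private
        pair : Labelling n
        pair k = if does (k ≟ j) then i else k

        pair-j : pair j ≡ i
        pair-j with j ≟ j
        ... | yes _  = refl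
        ... | no j≢j = contradiction refl j≢j

        i≢j : i ≢ j
        i≢j refl = ℕ.<-irrefl refl i<j

        pair-i : pair i ≡ i
        pair-i with i ≟ j
        ... | yes i≡j = contradiction i≡j i≢j
        ... | no _    = refl

        pair-part : IsPart pair
        pair-part k with k ≟ j
        ... | yes refl = ℕ.<⇒≤ i<j , pair-i
        ... | no k≢j with k ≟ j
        ...   | yes k≡j = contradiction k≡j k≢j
        ...   | no _    = ℕ.≤-refl , refl

        pair-< : ∀ {k l} → k < l → pair k ≡ pair l → k ≡ i × l ≡ j
        pair-< {k} {l} k<l e with k ≟ j | l ≟ j
        ... | yes refl | yes refl = contradiction k<l (ℕ.<-irrefl refl)
        ... | yes refl | no _     = contradiction (subst (_< k) e i<j) (ℕ.<-asym k<l)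
        ... | no _     | yes refl = e , refl
        ... | no _     | no _     = contradiction k<l (ℕ.<-irrefl (cong toℕ e))

        pair-nc : IsNC pair
        pair-nc k l m p k<l l<m m<p e f = contradiction
          (trans (proj₁ (pair-< (ℕ.<-trans k<l l<m) e)) (sym (proj₁ (pair-< (ℕ.<-trans l<m m<p) f))))
          (λ q → ℕ.<-irrefl (cong toℕ q) k<l)

        τ : NC n
        τ = tabulateNC pair pair-part pair-nc

        τ-pair : ∀ {k l} → k [ τ ]~ l → pair k ≡ pair l
        τ-pair {k} {l} e = trans (sym (lookup∘tabulate pair k)) (trans e (lookup∘tabulate pair l))

        union : UnionNonCrossing π τ
        union (inj₁ k) (inj₁ l) (inj₁ m) (inj₁ p) k<l l<m m<p (inj₁ e) (inj₁ f) = inj₁ (nonCrossing π k l m p k<l l<m m<p e f)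
        union (inj₂ k) (inj₂ l) (inj₂ m) (inj₂ p) k<l l<m m<p (inj₂ e) (inj₂ f) = inj₂ (nonCrossing τ k l m p k<l l<m m<p e f)
        union (inj₁ a) (inj₂ k) (inj₁ b) (inj₂ l) a≤k k<b b≤l (inj₁ e) (inj₂ f)
          with pair-< (ℕ.<-≤-trans k<b b≤l) (τ-pair f)
        ... | refl , refl = contradiction (proj₁ (closed b a (sym e) k<b b≤l)) (ℕ.≤⇒≯ a≤k)
        union (inj₂ k) (inj₁ a) (inj₂ l) (inj₁ b) k<a a≤l l<b (inj₂ f) (inj₁ e)
          with pair-< (ℕ.<-≤-trans k<a a≤l) (τ-pair f)
        ... | refl , refl = contradiction (proj₂ (closed a b e k<a a≤l)) (ℕ.<⇒≱ l<b)

      -- The only block of τ with more than one point is {i , j}; closedness makes its union with π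
      -- non-crossing, and maximality of `Kr π` then gives the join.
      Closed⇒Kr : lab (Kr π) i ≡ lab (Kr π) j
      Closed⇒Kr = proj₂ (proj₂ (Kreweras.kreweras π)) τ union i j
        (trans (lookup∘tabulate pair i) (trans (trans pair-i (sym pair-j)) (sym (lookup∘tabulate pair j))))

  -- Closed intervals describe all joins of the complement and, by `part-unique`, determine it. The
  -- recursion for nodes uses this description instead of maximality.
  record Complement {n} (π κ : NC n) : Set where
    field
      toClosed   : ∀ {i j} → i < j → lab κ i ≡ lab κ j → Closed (lab π) i j
      fromClosed : ∀ {i j} → i < j → Closed (lab π) i j → lab κ i ≡ lab κ j
  open Complement

  Kr-complement : ∀ {n} (π : NC n) → Complement π (Kr π)
  Kr-complement π = record { toClosed = Kr⇒Closed π ; fromClosed = Closed⇒Kr π }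

  lastBlock : ∀ {n} → Labelling n → Maybe (Fin n)
  lastBlock {zero}  v = nothing
  lastBlock {suc n} v = just (v (fromℕ n))

  ≤-last : ∀ {n} (i : Fin (suc n)) → i ≤ fromℕ n
  ≤-last {n} i = subst (toℕ i ℕ.≤_) (sym (toℕ-fromℕ n)) (toℕ≤pred[n] i)

  module KrNode {a b} {ρ ρ′ : NC a} {σ σ′ : NC b} (cρ : Complement ρ ρ′) (cσ : Complement σ σ′) where

    private
      module N = NodeGlue (lab ρ) (lab σ)
    open Glue (lab ρ′) (lastBlock (lab ρ′)) (lab σ′) nothing

    private
      N : Labelling (suc (a ℕ.+ b))
      N = N.glue

      N-gap⁺ : ∀ {i j} → lab ρ i ≡ lab ρ j → N (gap b i) ≡ N (gap b j)
      N-gap⁺ {i} {j} e = trans (N.glue-gap i) (trans (cong (gap b) e) (sym (N.glue-gap j)))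

      N-rest : ∀ {i j} → N (rest a i) ≡ N (rest a j) → lab σ i ≡ lab σ j
      N-rest {i} {j} e = N.restLabel-injective (trans (sym (N.glue-rest i)) (trans e (N.glue-rest j)))

      N-rest⁺ : ∀ {i j} → lab σ i ≡ lab σ j → N (rest a i) ≡ N (rest a j)
      N-rest⁺ {i} {j} e = trans (N.glue-rest i) (trans (cong N.restLabel e) (sym (N.glue-rest j)))

      N-from-gap : ∀ i j → N (gap b i) ≡ N j → ∃ λ k → j ≡ gap b k × lab ρ i ≡ lab ρ k
      N-from-gap i j e with N.glue≡gap j (trans (sym e) (N.glue-gap i))
      ... | k , refl , p = k , refl , sym p

      first-rest : ∀ (j : Fin b) → ∃ λ f → f ≤ j × N (rest a f) ≡ zero ×
                   (∀ k → is (firstPoint b) (lab σ k) ≡ true → lab σ f ≡ lab σ k)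
      first-rest j = go b σ j
        where
        go : ∀ b (σ : NC b) (j : Fin b) → ∃ λ f → f ≤ j × NodeGlue.glue (lab ρ) (lab σ) (rest a f) ≡ zero
             × (∀ k → is (firstPoint b) (lab σ k) ≡ true → lab σ f ≡ lab σ k)
        go (suc b) σ j = zero , z≤n , trans (sym (lab-node ρ σ (rest a zero))) (node-rest-zero ρ σ zero refl)
          , λ k e → trans (toℕ-injective {j = zero} (ℕ.n≤0⇒n≡0 (proj₁ (lab-part σ zero)))) (sym (is-first⇒zero {b} {lab σ k} e))

      is-last : ∀ k → is (lastBlock (lab ρ′)) (lab ρ′ k) ≡ true → ∀ l → k < l → (∀ (m : Fin a) → m ≤ l) → Closed (lab ρ) k l
      is-last = go cρ
        where
        go : ∀ {a} {ρ ρ′ : NC a} → Complement ρ ρ′ → ∀ k → is (lastBlock (lab ρ′)) (lab ρ′ k) ≡ true → ∀ l → k < l → (∀ (m : Fin a) → m ≤ l) → Closed (lab ρ) k l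
        go {suc a} {ρ} {ρ′} cρ k e l k<l top with is-true {m = just (lab ρ′ (fromℕ a))} e
        ... | q = toClosed cρ k<l (trans (sym (unjust q)) (cong (lab ρ′) (≤-antisym (top (fromℕ a)) (≤-last l))))
          where
          unjust : ∀ {i j : Fin (suc a)} → just i ≡ just j → i ≡ j
          unjust refl = refl

      last : ∀ {a} → Fin a → ∃ λ (l : Fin a) → (∀ (m : Fin a) → m ≤ l)
      last {suc a} _ = fromℕ a , ≤-last

      last-joined : ∀ k → (∀ l → (∀ (m : Fin a) → m ≤ l) → k < l → Closed (lab ρ) k l) → is (lastBlock (lab ρ′)) (lab ρ′ k) ≡ true
      last-joined = go cρ
        where
        go : ∀ {a} {ρ ρ′ : NC a} → Complement ρ ρ′ → ∀ k → (∀ l → (∀ (m : Fin a) → m ≤ l) → k < l → Closed (lab ρ) k l) → is (lastBlock (lab ρ′)) (lab ρ′ k) ≡ true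
        go {suc a} {ρ} {ρ′} cρ k closed with k ≟ fromℕ a
        ... | yes refl = is-just (lab ρ′ (fromℕ a))
        ... | no k≢l = subst (λ z → is (just (lab ρ′ (fromℕ a))) z ≡ true)
                (sym (fromClosed cρ k<l (closed (fromℕ a) ≤-last k<l))) (is-just (lab ρ′ (fromℕ a)))
          where
          k<l : k < fromℕ a
          k<l = ℕ.≤∧≢⇒< (≤-last k) (λ e → k≢l (toℕ-injective e))

    -- A closed interval cannot start at 0 or in the gap and end behind it, for it would contain the
    -- successor of 0 without 0. Within the gap, (0 , j] is closed exactly when the part of the gap
    -- after j is, which is the join with the last block.
    Closed⇒glue : ∀ {i j} → i < j → Closed N i j → glue i ≡ glue j
    Closed⇒glue {i} {j} i<j closed with view a b i | view a b j
    ... | origin | origin = refl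
    ... | origin | gapᵛ j = sym (trans (glue-gap j) (cong (λ c → if c then zero else gap b (lab ρ′ j))
            (last-joined j λ l top j<l m p m~p j<m m≤l → ℕ.≰⇒> (λ p≤j → ℕ.<⇒≱ j<m
              (gap-≤⁻¹ (proj₂ (closed (gap b p) (gap b m) (N-gap⁺ (sym m~p)) (s≤s z≤n) (gap-≤ p≤j))))) , top p)))
    ... | origin | restᵛ j with first-rest j
    ...   | f , f≤j , Nf , _ with () ← proj₁ (closed (rest a f) zero Nf (s≤s z≤n) (rest-≤ f≤j))
    Closed⇒glue {i} {j} i<j closed | gapᵛ i′ | gapᵛ j′ = trans (glue-gap i′) (trans (cong gapLabel
      (fromClosed cρ (gap-<⁻¹ i<j) λ m p m~p i<m m≤j → let q , r = closed (gap b m) (gap b p) (N-gap⁺ m~p) (gap-< i<m) (gap-≤ m≤j)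
        in gap-<⁻¹ q , gap-≤⁻¹ r)) (sym (glue-gap j′)))
    Closed⇒glue {i} {j} i<j closed | gapᵛ i′ | restᵛ j′ with first-rest j′
    ...   | f , f≤j , Nf , _ with () ← proj₁ (closed (rest a f) zero Nf (gap<rest i′ f) (rest-≤ f≤j))
    Closed⇒glue {i} {j} i<j closed | restᵛ i′ | gapᵛ j′ = contradiction i<j (ℕ.<-asym (gap<rest j′ i′))
    Closed⇒glue {i} {j} i<j closed | restᵛ i′ | restᵛ j′ = trans (glue-rest i′) (trans (cong restLabel
      (fromClosed cσ (rest-<⁻¹ i<j) λ m p m~p i<m m≤j → let q , r = closed (rest a m) (rest a p) (N-rest⁺ m~p) (rest-< i<m) (rest-≤ m≤j)
        in rest-<⁻¹ q , rest-≤⁻¹ r)) (sym (glue-rest j′)))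

    glue⇒Closed : ∀ {i j} → i < j → glue i ≡ glue j → Closed N i j
    glue⇒Closed {i} {j} i<j e with view a b i | view a b j
    ... | origin | restᵛ j = contradiction (trans e (glue-rest j)) λ ()
    ... | gapᵛ i | restᵛ j = ⊥-elim (gapLabel≡rest (trans (sym (glue-gap i)) (trans e (glue-rest j))))
    ... | restᵛ i | gapᵛ j = contradiction i<j (ℕ.<-asym (gap<rest j i))
    ... | origin | gapᵛ j = closed
      where
      joined : is (lastBlock (lab ρ′)) (lab ρ′ j) ≡ true
      joined = gapLabel≡zero (trans (sym (glue-gap j)) (sym e))
      closed : Closed N zero (gap b j)
      closed m p m~p 0<m m≤j with view a b m
      ... | restᵛ m = contradiction m≤j (ℕ.<⇒≱ (gap<rest j m))
      ... | gapᵛ m with N-from-gap m p m~p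
      ...   | p , refl , q = s≤s z≤n , gap-≤ (ℕ.≮⇒≥ λ j<p → let l , top = last j in
              ℕ.≤⇒≯ (gap-≤⁻¹ m≤j) (proj₁ (is-last j joined l (ℕ.<-≤-trans j<p (top p)) top p m (sym q) j<p (top p))))
    ... | gapᵛ i | gapᵛ j = closed
      where
      closed : Closed N (gap b i) (gap b j)
      closed m p m~p i<m m≤j with view a b m
      ... | restᵛ m = contradiction m≤j (ℕ.<⇒≱ (gap<rest j m))
      ... | gapᵛ m with N-from-gap m p m~p
      ...   | p , refl , q = let r , s = toClosed cρ (gap-<⁻¹ i<j) (gapLabel-injective (trans (sym (glue-gap i)) (trans e (glue-gap j))))
                                           m p q (gap-<⁻¹ i<m) (gap-≤⁻¹ m≤j) in gap-< r , gap-≤ s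
    ... | restᵛ i | restᵛ j = closed
      where
      inner-closed : Closed (lab σ) i j
      inner-closed = toClosed cσ (rest-<⁻¹ i<j) (restLabel-injective (trans (sym (glue-rest i)) (trans e (glue-rest j))))
      closed : Closed N (rest a i) (rest a j)
      closed m p m~p i<m m≤j with view a b m | view a b p
      ... | gapᵛ m  | _ = contradiction i<m (ℕ.<-asym (gap<rest m i))
      ... | restᵛ m | gapᵛ p = ⊥-elim (N.restLabel≡gap (trans (sym (N.glue-rest m)) (trans m~p (N.glue-gap p))))
      ... | restᵛ m | restᵛ p = let r , s = inner-closed m p (N-rest m~p) (rest-<⁻¹ i<m) (rest-≤⁻¹ m≤j) in rest-< r , rest-≤ s
      -- If m is in the block of 0, it is in that of the first remaining point f, and f ≤ i lies
      -- outside (i , j].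
      ... | restᵛ m | origin with first-rest i
      ...   | f , f≤i , _ , first = contradiction
                (proj₁ (inner-closed m f (sym (first m (N.restLabel≡zero (trans (sym (N.glue-rest m)) m~p)))) (rest-<⁻¹ i<m) (rest-≤⁻¹ m≤j)))
                (ℕ.≤⇒≯ f≤i)

    lab-complement : ∀ {κ} → Complement (node ρ σ) κ → ∀ i → lab κ i ≡ glue i
    lab-complement {κ} c = part-unique (lab-part κ) (glue-part (lab-part ρ′) (lab-part σ′)) to from
      where
      node-closed : ∀ {i j} → Closed (lab (node ρ σ)) i j → Closed N i j
      node-closed c m p e = c m p (trans (lab-node ρ σ m) (trans e (sym (lab-node ρ σ p))))
      closed-node : ∀ {i j} → Closed N i j → Closed (lab (node ρ σ)) i j
      closed-node c m p e = c m p (trans (sym (lab-node ρ σ m)) (trans e (lab-node ρ σ p)))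
      to : ∀ i j → lab κ i ≡ lab κ j → glue i ≡ glue j
      to i j e with <-cmp i j
      ... | tri< i<j _ _  = Closed⇒glue i<j (node-closed (toClosed c i<j e))
      ... | tri≈ _ refl _ = refl
      ... | tri> _ _ j<i  = sym (Closed⇒glue j<i (node-closed (toClosed c j<i (sym e))))
      from : ∀ i j → glue i ≡ glue j → lab κ i ≡ lab κ j
      from i j e with <-cmp i j
      ... | tri< i<j _ _  = fromClosed c i<j (closed-node (glue⇒Closed i<j e))
      ... | tri≈ _ refl _ = refl
      ... | tri> _ _ j<i  = sym (fromClosed c j<i (closed-node (glue⇒Closed j<i (sym e))))

  abstract

    -- Abstract, so that later computations see the recursion `krLab-node` and not the search
    -- defining `Kr`.
    krLab : ∀ {n} → NC n → Labelling n
    krLab π = lab (Kr π)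

    krLab-Kr : ∀ {n} (π : NC n) i → krLab π i ≡ lab (Kr π) i
    krLab-Kr π i = refl

    krLab-part : ∀ {n} (π : NC n) → IsPart (krLab π)
    krLab-part π = lab-part (Kr π)

    krLab-node : ∀ {a b} (ρ : NC a) (σ : NC b) i →
      krLab (node ρ σ) i ≡ Glue.glue (krLab ρ) (lastBlock (krLab ρ)) (krLab σ) nothing i
    krLab-node ρ σ = KrNode.lab-complement (Kr-complement ρ) (Kr-complement σ) (Kr-complement (node ρ σ))

-- Products over blocks under the decomposition.

module BlockProducts where

  open Nodes
  open KrewerasOfNodes
  open import Data.Bool.Base using (Bool; true; false; if_then_else_; not; _∧_)
  open import Data.Bool.Properties using (∧-identityʳ)
  open import Data.Fin.Base using (Fin; zero; suc; _↑ˡ_; _↑ʳ_; _<_)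
  open import Data.Fin.Properties using (_≟_; _<?_; any?; toℕ-injective)
  open import Data.List.Base as List using (List; []; _∷_; _++_)
  open import Data.List.Properties using (++-identityʳ)
  open import Relation.Binary.PropositionalEquality as ≡ using (_≡_; cong; cong₂)
  open import Relation.Nullary using (Dec; does; yes; no; _×-dec_; contradiction)
  open import Relation.Nullary.Decidable using (dec-true; dec-false)

  does-iff : ∀ {p q} {P : Set p} {Q : Set q} (P? : Dec P) (Q? : Dec Q) → (P → Q) → (Q → P) → does P? ≡ does Q?
  does-iff (yes p) Q? f g = ≡.sym (dec-true Q? (f p))
  does-iff (no ¬p) Q? f g = ≡.sym (dec-false Q? (λ q → ¬p (g q)))

  select : ∀ {l n} {L : Set l} → (Fin n → Bool) → (Fin n → L) → List L
  select {n = zero}  p x = []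
  select {n = suc n} p x = if p zero then x zero ∷ select (p ∘ suc) (x ∘ suc) else select (p ∘ suc) (x ∘ suc)

  module _ {l} {L : Set l} where

    select-cong : ∀ {n} {p q : Fin n → Bool} (x : Fin n → L) → (∀ i → p i ≡ q i) → select p x ≡ select q x
    select-cong {zero}  x e = ≡.refl
    select-cong {suc n} {p} {q} x e rewrite e zero | select-cong {n} {p ∘ suc} {q ∘ suc} (x ∘ suc) (e ∘ suc) = ≡.refl

    select-none : ∀ {n} {p : Fin n → Bool} (x : Fin n → L) → (∀ i → p i ≡ false) → select p x ≡ []
    select-none {zero}  x e = ≡.refl
    select-none {suc n} x e rewrite e zero = select-none (x ∘ suc) (e ∘ suc)

    select-++ : ∀ a {b} (p : Fin (a ℕ.+ b) → Bool) (x : Fin (a ℕ.+ b) → L) →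
      select p x ≡ select (p ∘ (_↑ˡ b)) (x ∘ (_↑ˡ b)) ++ select (p ∘ (a ↑ʳ_)) (x ∘ (a ↑ʳ_))
    select-++ zero    p x = ≡.refl
    select-++ (suc a) p x with p zero
    ... | true  = cong (x zero ∷_) (select-++ a (p ∘ suc) (x ∘ suc))
    ... | false = select-++ a (p ∘ suc) (x ∘ suc)

    blockOf : ∀ {n} → Labelling n → (Fin n → L) → Maybe (Fin n) → List L
    blockOf v x m = select (λ j → is m (v j)) x

    blockOf-cong : ∀ {n} {v w : Labelling n} (x : Fin n → L) m → (∀ i → v i ≡ w i) → blockOf v x m ≡ blockOf w x m
    blockOf-cong x m e = select-cong x (λ i → cong (is m) (e i))

    blockOf-nothing : ∀ {n} (v : Labelling n) (x : Fin n → L) → blockOf v x nothing ≡ []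
    blockOf-nothing v x = select-none x (λ _ → ≡.refl)

    blockOf-first : ∀ {n} (v : Labelling (suc n)) (x : Fin (suc n) → L) → v zero ≡ zero →
      ∃ λ w → blockOf v x (just zero) ≡ x zero ∷ w
    blockOf-first v x e rewrite e = _ , ≡.refl

    module GlueBlocks {a b} (v : Labelling a) (mp : Maybe (Fin a)) (w : Labelling b) (mq : Maybe (Fin b))
      (x : Fin (suc (a ℕ.+ b)) → L) where

      open Glue v mp w mq

      block-origin : blockOf glue x (just zero) ≡ x zero ∷ (blockOf v (x ∘ gap b) mp ++ blockOf w (x ∘ rest a) mq)
      block-origin = cong (x zero ∷_) (≡.trans (select-++ a _ (x ∘ suc))
        (≡.cong₂ _++_ (select-cong (x ∘ gap b) inGap) (select-cong (x ∘ rest a) inRest)))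
        where
        inGap : ∀ i → is (just zero) (glue (gap b i)) ≡ is mp (v i)
        inGap i rewrite glue-gap i with is mp (v i)
        ... | true  = ≡.refl
        ... | false = ≡.refl
        inRest : ∀ i → is (just zero) (glue (rest a i)) ≡ is mq (w i)
        inRest i rewrite glue-rest i with is mq (w i)
        ... | true  = ≡.refl
        ... | false = ≡.refl

      block-gap : ∀ k → is mp k ≡ false → blockOf glue x (just (gap b k)) ≡ blockOf v (x ∘ gap b) (just k)
      block-gap k unjoined = ≡.trans (select-++ a _ (x ∘ suc)) (≡.trans
        (≡.cong₂ _++_ (select-cong (x ∘ gap b) inGap) (select-none (x ∘ rest a) inRest)) (++-identityʳ _))
        where
        inGap : ∀ i → is (just (gap b k)) (glue (gap b i)) ≡ is (just k) (v i)
        inGap i = does-iff (gap b k ≟ glue (gap b i)) (k ≟ v i)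
          (λ e → ≡.sym (gapLabel≡gap (≡.trans (≡.sym (glue-gap i)) (≡.sym e))))
          (λ { ≡.refl → ≡.sym (≡.trans (glue-gap i) (cong (λ c → if c then zero else gap b k) unjoined)) })
        inRest : ∀ i → is (just (gap b k)) (glue (rest a i)) ≡ false
        inRest i = dec-false (gap b k ≟ glue (rest a i)) (λ e → restLabel≡gap (≡.trans (≡.sym (glue-rest i)) (≡.sym e)))

      block-rest : ∀ k → is mq k ≡ false → blockOf glue x (just (rest a k)) ≡ blockOf w (x ∘ rest a) (just k)
      block-rest k unjoined = ≡.trans (select-++ a _ (x ∘ suc))
        (≡.cong₂ _++_ (select-none (x ∘ gap b) inGap) (select-cong (x ∘ rest a) inRest))
        where
        inGap : ∀ i → is (just (rest a k)) (glue (gap b i)) ≡ false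
        inGap i = dec-false (rest a k ≟ glue (gap b i)) (λ e → gapLabel≡rest (≡.trans (≡.sym (glue-gap i)) (≡.sym e)))
        inRest : ∀ i → is (just (rest a k)) (glue (rest a i)) ≡ is (just k) (w i)
        inRest i = does-iff (rest a k ≟ glue (rest a i)) (k ≟ w i)
          (λ e → ≡.sym (restLabel≡rest (≡.trans (≡.sym (glue-rest i)) (≡.sym e))))
          (λ { ≡.refl → ≡.sym (≡.trans (glue-rest i) (cong (λ c → if c then zero else rest a k) unjoined)) })

  -- k lies strictly between two points of one block; by non-crossing this means
  -- that the block with least element k is inner.
  Covered : ∀ {n} → Labelling n → Fin n → Set
  Covered v k = ∃₂ λ i j → i < k × k < j × v i ≡ v j

  covered? : ∀ {n} (v : Labelling n) k → Dec (Covered v k)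
  covered? v k = any? λ i → any? λ j → (i <? k) ×-dec ((k <? j) ×-dec (v i ≟ v j))

  covered : ∀ {n} → Labelling n → Fin n → Bool
  covered v k = does (covered? v k)

  covered-cong : ∀ {n} {v w : Labelling n} → (∀ i → v i ≡ w i) → ∀ k → covered v k ≡ covered w k
  covered-cong {v = v} {w} e k = does-iff (covered? v k) (covered? w k)
    (λ (i , j , p , q , r) → i , j , p , q , ≡.trans (≡.sym (e i)) (≡.trans r (e j)))
    (λ (i , j , p , q , r) → i , j , p , q , ≡.trans (e i) (≡.trans r (≡.sym (e j))))

  covered-zero : ∀ {n} (v : Labelling (suc n)) → covered v zero ≡ false
  covered-zero v = dec-false (covered? v zero) (λ { (_ , _ , () , _) })

  module NodeCovered {a b} (v : Labelling a) (w : Labelling b) where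

    open NodeGlue v w

    -- Without remaining points 0 is a singleton and covers nothing.
    covered-gap₀ : b ≡ 0 → ∀ k → covered glue (gap b k) ≡ covered v k
    covered-gap₀ ≡.refl k = does-iff (covered? glue (gap 0 k)) (covered? v k) to
      (λ (i , j , p , q , r) → gap 0 i , gap 0 j , gap-< p , gap-< q ,
        ≡.trans (glue-gap i) (≡.trans (cong (gap 0) r) (≡.sym (glue-gap j))))
      where
      to : Covered glue (gap 0 k) → Covered v k
      to (i , j , p , q , r) with view a 0 j
      to (i , .zero , p , () , r) | origin
      ... | gapᵛ j with glue≡gap i (≡.trans r (glue-gap j))
      ...   | i , ≡.refl , e = i , j , gap-<⁻¹ p , gap-<⁻¹ q , e

    -- The point 0 and its successor, the first remaining point, enclose the whole gap.
    covered-gap₊ : ∀ j → firstPoint b ≡ just j → w j ≡ j → ∀ k → covered glue (gap b k) ≡ true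
    covered-gap₊ j e wj k = dec-true (covered? glue (gap b k)) (zero , rest a j , s≤s z≤n , gap<rest k j ,
      ≡.sym (≡.trans (glue-rest j) (cong (λ c → if c then zero else rest a (w j))
        (≡.trans (cong (is (firstPoint b)) wj) (≡.trans (cong (λ m → is m j) e) (is-just j))))))

    -- A pair that uses 0 is replaced by one that starts at the first remaining point, which lies in
    -- the same block and, k being a different point, still before k.
    covered-rest : IsPart w → ∀ k → is (firstPoint b) k ≡ false → covered glue (rest a k) ≡ covered w k
    covered-rest pw k unjoined = does-iff (covered? glue (rest a k)) (covered? w k) to
      (λ (i , j , p , q , r) → rest a i , rest a j , rest-< p , rest-< q ,
        ≡.trans (glue-rest i) (≡.trans (cong restLabel r) (≡.sym (glue-rest j))))
      where
      first : ∀ {b} (w : Labelling b) → IsPart w → ∀ k → is (firstPoint b) k ≡ false → ∀ j → is (firstPoint b) (w j) ≡ true →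
        ∃ λ i → i < k × w i ≡ w j
      first {suc b} w pw (suc k) _ j e = zero , s≤s z≤n ,
        ≡.trans (toℕ-injective {j = zero} (ℕ.n≤0⇒n≡0 (proj₁ (pw zero)))) (≡.sym (is-first⇒zero {b} {w j} e))
      to : Covered glue (rest a k) → Covered w k
      to (i , j , p , q , r) with view a b i | view a b j
      ... | _ | gapᵛ j = contradiction q (ℕ.<-asym (gap<rest j k))
      to (i , .zero , p , () , r) | _ | origin
      ... | gapᵛ i | restᵛ j = ⊥-elim (restLabel≡gap (≡.sym (≡.trans (≡.sym (glue-gap i)) (≡.trans r (glue-rest j)))))
      ... | restᵛ i | restᵛ j = i , j , rest-<⁻¹ p , rest-<⁻¹ q ,
              restLabel-injective (≡.trans (≡.sym (glue-rest i)) (≡.trans r (glue-rest j)))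
      ... | origin | restᵛ j with first w pw k unjoined j (restLabel≡zero (≡.sym (≡.trans r (glue-rest j))))
      ...   | i , i<k , e = i , j , i<k , rest-<⁻¹ q , e

  module Weights {c ℓ} (K : CommutativeRing c ℓ) where

    open CommutativeRing K hiding (zero)
    open import Algebra.Properties.CommutativeSemigroup *-commutativeSemigroup using (x∙yz≈y∙xz)
    open import Relation.Binary.Reasoning.Setoid setoid

    ∏ : ∀ {n} → (Fin n → Carrier) → Carrier
    ∏ {zero}  h = 1#
    ∏ {suc n} h = h zero * ∏ (h ∘ suc)

    ∏-cong : ∀ {n} {g h : Fin n → Carrier} → (∀ i → g i ≈ h i) → ∏ g ≈ ∏ h
    ∏-cong {zero}  e = refl
    ∏-cong {suc n} e = *-cong (e zero) (∏-cong (e ∘ suc))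

    ∏-split : ∀ a {b} (h : Fin (a ℕ.+ b) → Carrier) → ∏ h ≈ ∏ (h ∘ (_↑ˡ b)) * ∏ (h ∘ (a ↑ʳ_))
    ∏-split zero    h = sym (*-identityˡ _)
    ∏-split (suc a) h = trans (*-congˡ (∏-split a (h ∘ suc))) (sym (*-assoc _ _ _))

    when : Bool → Carrier → Carrier
    when p k = if p then k else 1#

    when-cong : ∀ {p q k k′} → p ≡ q → (q ≡ true → k ≈ k′) → when p k ≈ when q k′
    when-cong {true}  ≡.refl e = e ≡.refl
    when-cong {false} ≡.refl e = refl

    ∏-pull : ∀ {n} (m : Fin n) h → ∏ h ≈ h m * ∏ (λ k → when (not (is (just m) k)) (h k))
    ∏-pull {suc n} zero h = *-congˡ (sym (trans (*-identityˡ _) (∏-cong {g = λ k → when true (h (suc k))} λ _ → refl)))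
    ∏-pull (suc m) h = trans (*-congˡ (∏-pull m (h ∘ suc))) (x∙yz≈y∙xz _ _ _)

    abstract

      -- Blocks are represented by their least elements; m is left out.
      others : ∀ {n} → Labelling n → Maybe (Fin n) → (Fin n → Carrier) → Carrier
      others v m W = ∏ λ k → when (does (v k ≟ k) ∧ not (is m k)) (W k)

      others-cong : ∀ {n} {v w : Labelling n} {m W W′} → (∀ i → v i ≡ w i) →
        (∀ k → is m k ≡ false → W k ≈ W′ k) → others v m W ≈ others w m W′
      others-cong {v = v} {w} {m} e f = ∏-cong λ k → when-cong (cong (λ i → does (i ≟ k) ∧ not (is m k)) (e k))
        (λ r → f k (unmarked (does (w k ≟ k)) (is m k) r))
        where
        unmarked : ∀ p q → p ∧ not q ≡ true → q ≡ false
        unmarked true false _ = ≡.refl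

      others-pull : ∀ {n} {v : Labelling n} {m W} → v m ≡ m → others v nothing W ≈ W m * others v (just m) W
      others-pull {v = v} {m} {W} e = begin
        others v nothing W
          ≈⟨ ∏-pull m _ ⟩
        when (does (v m ≟ m) ∧ true) (W m) * ∏ (λ k → when (not (is (just m) k)) (when (does (v k ≟ k) ∧ true) (W k)))
          ≈⟨ *-cong (when-cong {q = true} (≡.trans (∧-identityʳ _) (dec-true (v m ≟ m) e)) (λ _ → refl))
               (∏-cong λ k → merge (does (v k ≟ k)) (is (just m) k) (W k)) ⟩
        W m * others v (just m) W ∎
        where
        merge : ∀ p q k → when (not q) (when (p ∧ true) k) ≈ when (p ∧ not q) k
        merge true  true  k = refl
        merge true  false k = refl
        merge false true  k = refl
        merge false false k = refl

      others-nothing : ∀ {n} (v : Labelling n) W → others v nothing W ≈ ∏ (λ k → when (does (v k ≟ k)) (W k))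
      others-nothing v W = ∏-cong λ k → when-cong {k = W k} (∧-identityʳ _) (λ _ → refl)

      others-empty : ∀ (v : Labelling 0) m W → others v m W ≈ 1#
      others-empty v m W = refl

    module _ {l} {L : Set l} where

      abstract

        -- One block is kept apart with its own functional H, so that its letters can be stripped
        -- off one at a time while the other blocks keep their weights.
        pointed : ∀ {n} → (List L → Carrier) → (Fin n → Carrier) → Labelling n → Maybe (Fin n) → (Fin n → L) → Carrier
        pointed H W v m x = H (blockOf v x m) * others v m W

        pointed-cong : ∀ {n} {H W W′} {v w : Labelling n} {m x} → (∀ i → v i ≡ w i) →
          (∀ k → is m k ≡ false → W k ≈ W′ k) → pointed H W v m x ≈ pointed H W′ w m x
        pointed-cong {H = H} {m = m} {x} e f =
          *-cong (reflexive (cong H (blockOf-cong x m e))) (others-cong {m = m} e f)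

        pointed-all : ∀ {n} {H W} {v : Labelling n} {m x} → (∀ i → m ≡ just i → v i ≡ i) →
          H [] ≈ 1# → (∀ i → m ≡ just i → H (blockOf v x m) ≈ W i) → pointed H W v m x ≈ others v nothing W
        pointed-all {H = H} {W} {v} {nothing} {x} rep H1 e =
          trans (*-congʳ (trans (reflexive (cong H (blockOf-nothing v x))) H1)) (*-identityˡ _)
        pointed-all {W = W} {v} {just i} rep H1 e = trans (*-congʳ (e i ≡.refl)) (sym (others-pull {v = v} {W = W} (rep i ≡.refl)))

        pointed-empty : ∀ {H W} (v : Labelling 0) m x → pointed H W v m x ≈ H []
        pointed-empty {H} {W} v m x = trans (*-congˡ (others-empty v m W)) (*-identityʳ _)

    module GlueWeights {a b} (v : Labelling a) (mp : Maybe (Fin a)) (w : Labelling b) (mq : Maybe (Fin b)) where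

      open Glue v mp w mq

      private
        rep-gap : ∀ k → does (glue (gap b k) ≟ gap b k) ≡ does (v k ≟ k) ∧ not (is mp k)
        rep-gap k with v k ≟ k
        ... | yes e = ≡.trans (cong (λ z → does (z ≟ gap b k)) (≡.trans (glue-gap k) (cong gapLabel e))) self
          where
          self : does (gapLabel k ≟ gap b k) ≡ not (is mp k)
          self with is mp k
          ... | true  = ≡.refl
          ... | false = dec-true (gap b k ≟ gap b k) ≡.refl
        ... | no ¬e = dec-false (glue (gap b k) ≟ gap b k) (λ q → ¬e (gapLabel≡gap (≡.trans (≡.sym (glue-gap k)) q)))

        rep-rest : ∀ k → does (glue (rest a k) ≟ rest a k) ≡ does (w k ≟ k) ∧ not (is mq k)
        rep-rest k with w k ≟ k
        ... | yes e = ≡.trans (cong (λ z → does (z ≟ rest a k)) (≡.trans (glue-rest k) (cong restLabel e))) self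
          where
          self : does (restLabel k ≟ rest a k) ≡ not (is mq k)
          self with is mq k
          ... | true  = ≡.refl
          ... | false = dec-true (rest a k ≟ rest a k) ≡.refl
        ... | no ¬e = dec-false (glue (rest a k) ≟ rest a k) (λ q → ¬e (restLabel≡rest (≡.trans (≡.sym (glue-rest k)) q)))

      abstract

        others-origin : ∀ W → others glue (just zero) W ≈ others v mp (W ∘ gap b) * others w mq (W ∘ rest a)
        others-origin W = trans (*-identityˡ _) (trans (∏-split a _) (*-cong
          (∏-cong λ k → when-cong (≡.trans (∧-identityʳ _) (rep-gap k)) (λ _ → refl))
          (∏-cong λ k → when-cong (≡.trans (∧-identityʳ _) (rep-rest k)) (λ _ → refl))))

        others-rest : ∀ m W → mq ≡ nothing →
          others glue (just (rest a m)) W ≈ W zero * (others v mp (W ∘ gap b) * others w (just m) (W ∘ rest a))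
        others-rest m W mq≡ = *-congˡ (trans (∏-split a _) (*-cong
          (∏-cong λ k → when-cong (≡.trans (cong (λ c → does (glue (gap b k) ≟ gap b k) ∧ not c)
            (dec-false (rest a m ≟ gap b k) (λ e → gap≢rest (≡.sym e)))) (≡.trans (∧-identityʳ _) (rep-gap k))) (λ _ → refl))
          (∏-cong λ k → when-cong (≡.cong₂ (λ p q → p ∧ not q)
            (≡.trans (rep-rest k) (≡.trans (cong (λ m → does (w k ≟ k) ∧ not (is m k)) mq≡) (∧-identityʳ _)))
            (does-iff (rest a m ≟ rest a k) (m ≟ k) rest-injective (cong (rest a)))) (λ _ → refl))))

    module NodeWeights {l} {L : Set l} {a b} (v : Labelling a) (w : Labelling b) (x : Fin (suc (a ℕ.+ b)) → L) where

      open NodeGlue v w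
      open GlueBlocks v nothing w (firstPoint b) x
      open GlueWeights v nothing w (firstPoint b)

      abstract

        pointed-node : ∀ H W → pointed H W glue (just zero) x ≈
          others v nothing (W ∘ gap b) * pointed (λ u → H (x zero ∷ u)) (W ∘ rest a) w (firstPoint b) (x ∘ rest a)
        pointed-node H W = begin
          H (blockOf glue x (just zero)) * others glue (just zero) W
            ≈⟨ *-cong (reflexive (cong H (≡.trans block-origin
                 (cong (λ u → x zero ∷ (u ++ blockOf w (x ∘ rest a) (firstPoint b))) (blockOf-nothing v (x ∘ gap b))))))
                 (others-origin W) ⟩
          H (x zero ∷ blockOf w (x ∘ rest a) (firstPoint b)) *
            (others v nothing (W ∘ gap b) * others w (firstPoint b) (W ∘ rest a))
            ≈⟨ x∙yz≈y∙xz _ _ _ ⟩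
          others v nothing (W ∘ gap b) * pointed (λ u → H (x zero ∷ u)) (W ∘ rest a) w (firstPoint b) (x ∘ rest a) ∎

    module DualWeights {l} {L : Set l} {a b} (v : Labelling a) (mp : Maybe (Fin a)) (w : Labelling b)
      (x : Fin (suc (a ℕ.+ b)) → L) where

      open Glue v mp w nothing
      open GlueBlocks v mp w nothing x
      open GlueWeights v mp w nothing

      private
        origin-block : blockOf glue x (just zero) ≡ x zero ∷ blockOf v (x ∘ gap b) mp
        origin-block = ≡.trans block-origin (cong (x zero ∷_) (≡.trans
          (cong (blockOf v (x ∘ gap b) mp ++_) (blockOf-nothing w (x ∘ rest a))) (++-identityʳ _)))

      abstract

        -- Here the marked block is that of 0, so H loses the letter x zero and then marks the block
        -- `mp` of the gap.
        pointed-dual₀ : ∀ H W → pointed H W glue (just zero) x ≈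
          pointed (λ u → H (x zero ∷ u)) (W ∘ gap b) v mp (x ∘ gap b) * others w nothing (W ∘ rest a)
        pointed-dual₀ H W = trans (*-cong (reflexive (cong H origin-block)) (others-origin W)) (sym (*-assoc _ _ _))

        -- The marked block lies behind the gap, so the block of 0 counts among the others with
        -- weight D. It consists of 0 and the block `mp`; with the letter of 0 stripped, D becomes
        -- the functional that marks `mp` in the gap.
        pointed-dual₊ : ∀ H (D : List L → Carrier) W m → W zero ≈ D (blockOf glue x (just zero)) →
          pointed H W glue (just (rest a m)) x ≈
          pointed (λ u → D (x zero ∷ u)) (W ∘ gap b) v mp (x ∘ gap b) * pointed H (W ∘ rest a) w (just m) (x ∘ rest a)
        pointed-dual₊ H D W m W0 = begin
          H (blockOf glue x (just (rest a m))) * others glue (just (rest a m)) W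
            ≈⟨ *-cong (reflexive (cong H (block-rest m ≡.refl))) (others-rest m W ≡.refl) ⟩
          H (blockOf w (x ∘ rest a) (just m)) * (W zero * (others v mp (W ∘ gap b) * others w (just m) (W ∘ rest a)))
            ≈⟨ *-congˡ (*-congʳ (trans W0 (reflexive (cong D origin-block)))) ⟩
          H (blockOf w (x ∘ rest a) (just m)) *
            (D (x zero ∷ blockOf v (x ∘ gap b) mp) * (others v mp (W ∘ gap b) * others w (just m) (W ∘ rest a)))
            ≈⟨ trans (*-congˡ (sym (*-assoc _ _ _))) (x∙yz≈y∙xz _ _ _) ⟩
          pointed (λ u → D (x zero ∷ u)) (W ∘ gap b) v mp (x ∘ gap b) * pointed H (W ∘ rest a) w (just m) (x ∘ rest a) ∎

-- Sums over non-crossing partitions as coefficients of series.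

module Recursions where

  open import Defs using (module FreeProbability; NC)
  open FormalSeries
  open Substitutions
  open CumulantSeries
  open Nodes
  open Enumeration
  open KrewerasOfNodes
  open BlockProducts
  open import Data.Bool.Base using (if_then_else_)
  open import Data.Fin.Base using (Fin; zero; suc; _↑ˡ_; _↑ʳ_; fromℕ)
  open import Data.Fin.Properties using (toℕ-injective; toℕ-fromℕ; toℕ-↑ˡ; toℕ-↑ʳ)
  open import Data.List.Base as List using (List; []; _∷_; tabulate)
  open import Relation.Binary.PropositionalEquality as ≡ using (_≡_; cong)

  takeᶠ : ∀ {l} {L : Set l} a b {n} → a ℕ.+ b ≡ n → (Fin n → L) → Fin a → L
  takeᶠ a b ≡.refl x i = x (i ↑ˡ b)

  dropᶠ : ∀ {l} {L : Set l} a b {n} → a ℕ.+ b ≡ n → (Fin n → L) → Fin b → L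
  dropᶠ a b ≡.refl x i = x (a ↑ʳ i)

  first-rep : ∀ {n} {v : Labelling n} → IsPart v → ∀ i → firstPoint n ≡ just i → v i ≡ i
  first-rep {suc n} pv .zero ≡.refl = toℕ-injective (ℕ.n≤0⇒n≡0 (proj₁ (pv zero)))

  last-rep : ∀ {n} {v : Labelling n} → IsPart v → ∀ i → lastBlock v ≡ just i → v i ≡ i
  last-rep {suc n} pv _ ≡.refl = proj₂ (pv (fromℕ n))

  module Recursion {c ℓ l} (K : CommutativeRing c ℓ) (L : Set l) where

    private module K = CommutativeRing K
    open K using (_≈_; _+_; _*_; 0#; 1#; trans; sym; refl; +-cong; *-cong; +-congˡ; *-congˡ; +-congʳ; *-congʳ; reflexive)
    open FreeProbability K using (sumNC)
    open Sums K
    open Weights K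
    open Substitution K L L hiding (const-cong)
    open ShiftLetter K L

    ⊛-cuts : ∀ f g {n} (x : Fin n → L) →
      (f ⊛ g) (tabulate x) ≈ sum (cuts n) (λ (a , b , e) → f (tabulate (takeᶠ a b e x)) * g (tabulate (dropᶠ a b e x)))
    ⊛-cuts f g {zero}  x = sym (K.+-identityʳ _)
    ⊛-cuts f g {suc n} x = +-congˡ (trans (⊛-cuts (∂ (x zero) f) g (x ∘ suc)) (trans
      (sum-cong (λ { (a , b , ≡.refl) → refl }) (cuts n))
      (reflexive (≡.sym (sum-map (λ (a , b , e) → f (tabulate (takeᶠ a b e x)) * g (tabulate (dropᶠ a b e x))) shiftCut (cuts n))))))

    -- The first letter of Int N H ⊛ R either ends the block of H or is followed
    -- by a gap and a further letter of H.
    first-letter : ∀ N H R x w → (Int N H ⊛ R) (x ∷ w) ≈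
      (R ⊛ const (H (x ∷ [])) ⊕ N ⊛ (Int N (∂ x H) ⊛ R)) w
    first-letter N H R x w = begin
      (Int N H ⊛ R) (x ∷ w)
        ≈⟨ ∂-⊛ x (Int N H) R refl w ⟩
      (Sub N (∂ x H) ⊛ R) w
        ≈⟨ ⊛-cong {g = R} (Sub-eq (shift-raises N) (∂ x H)) 𝓦.refl w ⟩
      ((const (H (x ∷ [])) ⊕ N ⊛ Int N (∂ x H)) ⊛ R) w
        ≈⟨ ⊛-distribʳ R (const (H (x ∷ []))) (N ⊛ Int N (∂ x H)) w ⟩
      (const (H (x ∷ [])) ⊛ R) w + (N ⊛ Int N (∂ x H) ⊛ R) w
        -- The constant is commuted to the right of R: it then belongs to the cut with an empty
        -- rest, the one where 0 ends its block.
        ≈⟨ +-cong (trans (const-⊛ _ R w) (trans (K.*-comm _ _) (sym (⊛-const R _ w)))) (⊛-assoc N (Int N (∂ x H)) R w) ⟩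
      (R ⊛ const (H (x ∷ [])) ⊕ N ⊛ (Int N (∂ x H) ⊛ R)) w ∎
      where open SetoidReasoning K.setoid

    sum-first-letter : ∀ N H R {n} (x : Fin (suc n) → L) (P Q : Cut n → K.Carrier) →
      (∀ a b (e : a ℕ.+ b ≡ n) → P (a , b , e) * Q (a , b , e) ≈
        R (tabulate (takeᶠ a b e (x ∘ suc))) * const (H (x zero ∷ [])) (tabulate (dropᶠ a b e (x ∘ suc))) +
        N (tabulate (takeᶠ a b e (x ∘ suc))) * (Int N (∂ (x zero) H) ⊛ R) (tabulate (dropᶠ a b e (x ∘ suc)))) →
      sum (cuts n) (λ c → P c * Q c) ≈ (Int N H ⊛ R) (tabulate x)
    sum-first-letter N H R {n} x P Q e = trans (sum-cong (λ (a , b , p) → e a b p) (cuts n)) (trans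
      (sum-+ _ _ (cuts n)) (trans
      (+-cong (sym (⊛-cuts R (const (H (x zero ∷ []))) (x ∘ suc))) (sym (⊛-cuts N (Int N (∂ (x zero) H) ⊛ R) (x ∘ suc))))
      (sym (first-letter N H R (x zero) (tabulate (x ∘ suc))))))

    left-≤ : ∀ a b {n m} → a ℕ.+ b ≡ n → n ℕ.≤ m → a ℕ.≤ m
    left-≤ a b ≡.refl p = ℕ.≤-trans (ℕ.m≤m+n a b) p

    right-≤ : ∀ a b {n m} → a ℕ.+ b ≡ n → n ℕ.≤ m → b ℕ.≤ m
    right-≤ a b ≡.refl p = ℕ.≤-trans (ℕ.m≤n+m b a) p

    blockWeight : ∀ {b} {B : Set b} → (List B → K.Carrier) → ∀ {n} → Labelling n → (Fin n → B) → Fin n → K.Carrier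
    blockWeight F v x k = F (blockOf v x (just k))

    module Moments (t : K.Carrier) (F : 𝓦) (F1 : F [] ≈ 1#) where

      open Cumulants K t L F

      -- The value 1 rather than t at the empty word makes an empty gap contribute 1.
      scaled : 𝓦
      scaled []      = 1#
      scaled (x ∷ w) = t * F (x ∷ w)

      scaledWeight coveredWeight : ∀ {n} → Labelling n → (Fin n → L) → Fin n → K.Carrier
      scaledWeight  v x k = t * blockWeight F v x k
      coveredWeight v x k = (if covered v k then t else 1#) * blockWeight F v x k

      scaled-first : ∀ {n} {v : Labelling n} {x : Fin n → L} → IsPart v → ∀ i → firstPoint n ≡ just i →
        scaled (blockOf v x (firstPoint n)) ≈ scaledWeight v x i
      scaled-first {suc n} {v} {x} pv .zero ≡.refl with blockOf v x (just zero) | blockOf-first v x (first-rep pv zero ≡.refl)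
      ... | _ | w , ≡.refl = refl

      -- The block of the first point is outer, so its weight has no factor t.
      covered-first : ∀ {n} {v : Labelling n} {x : Fin n → L} → ∀ i → firstPoint n ≡ just i →
        F (blockOf v x (firstPoint n)) ≈ coveredWeight v x i
      covered-first {suc n} {v} .zero ≡.refl rewrite covered-zero v = sym (K.*-identityˡ _)

      scaledSum coveredSum : ∀ n → 𝓦 → (Fin n → L) → K.Carrier
      scaledSum  n H x = sumNC n λ π → pointed H (scaledWeight (lab π) x) (lab π) (firstPoint n) x
      coveredSum n H x = sumNC n λ π → pointed H (coveredWeight (lab π) x) (lab π) (firstPoint n) x

      module _ {a b} (ρ : NC a) (σ : NC b) (H : 𝓦) (x : Fin (suc (a ℕ.+ b)) → L) where

        private
          module N = NodeGlue (lab ρ) (lab σ)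
        open NodeCovered (lab ρ) (lab σ)
        open GlueBlocks (lab ρ) nothing (lab σ) (firstPoint b) x
        open NodeWeights (lab ρ) (lab σ) x

        scaled-node : pointed H (scaledWeight (lab (node ρ σ)) x) (lab (node ρ σ)) (just zero) x ≈
          pointed scaled (scaledWeight (lab ρ) (x ∘ gap b)) (lab ρ) (firstPoint a) (x ∘ gap b) *
          pointed (∂ (x zero) H) (scaledWeight (lab σ) (x ∘ rest a)) (lab σ) (firstPoint b) (x ∘ rest a)
        scaled-node = trans
          (pointed-cong {m = just zero} (lab-node ρ σ) (λ k _ → *-congˡ (reflexive (cong F (blockOf-cong x (just k) (lab-node ρ σ))))))
          (trans (pointed-node H (scaledWeight N.glue x)) (*-cong
            (trans (others-cong {m = nothing} (λ _ → ≡.refl) (λ k _ → *-congˡ (reflexive (cong F (block-gap k ≡.refl)))))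
              (sym (pointed-all {m = firstPoint a} (first-rep (lab-part ρ)) refl (scaled-first (lab-part ρ)))))
            (pointed-cong {m = firstPoint b} (λ _ → ≡.refl) (λ k u → *-congˡ (reflexive (cong F (block-rest k u)))))))

        private
          covered-rest-weight : pointed (∂ (x zero) H) (coveredWeight N.glue x ∘ rest a) (lab σ) (firstPoint b) (x ∘ rest a) ≈
            pointed (∂ (x zero) H) (coveredWeight (lab σ) (x ∘ rest a)) (lab σ) (firstPoint b) (x ∘ rest a)
          covered-rest-weight = pointed-cong {m = firstPoint b} (λ _ → ≡.refl) (λ k u → *-cong
            (reflexive (cong (λ c → if c then t else 1#) (covered-rest (lab-part σ) k u))) (reflexive (cong F (block-rest k u))))

          to-glue : pointed H (coveredWeight (lab (node ρ σ)) x) (lab (node ρ σ)) (just zero) x ≈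
            pointed H (coveredWeight N.glue x) N.glue (just zero) x
          to-glue = pointed-cong {m = just zero} (lab-node ρ σ) (λ k _ → *-cong
            (reflexive (cong (λ c → if c then t else 1#) (covered-cong (lab-node ρ σ) k)))
            (reflexive (cong F (blockOf-cong x (just k) (lab-node ρ σ)))))

        covered-node₀ : b ≡ 0 → pointed H (coveredWeight (lab (node ρ σ)) x) (lab (node ρ σ)) (just zero) x ≈
          pointed F (coveredWeight (lab ρ) (x ∘ gap b)) (lab ρ) (firstPoint a) (x ∘ gap b) *
          pointed (∂ (x zero) H) (coveredWeight (lab σ) (x ∘ rest a)) (lab σ) (firstPoint b) (x ∘ rest a)
        covered-node₀ b≡0 = trans to-glue (trans (pointed-node H (coveredWeight N.glue x)) (*-cong
            (trans (others-cong {m = nothing} (λ _ → ≡.refl) (λ k _ → *-cong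
                (reflexive (cong (λ c → if c then t else 1#) (covered-gap₀ b≡0 k))) (reflexive (cong F (block-gap k ≡.refl)))))
              (sym (pointed-all {m = firstPoint a} (first-rep (lab-part ρ)) F1 covered-first)))
            covered-rest-weight))

        covered-node₊ : ∀ j → firstPoint b ≡ just j → pointed H (coveredWeight (lab (node ρ σ)) x) (lab (node ρ σ)) (just zero) x ≈
          pointed scaled (scaledWeight (lab ρ) (x ∘ gap b)) (lab ρ) (firstPoint a) (x ∘ gap b) *
          pointed (∂ (x zero) H) (coveredWeight (lab σ) (x ∘ rest a)) (lab σ) (firstPoint b) (x ∘ rest a)
        covered-node₊ j b≡ = trans to-glue (trans (pointed-node H (coveredWeight N.glue x)) (*-cong
            (trans (others-cong {m = nothing} (λ _ → ≡.refl) (λ k _ → *-cong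
                (reflexive (cong (λ c → if c then t else 1#) (covered-gap₊ j b≡ (first-rep (lab-part σ) j b≡) k)))
                (reflexive (cong F (block-gap k ≡.refl)))))
              (sym (pointed-all {m = firstPoint a} (first-rep (lab-part ρ)) refl (scaled-first (lab-part ρ)))))
            covered-rest-weight))

      -- H reads the block of the first point, with gaps N; the blocks behind its last point are all
      -- weighted by t in the first series (`N`), and only if inner in the second (`M`).
      scaledSeries coveredSeries : 𝓦 → 𝓦
      scaledSeries  H = const (H []) ⊕ Int N H ⊛ N
      coveredSeries H = const (H []) ⊕ Int N H ⊛ M

      scaledSeries-scaled : scaledSeries scaled ≋ N
      scaledSeries-scaled = 𝓦.trans (𝓦.+-cong {const 1#} 𝓦.refl (𝓦.trans (⊛-cong {g = N} (Int-• (shift-raises N) t F) 𝓦.refl)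
        (•-⊛ t b N))) (𝓦.sym N-eq)

      coveredSeries-F : coveredSeries F ≋ M
      coveredSeries-F = 𝓦.trans (𝓦.+-cong {x = const (F [])} {const 1#} (λ { [] → F1 ; (_ ∷ _) → refl }) 𝓦.refl) (𝓦.sym M-eq)

      private
        empty : ∀ H R {W v m x} → pointed {L = L} {n = 0} H W v m x + 0# ≈ H [] + 0# * R
        empty H R {v = v} {m} {x} = +-cong (pointed-empty v m x) (sym (K.zeroˡ R))

      -- The bound m serves the recursion into both parts of a cut; H is arbitrary because the rest
      -- continues the block of 0 with `∂ (x zero) H`.
      scaledSum-series : ∀ m n → n ℕ.≤ m → ∀ H x → scaledSum n H x ≈ scaledSeries H (tabulate x)
      scaledSum-series m       zero    _         H x = empty H (N [])
      scaledSum-series (suc m) (suc n) (s≤s n≤m) H x = trans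
        (sumNC-suc _ (λ (a , b , e) → N (tabulate (takeᶠ a b e x′))) (λ (a , b , e) → scaledSeries (∂ (x zero) H) (tabulate (dropᶠ a b e x′)))
          (λ (a , b , e) ρ → pointed scaled (scaledWeight (lab ρ) (takeᶠ a b e x′)) (lab ρ) (firstPoint a) (takeᶠ a b e x′))
          (λ (a , b , e) σ → pointed (∂ (x zero) H) (scaledWeight (lab σ) (dropᶠ a b e x′)) (lab σ) (firstPoint b) (dropᶠ a b e x′))
          (λ { a b ≡.refl ρ σ → scaled-node ρ σ H x })
          (λ a b e → trans (scaledSum-series m a (left-≤ a b e n≤m) scaled (takeᶠ a b e x′)) (scaledSeries-scaled (tabulate (takeᶠ a b e x′))))
          (λ a b e → scaledSum-series m b (right-≤ a b e n≤m) (∂ (x zero) H) (dropᶠ a b e x′)))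
        (trans (sum-first-letter N H N x _ _ (λ a b e → K.distribˡ _ _ _)) (sym (K.+-identityˡ _)))
        where x′ = x ∘ suc

      coveredSum-series : ∀ m n → n ℕ.≤ m → ∀ H x → coveredSum n H x ≈ coveredSeries H (tabulate x)
      coveredSum-series m       zero    _         H x = empty H (M [])
      coveredSum-series (suc m) (suc n) (s≤s n≤m) H x = trans
        (sumNC-suc _ P (λ (a , b , e) → coveredSeries (∂ (x zero) H) (tabulate (dropᶠ a b e x′)))
          p
          (λ (a , b , e) σ → pointed (∂ (x zero) H) (coveredWeight (lab σ) (dropᶠ a b e x′)) (lab σ) (firstPoint b) (dropᶠ a b e x′))
          (λ { a zero ≡.refl ρ σ → covered-node₀ ρ σ H x ≡.refl ; a (suc b) ≡.refl ρ σ → covered-node₊ ρ σ H x zero ≡.refl })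
          sum-p
          (λ a b e → coveredSum-series m b (right-≤ a b e n≤m) (∂ (x zero) H) (dropᶠ a b e x′)))
        (trans (sum-first-letter N H M x _ _ combine) (sym (K.+-identityˡ _)))
        where
        x′ = x ∘ suc
        -- With b = 0 the gap is not enclosed and keeps its outer blocks, giving M; otherwise all of
        -- its blocks are inner, giving N.
        P : Cut n → K.Carrier
        P (a , zero  , e) = M (tabulate (takeᶠ a zero e x′))
        P (a , suc b , e) = N (tabulate (takeᶠ a (suc b) e x′))
        p : ((a , b , e) : Cut n) → NC a → K.Carrier
        p (a , zero  , e) ρ = pointed F (coveredWeight (lab ρ) (takeᶠ a zero e x′)) (lab ρ) (firstPoint a) (takeᶠ a zero e x′)
        p (a , suc b , e) ρ = pointed scaled (scaledWeight (lab ρ) (takeᶠ a (suc b) e x′)) (lab ρ) (firstPoint a) (takeᶠ a (suc b) e x′)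
        sum-p : ∀ a b (e : a ℕ.+ b ≡ n) → sumNC a (p (a , b , e)) ≈ P (a , b , e)
        sum-p a zero    e = trans (coveredSum-series m a (left-≤ a zero e n≤m) F (takeᶠ a zero e x′)) (coveredSeries-F (tabulate (takeᶠ a zero e x′)))
        sum-p a (suc b) e = trans (scaledSum-series m a (left-≤ a (suc b) e n≤m) scaled (takeᶠ a (suc b) e x′)) (scaledSeries-scaled (tabulate (takeᶠ a (suc b) e x′)))
        combine : ∀ a b (e : a ℕ.+ b ≡ n) → P (a , b , e) * coveredSeries (∂ (x zero) H) (tabulate (dropᶠ a b e x′)) ≈
          M (tabulate (takeᶠ a b e x′)) * const (H (x zero ∷ [])) (tabulate (dropᶠ a b e x′)) +
          N (tabulate (takeᶠ a b e x′)) * (Int N (∂ (x zero) H) ⊛ M) (tabulate (dropᶠ a b e x′))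
        combine a zero    e = trans (*-congˡ (trans (+-congˡ (K.zeroˡ _)) (K.+-identityʳ _)))
          (sym (trans (+-congˡ (trans (*-congˡ (K.zeroˡ _)) (K.zeroʳ _))) (K.+-identityʳ _)))
        combine a (suc b) e = trans (*-congˡ (K.+-identityˡ _))
          (sym (trans (+-congʳ (K.zeroʳ _)) (K.+-identityˡ _)))

      coveredSum-M : ∀ n x → coveredSum n F x ≈ M (tabulate x)
      coveredSum-M n x = trans (coveredSum-series n n ℕ.≤-refl F x) (coveredSeries-F (tabulate x))

    module BoxedSum (F : 𝓦) (F1 : F [] ≈ 1#) (d₀ : Substitution.𝓦 K ⊤ ⊤) where

      open Boxed K L F d₀
      private
        module ST = Substitution K ⊤ ⊤
        module Cy = EvalLetter K L

      dots : ∀ {n} → Fin n → ⊤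
      dots _ = tt

      primal : 𝓦 → ∀ {n} → NC n → (Fin n → L) → K.Carrier
      primal H π x = pointed H (blockWeight F (lab π) x) (lab π) (firstPoint _) x

      -- The last block of the complement is marked because it is the one that 0 joins when the
      -- partition becomes the gap of a larger one.
      dual : ST.𝓦 → ∀ {n} → NC n → K.Carrier
      dual d π = pointed d (blockWeight d₀ (krLab π) dots) (krLab π) (lastBlock (krLab π)) dots

      boxedSum : ∀ n → 𝓦 → ST.𝓦 → (Fin n → L) → K.Carrier
      boxedSum n H d x = sumNC n λ π → primal H π x * dual d π

      primal-all : ∀ {n} (π : NC n) x → primal F π x ≈ others (lab π) nothing (blockWeight F (lab π) x)
      primal-all π x = pointed-all {m = firstPoint _} (first-rep (lab-part π)) F1
        (λ i e → reflexive (cong (λ m → F (blockOf (lab π) x m)) e))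

      dual-all : d₀ [] ≈ 1# → ∀ {n} (π : NC n) → dual d₀ π ≈ others (krLab π) nothing (blockWeight d₀ (krLab π) dots)
      dual-all d1 π = pointed-all {m = lastBlock (krLab π)} (last-rep (krLab-part π)) d1
        (λ i e → reflexive (cong (λ m → d₀ (blockOf (krLab π) dots m)) e))

      module _ {a b} (ρ : NC a) (σ : NC b) where

        private
          module N = NodeGlue (lab ρ) (lab σ)
          module D = Glue (krLab ρ) (lastBlock (krLab ρ)) (krLab σ) nothing
        open DualWeights {L = ⊤} (krLab ρ) (lastBlock (krLab ρ)) (krLab σ) dots
        module GB = GlueBlocks {L = ⊤} (krLab ρ) (lastBlock (krLab ρ)) (krLab σ) nothing dots

        primal-node : ∀ H x → primal H (node ρ σ) x ≈ primal F ρ (x ∘ gap b) * primal (∂ (x zero) H) σ (x ∘ rest a)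
        primal-node H x = trans
          (pointed-cong {m = just zero} (lab-node ρ σ) (λ k _ → reflexive (cong F (blockOf-cong x (just k) (lab-node ρ σ)))))
          (trans (NodeWeights.pointed-node (lab ρ) (lab σ) x H (blockWeight F N.glue x)) (*-cong
            (trans (others-cong {m = nothing} (λ _ → ≡.refl) (λ k _ → reflexive (cong F (GX.block-gap k ≡.refl))))
              (sym (primal-all ρ (x ∘ gap b))))
            (pointed-cong {m = firstPoint b} (λ _ → ≡.refl) (λ k u → reflexive (cong F (GX.block-rest k u))))))
          where module GX = GlueBlocks (lab ρ) nothing (lab σ) (firstPoint b) x

        to-glue : ∀ d {m} → lastBlock D.glue ≡ m → dual d (node ρ σ) ≈ pointed d (blockWeight d₀ D.glue dots) D.glue m dots
        to-glue d {m} e = trans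
          (reflexive (cong (λ m → pointed d (blockWeight d₀ (krLab (node ρ σ)) dots) (krLab (node ρ σ)) m dots)
            (≡.trans (cong just (krLab-node ρ σ (fromℕ (a ℕ.+ b)))) e)))
          (pointed-cong {m = m} (krLab-node ρ σ)
            (λ k _ → reflexive (cong d₀ (blockOf-cong {L = ⊤} dots (just k) (krLab-node ρ σ)))))

        private
          gap-weights : ∀ d → pointed d (blockWeight d₀ D.glue dots ∘ gap b) (krLab ρ) (lastBlock (krLab ρ)) dots ≈ dual d ρ
          gap-weights d = pointed-cong {m = lastBlock (krLab ρ)} (λ _ → ≡.refl) (λ k u → reflexive (cong d₀ (GB.block-gap k u)))

        dual-node₊ : ∀ d m → lastBlock (krLab σ) ≡ just m → lastBlock D.glue ≡ just (rest a m) →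
          dual d (node ρ σ) ≈ dual (ST.∂ tt d₀) ρ * dual d σ
        dual-node₊ d m e e′ = trans (to-glue d e′) (trans (pointed-dual₊ d d₀ (blockWeight d₀ D.glue dots) m refl)
          (*-cong (gap-weights (ST.∂ tt d₀)) (trans
            (pointed-cong {m = just m} (λ _ → ≡.refl) (λ k _ → reflexive (cong d₀ (GB.block-rest k ≡.refl))))
            (reflexive (cong (λ m → pointed d (blockWeight d₀ (krLab σ) dots) (krLab σ) m dots) (≡.sym e))))))

        dual-node₀ : ∀ d → lastBlock D.glue ≡ just zero →
          dual d (node ρ σ) ≈ dual (ST.∂ tt d) ρ * others (krLab σ) nothing (blockWeight d₀ D.glue dots ∘ rest a)
        dual-node₀ d e = trans (to-glue d e) (trans (pointed-dual₀ d (blockWeight d₀ D.glue dots)) (*-congʳ (gap-weights (ST.∂ tt d))))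

      -- The points behind 0 all belong to the gap, whose last block has been joined to 0; for a = 0
      -- the last point is 0 itself.
      last-glue₀ : ∀ {a} (v : Labelling a) (w : Labelling 0) → lastBlock (Glue.glue v (lastBlock v) w nothing) ≡ just zero
      last-glue₀ {zero}  v w = ≡.refl
      last-glue₀ {suc a} v w = cong just (≡.trans (cong glue last≡) (≡.trans (glue-gap (fromℕ a))
        (cong (λ c → if c then zero else gap 0 (v (fromℕ a))) (is-just (v (fromℕ a))))))
        where
        open Glue v (lastBlock v) w nothing
        last≡ : fromℕ (suc a ℕ.+ 0) ≡ gap 0 (fromℕ a)
        last≡ = toℕ-injective (≡.trans (toℕ-fromℕ (suc a ℕ.+ 0)) (cong suc (≡.trans (ℕ.+-identityʳ a)
          (≡.sym (≡.trans (toℕ-↑ˡ (fromℕ a) 0) (toℕ-fromℕ a))))))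

      last-glue₊ : ∀ {a b} (v : Labelling a) (w : Labelling (suc b)) →
        lastBlock (Glue.glue v (lastBlock v) w nothing) ≡ just (rest a (w (fromℕ b)))
      last-glue₊ {a} {b} v w = cong just (≡.trans (cong glue last≡) (glue-rest (fromℕ b)))
        where
        open Glue v (lastBlock v) w nothing
        last≡ : fromℕ (a ℕ.+ suc b) ≡ rest a (fromℕ b)
        last≡ = toℕ-injective (≡.trans (toℕ-fromℕ (a ℕ.+ suc b)) (≡.trans (ℕ.+-suc a b)
          (cong suc (≡.sym (≡.trans (toℕ-↑ʳ a (fromℕ b)) (cong (a ℕ.+_) (toℕ-fromℕ b)))))))

      open import Algebra.Properties.CommutativeSemigroup K.*-commutativeSemigroup using (interchange)

      boxed-node₊ : ∀ {a b} (ρ : NC a) (σ : NC (suc b)) H d x → primal H (node ρ σ) x * dual d (node ρ σ) ≈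
        (primal F ρ (x ∘ gap (suc b)) * dual (ST.∂ tt d₀) ρ) * (primal (∂ (x zero) H) σ (x ∘ rest a) * dual d σ)
      boxed-node₊ {a} {b} ρ σ H d x = trans (*-cong (primal-node ρ σ H x)
        (dual-node₊ ρ σ d (krLab σ (fromℕ b)) ≡.refl (last-glue₊ (krLab ρ) (krLab σ)))) (interchange _ _ _ _)

      boxed-node₀ : ∀ {a} (ρ : NC a) (σ : NC 0) H d x → primal H (node ρ σ) x * dual d (node ρ σ) ≈
        (primal F ρ (x ∘ gap 0) * dual (ST.∂ tt d) ρ) * H (x zero ∷ [])
      boxed-node₀ ρ σ H d x = trans (*-cong (trans (primal-node ρ σ H x) (*-congˡ (pointed-empty _ _ _)))
        (dual-node₀ ρ σ d (last-glue₀ (krLab ρ) (krLab σ)))) (trans (interchange _ _ _ _) (*-congˡ (trans (*-congˡ (others-empty _ _ _)) (K.*-identityʳ _))))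

      -- The block of 0 in π, with its gaps filled by Y, accounts for `Int Y H`. The point i' of its
      -- last element i lies in the last block of the complement, which with its gaps filled by X
      -- accounts for `Int X d`.
      boxedSum-series : ∀ m n → n ℕ.≤ m → ∀ H d x → boxedSum (suc n) H d x ≈ (Int Y H ⊛ Cy.Int X d) (tabulate x)
      boxedSum-sub : ∀ m n → n ℕ.≤ m → ∀ d x → boxedSum n F d x ≈ Cy.Sub X d (tabulate x)

      boxedSum-sub m       zero    n≤m       d x = trans (trans (K.+-identityʳ _)
          (trans (*-cong (trans (pointed-empty _ _ x) F1) (pointed-empty {L = ⊤} _ _ dots)) (K.*-identityˡ _)))
        (sym (trans (Cy.Sub-eq X-raises d []) (trans (+-congˡ (K.zeroˡ _)) (K.+-identityʳ _))))
      boxedSum-sub (suc m) (suc n) (s≤s n≤m) d x = trans (boxedSum-series m n n≤m F d x)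
        (sym (trans (Cy.Sub-eq X-raises d (tabulate x)) (trans (K.+-identityˡ _) (⊛-cong {g = Cy.Int X d} X-eq 𝓦.refl (tabulate x)))))

      boxedSum-series m n n≤m H d x = trans
        (sumNC-suc _ P Q p q
          (λ { a zero ≡.refl ρ σ → boxed-node₀ ρ σ H d x ; a (suc b) ≡.refl ρ σ → boxed-node₊ ρ σ H d x })
          sum-p (sum-q m n≤m))
        (sum-first-letter Y H (Cy.Int X d) x P Q combine)
        where
        x′ = x ∘ suc
        P Q : Cut n → K.Carrier
        P (a , zero  , e) = Cy.Int X d (tabulate (takeᶠ a zero e x′))
        P (a , suc b , e) = Y (tabulate (takeᶠ a (suc b) e x′))
        Q (a , zero  , e) = H (x zero ∷ [])
        Q (a , suc b , e) = (Int Y (∂ (x zero) H) ⊛ Cy.Int X d) (tabulate (dropᶠ a (suc b) e x′))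
        p : ((a , b , e) : Cut n) → NC a → K.Carrier
        p (a , zero  , e) ρ = primal F ρ (takeᶠ a zero e x′) * dual (ST.∂ tt d) ρ
        p (a , suc b , e) ρ = primal F ρ (takeᶠ a (suc b) e x′) * dual (ST.∂ tt d₀) ρ
        q : ((a , b , e) : Cut n) → NC b → K.Carrier
        q (a , zero  , e) σ = H (x zero ∷ [])
        q (a , suc b , e) σ = primal (∂ (x zero) H) σ (dropᶠ a (suc b) e x′) * dual d σ
        sum-p : ∀ a b (e : a ℕ.+ b ≡ n) → sumNC a (p (a , b , e)) ≈ P (a , b , e)
        sum-p a zero    e = boxedSum-sub m a (left-≤ a zero e n≤m) (ST.∂ tt d) (takeᶠ a zero e x′)
        sum-p a (suc b) e = boxedSum-sub m a (left-≤ a (suc b) e n≤m) (ST.∂ tt d₀) (takeᶠ a (suc b) e x′)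
        -- A non-empty rest has b + 1 ≤ n points, so the bound drops here; for the gap it drops
        -- inside `boxedSum-sub`.
        sum-q : ∀ m → n ℕ.≤ m → ∀ a b (e : a ℕ.+ b ≡ n) → sumNC b (q (a , b , e)) ≈ Q (a , b , e)
        sum-q m       n≤m a zero    e = K.+-identityʳ _
        sum-q zero    n≤m a (suc b) e with right-≤ a (suc b) e n≤m
        ... | ()
        sum-q (suc m) n≤m a (suc b) e = boxedSum-series m b (ℕ.s≤s⁻¹ (right-≤ a (suc b) e n≤m)) (∂ (x zero) H) d (dropᶠ a (suc b) e x′)
        combine : ∀ a b (e : a ℕ.+ b ≡ n) → P (a , b , e) * Q (a , b , e) ≈
          Cy.Int X d (tabulate (takeᶠ a b e x′)) * const (H (x zero ∷ [])) (tabulate (dropᶠ a b e x′)) +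
          Y (tabulate (takeᶠ a b e x′)) * (Int Y (∂ (x zero) H) ⊛ Cy.Int X d) (tabulate (dropᶠ a b e x′))
        combine a zero    e = sym (trans (+-congˡ (trans (*-congˡ (K.zeroˡ _)) (K.zeroʳ _))) (K.+-identityʳ _))
        combine a (suc b) e = sym (trans (+-congʳ (K.zeroʳ _)) (K.+-identityˡ _))

      boxedSum-G : ∀ n x → boxedSum (suc n) F d₀ x ≈ G (tabulate x)
      boxedSum-G n x = trans (boxedSum-series n n ℕ.≤-refl F d₀ x) (⊛-cong {g = Y} (𝓦.sym X-eq) 𝓦.refl (tabulate x))

-- Inner blocks through their least elements.

module InnerBlocks where

  open import Defs using (NC; block; blocks; minᵇ; maxᵇ; IsInner; isInner?; nonCrossing)
  open Nodes
  open BlockProducts using (Covered; covered; covered?; does-iff)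
  open import Data.Fin.Base using (Fin; toℕ; _<_)
  open import Data.Fin.Properties using (_≟_; toℕ<n; <-cmp)
  open import Data.List.Base as List using (List; map; allFin)
  import Data.List.Extrema.Nat as Extrema
  open import Data.List.Membership.Propositional using (_∈_; find; lose)
  open import Data.List.Membership.Propositional.Properties using (∈-filter⁺; ∈-filter⁻; ∈-allFin; ∈-map⁺; ∈-map⁻)
  import Data.List.Relation.Unary.All as All
  import Data.List.Relation.Unary.All.Properties as All
  import Data.List.Relation.Unary.Any as Any
  open import Data.Sum.Base using (inj₁; inj₂)
  open import Relation.Binary.PropositionalEquality using (_≡_; _≢_; refl; sym; trans; subst)
  open import Relation.Nullary using (does; contradiction)

  module _ {n} (π : NC n) where

    private
      v : Labelling n
      v = lab π

    ∈-block : ∀ {a j} → v j ≡ a → j ∈ block π a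
    ∈-block {j = j} = ∈-filter⁺ (λ j → v j ≟ _) (∈-allFin j)

    block-∈ : ∀ {a j} → j ∈ block π a → v j ≡ a
    block-∈ {a} p = proj₂ (∈-filter⁻ (λ j → v j ≟ a) {xs = allFin n} p)

    minᵇ-block : ∀ {a} → v a ≡ a → minᵇ (block π a) ≡ toℕ a
    minᵇ-block {a} va≡a = Extrema.min≈v⁺ (∈-map⁺ toℕ (∈-block va≡a))
      (All.map⁺ (All.tabulate λ {j} j∈ → subst (λ b → toℕ b ℕ.≤ toℕ j) (block-∈ j∈) (proj₁ (lab-part π j))))
      -- The default n of the minimum lies above a.
      (ℕ.<⇒≤ (toℕ<n a))

    ≤-maxᵇ : ∀ {a j} → v j ≡ a → toℕ j ℕ.≤ maxᵇ (block π a)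
    ≤-maxᵇ e = All.lookup (Extrema.xs≤max 0 (map toℕ (block π _))) (∈-map⁺ toℕ (∈-block e))

    maxᵇ-attained : ∀ {a m} → m ℕ.< maxᵇ (block π a) → ∃ λ j → v j ≡ a × m ℕ.< toℕ j
    maxᵇ-attained {a} m< with Extrema.argmax-sel (λ x → x) 0 (map toℕ (block π a))
    -- Were the maximum the default 0, nothing could lie below it.
    ... | inj₁ e = contradiction (subst (_ ℕ.<_) e m<) λ ()
    ... | inj₂ p with ∈-map⁻ toℕ p
    ...   | j , j∈ , e = j , block-∈ j∈ , subst (_ ℕ.<_) e m<

    inner⇒covered : ∀ {a} → v a ≡ a → IsInner π (block π a) → Covered v a
    inner⇒covered {a} va≡a inner with find inner
    ... | W , W∈ , min< , _ , <max with ∈-map⁻ (block π) W∈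
    ...   | b , b∈ , refl with maxᵇ-attained {b} (ℕ.≤-<-trans (≤-maxᵇ va≡a) <max)
    ...     | j , vj≡b , a<j = b , j , subst (ℕ._< toℕ a) (minᵇ-block vb≡b) (subst (_ ℕ.<_) (minᵇ-block va≡a) min<)
                             , a<j , trans vb≡b (sym vj≡b)
      where
      vb≡b : v b ≡ b
      vb≡b = proj₂ (∈-filter⁻ (λ a → v a ≟ a) {xs = allFin n} b∈)

    -- The block of i encloses that of a: its minimum is at most i, and a point of the block of a
    -- beyond j would cross the pair i, j.
    covered⇒inner : ∀ {a} → v a ≡ a → Covered v a → IsInner π (block π a)
    covered⇒inner {a} va≡a (i , j , i<a , a<j , vi≡vj) = lose
      (∈-map⁺ (block π) (∈-filter⁺ (λ a → v a ≟ a) (∈-allFin b) vb≡b))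
      ( subst (ℕ._< minᵇ (block π a)) (sym (minᵇ-block vb≡b)) (subst (toℕ b ℕ.<_) (sym (minᵇ-block va≡a)) b<a)
      , subst (ℕ._≤ maxᵇ (block π a)) (sym (minᵇ-block va≡a)) (≤-maxᵇ va≡a)
      -- The default 0 of the maximum must lie below j as well.
      , ℕ.<-≤-trans (Extrema.max<v⁺ (ℕ.≤-<-trans z≤n a<j) (All.map⁺ (All.tabulate λ k∈ → before (block-∈ k∈)))) (≤-maxᵇ (sym vi≡vj)))
      where
      b : Fin n
      b = v i
      vb≡b : v b ≡ b
      vb≡b = proj₂ (lab-part π i)
      b<a : toℕ b ℕ.< toℕ a
      b<a = ℕ.≤-<-trans (proj₁ (lab-part π i)) i<a
      b≢a : v i ≢ a
      b≢a refl = ℕ.<-irrefl refl b<a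
      before : ∀ {k} → v k ≡ a → k < j
      before {k} vk≡a with <-cmp k j
      ... | tri< k<j _ _  = k<j
      ... | tri≈ _ refl _ = contradiction (trans vi≡vj vk≡a) b≢a
      ... | tri> _ _ j<k  = contradiction (trans (nonCrossing π i a j k i<a a<j j<k vi≡vj (trans va≡a (sym vk≡a))) va≡a) b≢a

    inner≡covered : ∀ a → v a ≡ a → does (isInner? π (block π a)) ≡ covered v a
    inner≡covered a va≡a = does-iff (isInner? π (block π a)) (covered? v a) (inner⇒covered va≡a) (covered⇒inner va≡a)

-- Translation between functionals and series, and conclusion.

module Assembly where

  open import Defs using (module FreeProbability; NC; Kr; block; blocks; inner; isInner?)
  open FormalSeries
  open Substitutions
  open CumulantSeries
  open Freeness
  open FreeProducts
  open Nodes
  open Enumeration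
  open KrewerasOfNodes
  open BlockProducts
  open Recursions
  open InnerBlocks
  import Algebra.Properties.Semiring.Exp as SemiringExp
  open import Data.Bool.Base using (Bool; true; false; if_then_else_)
  open import Data.Fin.Base using (Fin; zero; suc)
  open import Data.Fin.Properties using (_≟_)
  open import Data.List.Base as List using (List; []; _∷_; length; filter; foldr; allFin; tabulate)
  open import Data.List.Properties using (tabulate-lookup; map-tabulate)
  open import Data.Vec.Base as Vec using (Vec; []; _∷_; lookup; fromList; replicate)
  open import Data.Vec.Properties using (lookup∘tabulate; tabulate∘lookup; tabulate-∘; lookup-replicate)
  open import Relation.Binary.PropositionalEquality as ≡ using (_≡_; cong; subst)
  open import Relation.Nullary using (does; yes; no)
  open import Relation.Unary using (Pred; Decidable; _∈_)

  select-map : ∀ {l m} {L : Set l} {M : Set m} {n} (f : L → M) (p : Fin n → Bool) (x : Fin n → L) (z : Fin n → M) →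
    (∀ i → z i ≡ f (x i)) → List.map f (select p x) ≡ select p z
  select-map {n = zero}  f p x z e = ≡.refl
  select-map {n = suc n} f p x z e with p zero
  ... | true  = ≡.cong₂ _∷_ (≡.sym (e zero)) (select-map f (p ∘ suc) (x ∘ suc) (z ∘ suc) (e ∘ suc))
  ... | false = select-map f (p ∘ suc) (x ∘ suc) (z ∘ suc) (e ∘ suc)

  select-nonempty : ∀ {l} {L : Set l} {n} (p : Fin n → Bool) (x : Fin n → L) k → p k ≡ true →
    ∃ λ a → ∃ λ w → select p x ≡ a ∷ w
  select-nonempty {n = suc n} p x zero e rewrite e = _ , _ , ≡.refl
  select-nonempty {n = suc n} p x (suc k) e with p zero
  ... | true  = _ , _ , ≡.refl
  ... | false = select-nonempty (p ∘ suc) (x ∘ suc) k e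

  map-filter-tabulate : ∀ {a b q} {A : Set a} {B : Set b} {Q : Pred A q} (Q? : Decidable Q) (f : A → B) {n} (g : Fin n → A) →
    List.map f (filter Q? (tabulate g)) ≡ select (λ i → does (Q? (g i))) (f ∘ g)
  map-filter-tabulate Q? f {zero}  g = ≡.refl
  map-filter-tabulate Q? f {suc n} g with does (Q? (g zero))
  ... | true  = cong (f (g zero) ∷_) (map-filter-tabulate Q? f (g ∘ suc))
  ... | false = map-filter-tabulate Q? f (g ∘ suc)

  module Transfer {c ℓ₀ a ℓ} (K : CommutativeRing c ℓ₀) (𝒜 : FreeProbability.NCProbabilitySpace K a ℓ) where

    private module K = CommutativeRing K
    open FreeProbability.Space K 𝒜 hiding (zero)
    open FreeProbability K using (sumNC)
    open FreeSeries K 𝒜 using (φ-cong)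
    open SemiringExp K.semiring using (_^_)
    open Sums K
    open Weights K

    -- The value at the empty word is 1, the constant term on which the recursions of the block sums
    -- rest.
    onList : Functionals → List Carrier → K.Carrier
    onList ψ []      = K.1#
    onList ψ (z ∷ w) = ψ (suc (length w)) (z ∷ fromList w)

    -- The two argument vectors have different length indices; absorbing the head into the
    -- functional lets the induction proceed without transport along an equality of lengths.
    functional-map : ∀ {b} {B : Set b} (ψ : Functionals) (f : B → Carrier) V →
      ψ (length V) (Vec.map f (fromList V)) ≡ ψ (length (List.map f V)) (fromList (List.map f V))
    functional-map ψ f []      = ≡.refl
    functional-map ψ f (b ∷ V) = functional-map (λ n z → ψ (suc n) (f b ∷ z)) f V

    functional-tabulate : ∀ (ψ : Functionals) {n} (g : Fin n → Carrier) →
      ψ n (Vec.tabulate g) ≡ ψ (length (tabulate g)) (fromList (tabulate g))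
    functional-tabulate ψ {zero}  g = ≡.refl
    functional-tabulate ψ {suc n} g = functional-tabulate (λ n z → ψ (suc n) (g zero ∷ z)) (g ∘ suc)

    product-filter : ∀ {A : Set} {q} {Q : Pred A q} (Q? : Decidable Q) (h : A → K.Carrier) {n} (g : Fin n → A) →
      foldr K._*_ K.1# (List.map h (filter Q? (tabulate g))) K.≈ ∏ (λ i → when (does (Q? (g i))) (h (g i)))
    product-filter Q? h {zero}  g = K.refl
    product-filter Q? h {suc n} g with does (Q? (g zero))
    ... | true  = K.*-congˡ (product-filter Q? h (g ∘ suc))
    ... | false = K.trans (product-filter Q? h (g ∘ suc)) (K.sym (K.*-identityˡ _))

    power-filter : ∀ {A : Set} {q} {Q : Pred A q} (Q? : Decidable Q) t (h : A → K.Carrier) xs →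
      (t ^ length (filter Q? xs)) K.* foldr K._*_ K.1# (List.map h xs) K.≈
      foldr K._*_ K.1# (List.map (λ V → (if does (Q? V) then t else K.1#) K.* h V) xs)
    power-filter Q? t h []       = K.*-identityˡ _
    power-filter Q? t h (V ∷ xs) with does (Q? V)
    ... | true  = K.trans (interchange _ _ _ _) (K.*-congˡ (power-filter Q? t h xs))
      where open import Algebra.Properties.CommutativeSemigroup K.*-commutativeSemigroup using (interchange)
    ... | false = K.trans (x∙yz≈y∙xz _ _ _) (K.*-cong (K.sym (K.*-identityˡ _)) (power-filter Q? t h xs))
      where open import Algebra.Properties.CommutativeSemigroup K.*-commutativeSemigroup using (x∙yz≈y∙xz)

    module _ {b} {B : Set b} (val : B → Carrier) (ψ : Functionals) where

      pulled : List B → K.Carrier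
      pulled w = onList ψ (List.map val w)

      module _ {n} (π : NC n) (x : Fin n → B) (z : Vec Carrier n) (z≡ : ∀ i → lookup z i ≡ val (x i)) where

        private
          on-block : List (Fin n) → K.Carrier
          on-block V = ψ (length V) (z ∣ V)

        block-value : ∀ k → lab π k ≡ k → on-block (block π k) K.≈ pulled (blockOf (lab π) x (just k))
        block-value k rep = K.reflexive (≡.trans (functional-map ψ (lookup z) (block π k))
          (≡.trans (cong (λ w → ψ (length w) (fromList w)) word) (nonempty (select-nonempty (λ j → is (just k) (lab π j)) (lookup z) k rep-selected))))
          where
          word : List.map (lookup z) (block π k) ≡ List.map val (blockOf (lab π) x (just k))
          word = ≡.trans (map-filter-tabulate (λ j → lab π j ≟ k) (lookup z) id)
            (≡.trans (select-cong (lookup z) (λ j → does-iff (lab π j ≟ k) (k ≟ lab π j) ≡.sym ≡.sym))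
              (≡.sym (select-map val (λ j → is (just k) (lab π j)) x (lookup z) z≡)))
          rep-selected : is (just k) (lab π k) ≡ true
          rep-selected = ≡.trans (cong (is (just k)) rep) (is-just k)
          -- `onList` follows ψ on non-empty words, and the block contains its representative k.
          nonempty : (∃ λ a → ∃ λ w′ → select (λ j → is (just k) (lab π j)) (lookup z) ≡ a ∷ w′) →
            ψ (length (List.map val (blockOf (lab π) x (just k)))) (fromList (List.map val (blockOf (lab π) x (just k)))) ≡
            onList ψ (List.map val (blockOf (lab π) x (just k)))
          nonempty (a , w′ , e) rewrite ≡.trans (select-map val (λ j → is (just k) (lab π j)) x (lookup z) z≡) e = ≡.refl

        partition-value : (ψ ⟦ π ⟧) z K.≈ others (lab π) nothing (λ k → pulled (blockOf (lab π) x (just k)))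
        partition-value = K.trans (K.reflexive (cong (foldr K._*_ K.1#) (map-map (filter (λ a → lab π a ≟ a) (allFin n)))))
          (K.trans (product-filter (λ a → lab π a ≟ a) (on-block ∘ block π) id)
          (K.trans (∏-cong λ k → when-rep k) (K.sym (others-nothing (lab π) _))))
          where
          map-map : ∀ as → List.map on-block (List.map (block π) as) ≡ List.map (on-block ∘ block π) as
          map-map []       = ≡.refl
          map-map (a ∷ as) = cong (_ ∷_) (map-map as)
          when-rep : ∀ k → when (does (lab π k ≟ k)) (on-block (block π k)) K.≈
            when (does (lab π k ≟ k)) (pulled (blockOf (lab π) x (just k)))
          when-rep k with lab π k ≟ k
          ... | yes rep = block-value k rep
          ... | no _    = K.refl

        weighted-value : ∀ t → (t ^ inner π) K.* (ψ ⟦ π ⟧) z K.≈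
          others (lab π) nothing (λ k → (if covered (lab π) k then t else K.1#) K.* pulled (blockOf (lab π) x (just k)))
        weighted-value t = K.trans (power-filter (isInner? π) t on-block (blocks π))
          (K.trans (K.reflexive (cong (foldr K._*_ K.1#) (map-map (filter (λ a → lab π a ≟ a) (allFin n)))))
          (K.trans (product-filter (λ a → lab π a ≟ a) (weight ∘ block π) id)
          (K.trans (∏-cong λ k → when-rep k) (K.sym (others-nothing (lab π) _)))))
          where
          weight : List (Fin n) → K.Carrier
          weight V = (if does (isInner? π V) then t else K.1#) K.* on-block V
          map-map : ∀ as → List.map weight (List.map (block π) as) ≡ List.map (weight ∘ block π) as
          map-map []       = ≡.refl
          map-map (a ∷ as) = cong (_ ∷_) (map-map as)
          when-rep : ∀ k → when (does (lab π k ≟ k)) (weight (block π k)) K.≈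
            when (does (lab π k ≟ k)) ((if covered (lab π) k then t else K.1#) K.* pulled (blockOf (lab π) x (just k)))
          when-rep k with lab π k ≟ k
          ... | yes rep = K.*-cong (K.reflexive (cong (λ c → if c then t else K.1#) (inner≡covered π k rep))) (block-value k rep)
          ... | no _    = K.refl

      module _ {t : K.Carrier} (isCumulants : IsTBooleanCumulants t ψ) where

        open IsTBooleanCumulants isCumulants
        private
          module C = Cumulants K t B pulled
          module R = Recursion K B
          module M = R.Moments t pulled K.refl

        prodᵇ : List B → Carrier
        prodᵇ []      = 1#
        prodᵇ (x ∷ w) = val x * prodᵇ w

        private
          product-tabulate : ∀ {n} (x : Fin n → B) → product (Vec.tabulate (val ∘ x)) ≡ prodᵇ (tabulate x)
          product-tabulate {zero}  x = ≡.refl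
          product-tabulate {suc n} x = cong (val (x zero) *_) (product-tabulate (x ∘ suc))

          moments-tabulate : ∀ n (x : Fin n → B) → φ (prodᵇ (tabulate x)) K.≈ C.M (tabulate x)
          moments-tabulate zero    x = K.trans φ-1 (K.sym C.M-[])
          moments-tabulate (suc n) x = K.trans (K.reflexive (cong φ (≡.sym (product-tabulate x))))
            (K.trans (moment-formula (suc n) (Vec.tabulate (val ∘ x)))
            (K.trans (sum-cong (λ π → K.trans (weighted-value π x (Vec.tabulate (val ∘ x)) (lookup∘tabulate (val ∘ x)) t)
              (K.sym (pointed-all {m = just zero} (first-rep (lab-part π)) K.refl (M.covered-first {x = x})))) (Defs.allNC (suc n)))
            (M.coveredSum-M (suc n) x)))

        moments≈M : ∀ w → φ (prodᵇ w) K.≈ C.M w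
        moments≈M w = subst (λ w → φ (prodᵇ w) K.≈ C.M w) (tabulate-lookup w) (moments-tabulate (length w) (List.lookup w))

    module _ {p} (ℳ 𝒩 : Pred Carrier p) (isℳ : IsUnitalSubalgebra ℳ) (is𝒩 : IsUnitalSubalgebra 𝒩)
      (free : FreelyIndependent ℳ 𝒩) (t : K.Carrier) (β : Functionals) (isβ : IsTBooleanCumulants t β)
      (y : Carrier) (y∈ : y ∈ 𝒩) where

      private
        -- Every element of ℳ is a letter of its own, so that one series holds the cumulants of all
        -- tuples from ℳ.
        L : Set _
        L = ∃ (_∈ ℳ)

        Fˣ : List L → K.Carrier
        Fˣ = pulled proj₁ β

        Fʸ : List ⊤ → K.Carrier
        Fʸ = pulled (λ _ → y) β

        module FP = FreeProduct K t 𝒜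
        module RX = FreeSeries.Resolvent K 𝒜 L L proj₁ t Fˣ (ShiftLetter.shift-isLetter K L)
        module RY = FreeSeries.Resolvent K 𝒜 ⊤ L (λ _ → y) t Fʸ (EvalLetter.eval-isLetter K L)
        module BS = Recursion.BoxedSum K L Fˣ K.refl Fʸ

        prodˣ : ∀ w → RX.prod w ≈ prodᵇ proj₁ β isβ w
        prodˣ []      = refl
        prodˣ (x ∷ w) = *-congˡ (prodˣ w)

        prodʸ : ∀ w → RY.prod w ≈ prodᵇ (λ _ → y) β isβ w
        prodʸ []      = refl
        prodʸ (x ∷ w) = *-congˡ (prodʸ w)

        xy : L → Carrier
        xy x = proj₁ x * y

        momentsˣ : ∀ w → RX.moments 1# w K.≈ Cumulants.M K t L Fˣ w
        momentsʸ : ∀ w → RY.moments 1# w K.≈ Cumulants.M K t ⊤ Fʸ w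
        momentsˣ w = K.trans (φ-cong (trans (*-identityˡ _) (prodˣ w))) (moments≈M proj₁ β isβ w)
        momentsʸ w = K.trans (φ-cong (trans (*-identityˡ _) (prodʸ w))) (moments≈M (λ _ → y) β isβ w)

        prod-xy≈ : ∀ w → FP.prod-xy ℳ 𝒩 isℳ is𝒩 free L proj₁ proj₂ y y∈ Fˣ Fʸ momentsˣ momentsʸ w ≈ prodᵇ xy β isβ w
        prod-xy≈ []      = refl
        prod-xy≈ (x ∷ w) = *-congˡ (prod-xy≈ w)

      products : (n : ℕ) .{{_ : NonZero n}} (x : Vec Carrier n) → (∀ i → lookup x i ∈ ℳ) →
        β n (Vec.map (_* y) x) K.≈ sumNC n (λ π → (β ⟦ π ⟧) x K.* (β ⟦ Kr π ⟧) (replicate n y))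
      products zero {{nz}} x x∈ = ⊥-elim-irr (ℕ.NonZero.nonZero nz)
      products (suc n) x x∈ = K.trans (K.reflexive left)
        -- The products x y are read over the same letters, through the values `xy`, so that their
        -- cumulants form a series over `L` that can be compared with G.
        (K.trans (FP.cumulants-of-products ℳ 𝒩 isℳ is𝒩 free L proj₁ proj₂ y y∈ Fˣ Fʸ momentsˣ momentsʸ (pulled xy β)
          (λ w → K.trans (φ-cong (prod-xy≈ w)) (moments≈M xy β isβ w)) (letter zero) (tabulate (letter ∘ suc)))
        (K.trans (K.sym (BS.boxedSum-G n letter)) (sum-cong right (Defs.allNC (suc n)))))
        where
        letter : Fin (suc n) → L
        letter i = lookup x i , x∈ i
        left : β (suc n) (Vec.map (_* y) x) ≡ pulled xy β (tabulate letter)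
        left = ≡.trans (cong (β (suc n)) (≡.trans (cong (Vec.map (_* y)) (≡.sym (tabulate∘lookup x)))
          (≡.sym (tabulate-∘ (_* y) (lookup x))))) (≡.trans (functional-tabulate β (xy ∘ letter))
          (cong (λ w → β (length w) (fromList w)) (≡.sym (map-tabulate letter xy))))
        right : ∀ π → BS.primal Fˣ π letter K.* BS.dual Fʸ π K.≈ (β ⟦ π ⟧) x K.* (β ⟦ Kr π ⟧) (replicate (suc n) y)
        right π = K.*-cong
          (K.trans (BS.primal-all π letter) (K.sym (partition-value proj₁ β π letter x (λ _ → ≡.refl))))
          (K.trans (BS.dual-all K.refl π) (K.trans
            (others-cong {m = nothing} (krLab-Kr π) (λ k _ → K.reflexive (cong Fʸ (blockOf-cong BS.dots (just k) (krLab-Kr π)))))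
            (K.sym (partition-value (λ _ → y) β (Kr π) BS.dots (replicate (suc n) y) (λ i → lookup-replicate i y)))))

open import Defs
open import Data.Vec.Base using (Vec; lookup; map; replicate)
open import Relation.Unary using (Pred; _∈_)

mainTheorem7 : ∀ {a ℓ p} (𝒜 : NCProbabilitySpace a ℓ) → let open Space 𝒜 in
    (ℳ 𝒩 : Pred Carrier p) →
    IsUnitalSubalgebra ℳ → IsUnitalSubalgebra 𝒩 → FreelyIndependent ℳ 𝒩 →
    (t : ℝ) (β : Functionals) → IsTBooleanCumulants (fromℝ t) β →
    (n : ℕ) .{{_ : NonZero n}} (x : Vec Carrier n) → (∀ i → lookup x i ∈ ℳ) →
    (y : Carrier) → y ∈ 𝒩 →
    β n (map (λ xᵢ → xᵢ * y) x) ≃ᶜ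
    (∑[ π ∈NC n ] (β ⟦ π ⟧) x *ᶜ (β ⟦ Kr π ⟧) (replicate n y))
mainTheorem7 𝒜 ℳ 𝒩 isℳ is𝒩 free t β isβ n x x∈ y y∈ =
  Assembly.Transfer.products ℂ-commutativeRing 𝒜 ℳ 𝒩 isℳ is𝒩 free (fromℝ t) β isβ y y∈ n x x∈
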